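{- Let $K,L$ be number fields, let $k,l\ge2$ be integers, and let $A:\mathcal O_K\to\mathcal O_L$ be a $\mathbb Z$-linear map. Then the following statements satisfy the implications (a) $\Leftrightarrow$ (b) $\Rightarrow$ (c): (a) $A(V_{K,k})\subseteq V_{L,l}$. (b) $A(V_{K,k,p})\subseteq V_{L,l,p}$ for all prime numbers $p$; that is, for every prime number $p$ and every $x\in\mathcal O_K$ whose residue class modulo $p^k$ lies in $V_{K,k,p}$, the residue class of $A(x)$ modulo $p^l$ lies in $V_{L,l,p}$. (c) $A$ is the composition $M_\varepsilon\circ\tau$ of (the restriction to $\mathcal O_K$ of) a field homomorphism $\tau:K\to L$ and the multiplication map $M_\varepsilon:x\mapsto\varepsilon x$ for some $\varepsilon\in\mathcal O_L$.
   Context: For a number field $K$ with ring of integers $\mathcal O_K$ and an integer $k$, $V_{K,k}$ is the set of $k$-free integers: the set of $x\in\mathcal O_K$ with $x\notin\mathfrak p^k$ for every (nonzero) prime ideal $\mathfrak p$ of $\mathcal O_K$. For a prime number $p$, $V_{K,k,p}\subseteq\mathcal O_K/p^k\mathcal O_K$ is the set of residue classes modulo $p^k$ that are not divisible by the $k$-th power of any prime ideal dividing $p$ (i.e. classes of $x$ with $x\notin\mathfrak p^k$ for all $\mathfrak p\mid p$). -}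

module Defs where

open import Algebra.Apartness.Bundles using (HeytingField; HeytingCommutativeRing)
open import Algebra.Bundles using (CommutativeRing)
open import Algebra.Module.Bundles.Raw using (RawLeftModule)
open import Algebra.Module.Morphism.Structures using (module LeftModuleMorphisms)
open import Algebra.Morphism.Structures using (module RingMorphisms)
import Algebra.Properties.CommutativeSemigroup
import Algebra.Properties.CommutativeSemiring.Exp
import Algebra.Properties.Monoid.Sum
import Algebra.Properties.Ring
open import Data.Integer.Base as ℤ using (ℤ; +_; 0ℤ; 1ℤ; -1ℤ)
import Data.Integer.Properties as ℤ
open import Data.List.Base using (List; []; _∷_; applyUpTo; cartesianProductWith)
open import Data.List.Membership.Propositional using () renaming (_∈_ to _∈ˡ_)
open import Data.List.Membership.Propositional.Properties
  using (∈-applyUpTo⁺; ∈-applyUpTo⁻; ∈-cartesianProductWith⁺; ∈-cartesianProductWith⁻)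
open import Data.List.Relation.Unary.All as All using (All; []; _∷_)
open import Data.List.Relation.Unary.Any using (here; there)
open import Data.Nat.Base as ℕ using (ℕ; zero; suc; z≤n; s≤s)
import Data.Nat.Properties as ℕ
open import Data.Product.Base using (Σ; Σ-syntax; ∃-syntax; _×_; _,_; proj₁; proj₂)
open import Data.Rational.Base as ℚ using (ℚ)
open import Data.Rational.Literals using (fromℤ)
import Data.Rational.Properties as ℚ
import Data.Rational.Unnormalised.Base as ℚᵘ
import Data.Rational.Unnormalised.Properties as ℚᵘ
open import Data.Sum.Base using (_⊎_; inj₁; inj₂)
open import Data.Unit.Base using (⊤; tt)
open import Data.Vec.Base using (Vec; []; _∷_)
open import Data.Vec.Functional using (Vector)
open import Level using (0ℓ) renaming (suc to lsuc)
open import Relation.Binary.Bundles using (Setoid)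
open import Relation.Binary.PropositionalEquality as ≡ using (_≡_; refl; cong; cong₂)
open import Relation.Nullary.Negation using (¬_)
open import Relation.Unary using (Pred; _∈_; _∉_)

module Integrality
  (R : CommutativeRing 0ℓ 0ℓ)
  (φ : ℤ → CommutativeRing.Carrier R)
  (φ-hom : RingMorphisms.IsRingHomomorphism
             (CommutativeRing.rawRing ℤ.+-*-commutativeRing)
             (CommutativeRing.rawRing R) φ)
  where

  open CommutativeRing R hiding (zero; _-_) renaming (refl to ≈-refl)
  open RingMorphisms.IsRingHomomorphism φ-hom
    using (+-homo; *-homo; -‿homo; 0#-homo; 1#-homo)
  open Algebra.Properties.CommutativeSemiring.Exp commutativeSemiring using (_^_; ^-homo-*)
  open Algebra.Properties.Ring ring using (-‿distribˡ-*)
  module +C = Algebra.Properties.CommutativeSemigroup +-commutativeSemigroup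
  module *C = Algebra.Properties.CommutativeSemigroup *-commutativeSemigroup
  open import Relation.Binary.Reasoning.Setoid setoid

  -- ⟦ a₀ ∷ … ∷ aₙ₋₁ ∷ [] ⟧ x is a₀ + a₁ x + … + aₙ₋₁ xⁿ⁻¹.
  ⟦_⟧ : ∀ {n} → Vec ℤ n → Carrier → Carrier
  ⟦ []    ⟧ x = 0#
  ⟦ a ∷ p ⟧ x = φ a + x * ⟦ p ⟧ x

  Integral : Pred Carrier 0ℓ
  Integral x = ∃[ n ] Σ[ p ∈ Vec ℤ n ] x ^ n + ⟦ p ⟧ x ≈ 0#

  -- The integral elements form a subring: if z stabilises the ℤ-span of a
  -- finite family containing 1, fraction-free elimination on the resulting
  -- linear system over ℤ[z] yields a monic polynomial with root z.

  private
    φ0 : φ 0ℤ ≈ 0#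
    φ0 = 0#-homo
    φ1 : φ 1ℤ ≈ 1#
    φ1 = 1#-homo
    φ-1 : φ -1ℤ ≈ - 1#
    φ-1 = trans (-‿homo 1ℤ) (-‿cong φ1)

    φ-1*x : ∀ y → φ -1ℤ * y ≈ - y
    φ-1*x y = begin
      φ -1ℤ * y  ≈⟨ *-congʳ φ-1 ⟩
      - 1# * y   ≈⟨ sym (-‿distribˡ-* 1# y) ⟩
      - (1# * y) ≈⟨ -‿cong (*-identityˡ y) ⟩
      - y        ∎

    cancel : ∀ a b → (a + b) + - a ≈ b
    cancel a b = begin
      (a + b) + - a ≈⟨ +-congʳ (+-comm a b) ⟩
      (b + a) + - a ≈⟨ +-assoc b a (- a) ⟩
      b + (a + - a) ≈⟨ +-congˡ (-‿inverseʳ a) ⟩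
      b + 0#        ≈⟨ +-identityʳ b ⟩
      b             ∎

    module At (x : Carrier) where

      -- Values at x of integer polynomials of degree < d.
      P : ℕ → Pred Carrier 0ℓ
      P d y = Σ[ p ∈ Vec ℤ d ] y ≈ ⟦ p ⟧ x

      P-resp : ∀ {d y z} → z ≈ y → P d y → P d z
      P-resp e (p , h) = p , trans e h

      P-zero : ∀ d → P d 0#
      P-zero zero    = [] , ≈-refl
      P-zero (suc d) with P-zero d
      ... | p , h = 0ℤ ∷ p , sym (begin
        φ 0ℤ + x * ⟦ p ⟧ x ≈⟨ +-cong φ0 (*-congˡ (sym h)) ⟩
        0# + x * 0#        ≈⟨ +-identityˡ _ ⟩
        x * 0#             ≈⟨ zeroʳ x ⟩
        0#                 ∎)

      P-≤ : ∀ {d e y} → d ℕ.≤ e → P d y → P e y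
      P-≤ z≤n       ([] , h)    = P-resp h (P-zero _)
      P-≤ (s≤s d≤e) (a ∷ p , h) with P-≤ d≤e (p , ≈-refl)
      ... | q , h′ = a ∷ q , trans h (+-congˡ (*-congˡ h′))

      P-+ : ∀ {d y z} → P d y → P d z → P d (y + z)
      P-+ ([] , h) ([] , h′) = [] , trans (+-cong h h′) (+-identityˡ 0#)
      P-+ {y = y} {z} (a ∷ p , h) (b ∷ q , h′) with P-+ (p , ≈-refl) (q , ≈-refl)
      ... | r , h″ = a ℤ.+ b ∷ r , (begin
        y + z                                         ≈⟨ +-cong h h′ ⟩
        (φ a + x * ⟦ p ⟧ x) + (φ b + x * ⟦ q ⟧ x)     ≈⟨ +C.interchange _ _ _ _ ⟩
        (φ a + φ b) + (x * ⟦ p ⟧ x + x * ⟦ q ⟧ x)     ≈⟨ +-cong (sym (+-homo a b)) (sym (distribˡ x _ _)) ⟩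
        φ (a ℤ.+ b) + x * (⟦ p ⟧ x + ⟦ q ⟧ x)         ≈⟨ +-congˡ (*-congˡ h″) ⟩
        φ (a ℤ.+ b) + x * ⟦ r ⟧ x                     ∎)

      P-scale : ∀ {d y} c → P d y → P d (φ c * y)
      P-scale c ([] , h) = [] , trans (*-congˡ h) (zeroʳ _)
      P-scale {y = y} c (a ∷ p , h) with P-scale c (p , ≈-refl)
      ... | q , h′ = c ℤ.* a ∷ q , (begin
        φ c * y                             ≈⟨ *-congˡ h ⟩
        φ c * (φ a + x * ⟦ p ⟧ x)           ≈⟨ distribˡ _ _ _ ⟩
        φ c * φ a + φ c * (x * ⟦ p ⟧ x)     ≈⟨ +-cong (sym (*-homo c a)) (*C.x∙yz≈y∙xz _ _ _) ⟩
        φ (c ℤ.* a) + x * (φ c * ⟦ p ⟧ x)   ≈⟨ +-congˡ (*-congˡ h′) ⟩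
        φ (c ℤ.* a) + x * ⟦ q ⟧ x           ∎)

      P-neg : ∀ {d y} → P d y → P d (- y)
      P-neg h = P-resp (sym (φ-1*x _)) (P-scale -1ℤ h)

      P-x* : ∀ {d y} → P d y → P (suc d) (x * y)
      P-x* (p , h) = 0ℤ ∷ p , trans (*-congˡ h) (sym (trans (+-congʳ φ0) (+-identityˡ _)))

      P-x^* : ∀ e {d y} → P d y → P (e ℕ.+ d) (x ^ e * y)
      P-x^* zero    h = P-resp (*-identityˡ _) h
      P-x^* (suc e) h = P-resp (*-assoc _ _ _) (P-x* (P-x^* e h))

      P-* : ∀ {d e y z} → P d y → P e z → P (d ℕ.+ e) (y * z)
      P-* {e = e} ([] , h) _ = P-resp (trans (*-congʳ h) (zeroˡ _)) (P-zero e)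
      P-* {suc d} {e} {y} {z} (a ∷ p , h) k =
        P-resp eq (P-+ (P-≤ (ℕ.m≤n+m e (suc d)) (P-scale a k)) (P-x* (P-* (p , ≈-refl) k)))
        where
        eq : y * z ≈ φ a * z + x * (⟦ p ⟧ x * z)
        eq = begin
          y * z                           ≈⟨ *-congʳ h ⟩
          (φ a + x * ⟦ p ⟧ x) * z         ≈⟨ distribʳ _ _ _ ⟩
          φ a * z + (x * ⟦ p ⟧ x) * z     ≈⟨ +-congˡ (*-assoc _ _ _) ⟩
          φ a * z + x * (⟦ p ⟧ x * z)     ∎

      Monic : ℕ → Pred Carrier 0ℓ
      Monic m u = Σ[ q ∈ Carrier ] P m q × u ≈ x ^ m + q

      Monic-* : ∀ {m n u v} → Monic m u → Monic n v → Monic (m ℕ.+ n) (u * v)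
      Monic-* {m} {n} {u} {v} (q , hq , hu) (r , hr , hv) =
        x ^ m * r + (x ^ n * q + q * r) ,
        P-+ (P-x^* m hr) (P-+ (≡.subst (λ d → P d (x ^ n * q)) (ℕ.+-comm n m) (P-x^* n hq)) (P-* hq hr)) ,
        (begin
          u * v                                                    ≈⟨ *-cong hu hv ⟩
          (x ^ m + q) * (x ^ n + r)                                ≈⟨ distribʳ _ _ _ ⟩
          x ^ m * (x ^ n + r) + q * (x ^ n + r)                    ≈⟨ +-cong (distribˡ _ _ _) (distribˡ _ _ _) ⟩
          (x ^ m * x ^ n + x ^ m * r) + (q * x ^ n + q * r)        ≈⟨ +-assoc _ _ _ ⟩
          x ^ m * x ^ n + (x ^ m * r + (q * x ^ n + q * r))        ≈⟨ +-cong (sym (^-homo-* x m n)) (+-congˡ (+-congʳ (*-comm _ _))) ⟩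
          x ^ (m ℕ.+ n) + (x ^ m * r + (x ^ n * q + q * r))        ∎)

      -- Linear combinations of a family with coefficients in P d.
      Lin : ℕ → List Carrier → Pred Carrier 0ℓ
      Lin d []       y = y ≈ 0#
      Lin d (v ∷ vs) y = Σ[ q ∈ Carrier ] Σ[ r ∈ Carrier ] P d q × Lin d vs r × y ≈ q * v + r

      Lin-resp : ∀ {d} vs {y z} → z ≈ y → Lin d vs y → Lin d vs z
      Lin-resp []       e h                       = trans e h
      Lin-resp (v ∷ vs) e (q , r , hq , hr , h)   = q , r , hq , hr , trans e h

      Lin-zero : ∀ {d} vs → Lin d vs 0#
      Lin-zero         []       = ≈-refl
      Lin-zero {d = d} (v ∷ vs) = 0# , 0# , P-zero d , Lin-zero vs ,
        sym (trans (+-identityʳ _) (zeroˡ v))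

      Lin-+ : ∀ {d} vs {y z} → Lin d vs y → Lin d vs z → Lin d vs (y + z)
      Lin-+ []       h k = trans (+-cong h k) (+-identityˡ 0#)
      Lin-+ (v ∷ vs) {y} {z} (q , r , hq , hr , h) (q′ , r′ , hq′ , hr′ , h′) =
        q + q′ , r + r′ , P-+ hq hq′ , Lin-+ vs hr hr′ , (begin
          y + z                           ≈⟨ +-cong h h′ ⟩
          (q * v + r) + (q′ * v + r′)     ≈⟨ +C.interchange _ _ _ _ ⟩
          (q * v + q′ * v) + (r + r′)     ≈⟨ +-congʳ (sym (distribʳ _ _ _)) ⟩
          (q + q′) * v + (r + r′)         ∎)

      Lin-map : ∀ {d e} c → (∀ {q} → P d q → P e (c * q)) →
                ∀ vs {y} → Lin d vs y → Lin e vs (c * y)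
      Lin-map c f []       h = trans (*-congˡ h) (zeroʳ c)
      Lin-map c f (v ∷ vs) (q , r , hq , hr , h) =
        c * q , c * r , f hq , Lin-map c f vs hr ,
        trans (*-congˡ h) (trans (distribˡ _ _ _) (+-congʳ (sym (*-assoc _ _ _))))

      Lin-gen : ∀ {d} {vs} {v q} → v ∈ˡ vs → P d q → Lin d vs (q * v)
      Lin-gen {vs = _ ∷ vs} (here refl) hq =
        _ , 0# , hq , Lin-zero vs , sym (+-identityʳ _)
      Lin-gen {d} {vs = w ∷ vs} (there i) hq =
        0# , _ , P-zero d , Lin-gen i hq , sym (trans (+-congʳ (zeroˡ w)) (+-identityˡ _))

      Lin-ann : ∀ {d} vs {y} u → All (λ v → u * v ≈ 0#) vs → Lin d vs y → u * y ≈ 0#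
      Lin-ann []       u _        h = trans (*-congˡ h) (zeroʳ u)
      Lin-ann (v ∷ vs) {y} u (a ∷ as) (q , r , _ , hr , h) = begin
        u * y                 ≈⟨ *-congˡ h ⟩
        u * (q * v + r)       ≈⟨ distribˡ _ _ _ ⟩
        u * (q * v) + u * r   ≈⟨ +-cong (*C.x∙yz≈y∙xz _ _ _) (Lin-ann vs u as hr) ⟩
        q * (u * v) + 0#      ≈⟨ +-identityʳ _ ⟩
        q * (u * v)           ≈⟨ *-congˡ a ⟩
        q * 0#                ≈⟨ zeroʳ q ⟩
        0#                    ∎

      eliminate : ∀ vs d → All (λ v → Lin d vs (x ^ d * v)) vs →
                  Σ[ m ∈ ℕ ] Σ[ u ∈ Carrier ] Monic m u × All (λ v → u * v ≈ 0#) vs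
      eliminate [] d _ = 0 , 1# , (0# , P-zero 0 , sym (+-identityʳ 1#)) , []
      eliminate (v₀ ∷ vs) d ((q , r , hq , hr , h) ∷ rows) =
        let m , t , ht , ann = eliminate vs (d ℕ.+ d) (All.tabulate λ i → row i (All.lookup rows i))
            killed : ∀ {v} → t * v ≈ 0# → (t * u) * v ≈ 0#
            killed {v} e = begin
              (t * u) * v ≈⟨ *C.xy∙z≈y∙xz _ _ _ ⟩
              u * (t * v) ≈⟨ *-congˡ e ⟩
              u * 0#      ≈⟨ zeroʳ u ⟩
              0#          ∎
        in m ℕ.+ d , t * u , Monic-* ht (- q , P-neg hq , ≈-refl) ,
           trans (*-assoc t u v₀) (trans (*-congˡ uv₀) (Lin-ann vs t ann hr)) ∷
           All.map killed ann
        where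
        u = x ^ d + - q

        uv₀ : u * v₀ ≈ r
        uv₀ = begin
          (x ^ d + - q) * v₀             ≈⟨ distribʳ _ _ _ ⟩
          x ^ d * v₀ + - q * v₀          ≈⟨ +-cong h (sym (-‿distribˡ-* q v₀)) ⟩
          (q * v₀ + r) + - (q * v₀)      ≈⟨ cancel _ _ ⟩
          r                              ∎

        split : x ^ d ≈ u + q
        split = sym (begin
          (x ^ d + - q) + q   ≈⟨ +-assoc _ _ _ ⟩
          x ^ d + (- q + q)   ≈⟨ +-congˡ (-‿inverseˡ q) ⟩
          x ^ d + 0#          ≈⟨ +-identityʳ _ ⟩
          x ^ d               ∎)

        row : ∀ {v} → v ∈ˡ vs → Lin d (v₀ ∷ vs) (x ^ d * v) →
              Lin (d ℕ.+ d) vs (x ^ (d ℕ.+ d) * v)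
        row {v} i (q′ , r′ , hq′ , hr′ , h′) = Lin-resp vs eq
          (Lin-+ vs (Lin-map q′ (P-* hq′) vs hr)
          (Lin-+ vs (Lin-+ vs (Lin-map (x ^ d) (P-x^* d) vs hr′)
                              (Lin-map (- q) (P-* (P-neg hq)) vs hr′))
                    (Lin-gen i (P-x^* d hq))))
          where
          eq : x ^ (d ℕ.+ d) * v ≈ q′ * r + ((x ^ d * r′ + - q * r′) + (x ^ d * q) * v)
          eq = begin
            x ^ (d ℕ.+ d) * v                          ≈⟨ *-congʳ (^-homo-* x d d) ⟩
            (x ^ d * x ^ d) * v                        ≈⟨ *-assoc _ _ _ ⟩
            x ^ d * (x ^ d * v)                        ≈⟨ *-congʳ split ⟩
            (u + q) * (x ^ d * v)                      ≈⟨ distribʳ _ _ _ ⟩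
            u * (x ^ d * v) + q * (x ^ d * v)          ≈⟨ +-cong (*-congˡ h′) (*C.x∙yz≈yx∙z _ _ _) ⟩
            u * (q′ * v₀ + r′) + (x ^ d * q) * v       ≈⟨ +-congʳ (distribˡ _ _ _) ⟩
            (u * (q′ * v₀) + u * r′) + (x ^ d * q) * v ≈⟨ +-assoc _ _ _ ⟩
            u * (q′ * v₀) + (u * r′ + (x ^ d * q) * v) ≈⟨ +-cong
                                                            (trans (*C.x∙yz≈y∙xz _ _ _) (*-congˡ uv₀))
                                                            (+-congʳ (distribʳ _ _ _)) ⟩
            q′ * r + ((x ^ d * r′ + - q * r′) + (x ^ d * q) * v) ∎

    module Span (z : Carrier) (vs : List Carrier) where
      open At z

      S : Pred Carrier 0ℓ
      S = Lin 1 vs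

      S-scale : ∀ c {y} → S y → S (φ c * y)
      S-scale c = Lin-map (φ c) (P-scale c) vs

      S-gen : ∀ {v} → v ∈ˡ vs → S v
      S-gen i = Lin-resp vs (sym (*-identityˡ _)) (Lin-gen i
        (1ℤ ∷ [] , sym (trans (+-cong φ1 (zeroʳ z)) (+-identityʳ 1#))))

      S-poly : ∀ {k} (p : Vec ℤ k) x w → (∀ t → t ℕ.< k → S (x ^ t * w)) → S (⟦ p ⟧ x * w)
      S-poly []      x w h = Lin-resp vs (zeroˡ w) (Lin-zero vs)
      S-poly (a ∷ p) x w h = Lin-resp vs eq (Lin-+ vs
        (S-scale a (Lin-resp vs (sym (*-identityˡ w)) (h 0 (s≤s z≤n))))
        (S-poly p x (x * w) λ t t<k → Lin-resp vs (*C.x∙yz≈yx∙z _ _ _) (h (suc t) (s≤s t<k))))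
        where
        eq : (φ a + x * ⟦ p ⟧ x) * w ≈ φ a * w + ⟦ p ⟧ x * (x * w)
        eq = trans (distribʳ _ _ _) (+-congˡ (*C.xy∙z≈y∙xz _ _ _))

      S-stable : ∀ x → All (λ v → S (x * v)) vs → ∀ {y} → S y → S (x * y)
      S-stable x = go vs
        where
        go : ∀ ws → All (λ v → S (x * v)) ws → ∀ {y} → Lin 1 ws y → S (x * y)
        go []       []       h = Lin-resp vs (trans (*-congˡ h) (zeroʳ x)) (Lin-zero vs)
        go (w ∷ ws) (s ∷ ss) {y} (q , r , (a ∷ [] , hq) , hr , h) =
          Lin-resp vs eq (Lin-+ vs (S-scale a s) (go ws ss hr))
          where
          eq : x * y ≈ φ a * (x * w) + x * r
          eq = begin
            x * y                      ≈⟨ *-congˡ h ⟩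
            x * (q * w + r)            ≈⟨ distribˡ _ _ _ ⟩
            x * (q * w) + x * r        ≈⟨ +-congʳ (*C.x∙yz≈y∙xz _ _ _) ⟩
            q * (x * w) + x * r        ≈⟨ +-congʳ (*-congʳ (trans hq (trans (+-congˡ (zeroʳ z)) (+-identityʳ _)))) ⟩
            φ a * (x * w) + x * r      ∎

      stable⇒integral : S 1# → All (λ v → S (z * v)) vs → Integral z
      stable⇒integral 1∈S st =
        let m , u , (q , (p , hq) , hu) , ann =
              eliminate vs 1 (All.map (Lin-resp vs (*-congʳ (*-identityʳ z))) st)
        in m , p , (begin
          z ^ m + ⟦ p ⟧ z ≈⟨ +-congˡ (sym hq) ⟩
          z ^ m + q       ≈⟨ sym hu ⟩
          u               ≈⟨ sym (*-identityʳ u) ⟩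
          u * 1#          ≈⟨ Lin-ann vs u ann 1∈S ⟩
          0#              ∎)

    reduce : ∀ {x} → Integral x → Σ[ n ∈ ℕ ] Σ[ p ∈ Vec ℤ (suc n) ] x ^ suc n ≈ ⟦ p ⟧ x
    reduce {x} (n , p , h) =
      let q , hq = P-x* (P-neg (p , ≈-refl)) in n , q , trans (*-congˡ xⁿ≈) hq
      where
      open At x
      open Algebra.Properties.Ring ring using (+-inverseˡ-unique)
      xⁿ≈ : x ^ n ≈ - ⟦ p ⟧ x
      xⁿ≈ = +-inverseˡ-unique _ _ h

    module Grid {x y : Carrier} (ix : Integral x) (iy : Integral y) where
      n = proj₁ (reduce ix)
      m = proj₁ (reduce iy)
      p = proj₁ (proj₂ (reduce ix))
      q = proj₁ (proj₂ (reduce iy))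

      grid : List Carrier
      grid = cartesianProductWith _*_ (applyUpTo (x ^_) (suc n)) (applyUpTo (y ^_) (suc m))

      grid⁺ : ∀ {i j} → i ℕ.≤ n → j ℕ.≤ m → (x ^ i * y ^ j) ∈ˡ grid
      grid⁺ i≤n j≤m = ∈-cartesianProductWith⁺ _*_
        (∈-applyUpTo⁺ (x ^_) (s≤s i≤n)) (∈-applyUpTo⁺ (y ^_) (s≤s j≤m))

      forGrid : ∀ {Q : Pred Carrier 0ℓ} →
                (∀ {i j} → i ℕ.≤ n → j ℕ.≤ m → Q (x ^ i * y ^ j)) → All Q grid
      forGrid {Q} f = All.tabulate aux
        where
        aux : ∀ {v} → v ∈ˡ grid → Q v
        aux v∈ with ∈-cartesianProductWith⁻ _*_ (applyUpTo (x ^_) (suc n)) (applyUpTo (y ^_) (suc m)) v∈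
        ... | a , b , a∈ , b∈ , refl with ∈-applyUpTo⁻ (x ^_) a∈ | ∈-applyUpTo⁻ (y ^_) b∈
        ... | i , s≤s i≤n , refl | j , s≤s j≤m , refl = f i≤n j≤m

      module _ (z : Carrier) where
        open At z using (Lin-resp; Lin-+)
        open Span z grid

        S-x : ∀ {i j} → i ℕ.≤ n → j ℕ.≤ m → S (x * (x ^ i * y ^ j))
        S-x {i} {j} i≤n j≤m with ℕ.m≤n⇒m<n∨m≡n i≤n
        ... | inj₁ i<n  = Lin-resp grid (sym (*-assoc _ _ _)) (S-gen (grid⁺ i<n j≤m))
        ... | inj₂ refl = Lin-resp grid
          (trans (sym (*-assoc _ _ _)) (*-congʳ (proj₂ (proj₂ (reduce ix)))))
          (S-poly p x (y ^ j) λ { t (s≤s t≤n) → S-gen (grid⁺ t≤n j≤m) })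

        S-y : ∀ {i j} → i ℕ.≤ n → j ℕ.≤ m → S (y * (x ^ i * y ^ j))
        S-y {i} {j} i≤n j≤m with ℕ.m≤n⇒m<n∨m≡n j≤m
        ... | inj₁ j<m  = Lin-resp grid (*C.x∙yz≈y∙xz _ _ _) (S-gen (grid⁺ i≤n j<m))
        ... | inj₂ refl = Lin-resp grid
          (trans (*C.x∙yz≈xz∙y _ _ _) (*-congʳ (proj₂ (proj₂ (reduce iy)))))
          (S-poly q y (x ^ i) λ { t (s≤s t≤m) →
            Lin-resp grid (*-comm _ _) (S-gen (grid⁺ i≤n t≤m)) })

        integral : (∀ {i j} → i ℕ.≤ n → j ℕ.≤ m → S (z * (x ^ i * y ^ j))) → Integral z
        integral f = stable⇒integral
          (Lin-resp grid (sym (*-identityˡ 1#)) (S-gen (grid⁺ z≤n z≤n))) (forGrid f)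

  Integral-φ : ∀ a → Integral (φ a)
  Integral-φ a = 1 , ℤ.- a ∷ [] , (begin
    φ a * 1# + (φ (ℤ.- a) + φ a * 0#) ≈⟨ +-cong (*-identityʳ _) (trans (+-congˡ (zeroʳ _)) (+-identityʳ _)) ⟩
    φ a + φ (ℤ.- a)                   ≈⟨ +-congˡ (-‿homo a) ⟩
    φ a + - φ a                       ≈⟨ -‿inverseʳ _ ⟩
    0#                                ∎)

  Integral-0 : Integral 0#
  Integral-0 = 1 , 0ℤ ∷ [] , (begin
    0# * 1# + (φ 0ℤ + 0# * 0#) ≈⟨ +-cong (zeroˡ 1#) (+-cong φ0 (zeroˡ 0#)) ⟩
    0# + (0# + 0#)             ≈⟨ +-identityˡ _ ⟩
    0# + 0#                    ≈⟨ +-identityˡ _ ⟩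
    0#                         ∎)

  Integral-1 : Integral 1#
  Integral-1 = 1 , -1ℤ ∷ [] , (begin
    1# * 1# + (φ -1ℤ + 1# * 0#) ≈⟨ +-cong (*-identityˡ 1#) (+-cong φ-1 (zeroʳ 1#)) ⟩
    1# + (- 1# + 0#)            ≈⟨ +-congˡ (+-identityʳ _) ⟩
    1# + - 1#                   ≈⟨ -‿inverseʳ 1# ⟩
    0#                          ∎)

  Integral-+ : ∀ {x y} → Integral x → Integral y → Integral (x + y)
  Integral-+ {x} {y} ix iy = integral (x + y) λ i≤n j≤m →
    Lin-resp grid (distribʳ _ _ _) (Lin-+ grid (S-x (x + y) i≤n j≤m) (S-y (x + y) i≤n j≤m))
    where
    open Grid ix iy
    open At (x + y) using (Lin-resp; Lin-+)

  Integral-* : ∀ {x y} → Integral x → Integral y → Integral (x * y)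
  Integral-* {x} {y} ix iy = integral (x * y) λ i≤n j≤m →
    Lin-resp grid (*-assoc _ _ _)
      (S-stable x (forGrid (S-x (x * y))) (S-y (x * y) i≤n j≤m))
    where
    open Grid ix iy
    open At (x * y) using (Lin-resp)
    open Span (x * y) grid using (S-stable)

  Integral-neg : ∀ {x} → Integral x → Integral (- x)
  Integral-neg {x} ix = resp (φ-1*x x) (Integral-* (Integral-φ -1ℤ) ix)
    where
    open Algebra.Properties.CommutativeSemiring.Exp commutativeSemiring using (^-congˡ)
    ⟦p⟧-cong : ∀ {n} (p : Vec ℤ n) {y z} → y ≈ z → ⟦ p ⟧ y ≈ ⟦ p ⟧ z
    ⟦p⟧-cong []      e = ≈-refl
    ⟦p⟧-cong (a ∷ p) e = +-congˡ (*-cong e (⟦p⟧-cong p e))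
    resp : ∀ {y z} → y ≈ z → Integral y → Integral z
    resp e (n , p , h) = n , p , trans (+-cong (^-congˡ n (sym e)) (⟦p⟧-cong p (sym e))) h

-- A finite field extension of ℚ. The homomorphism ι from ℚ is unique when it
-- exists, and under excluded middle the tight apartness is just ¬ (x ≈ y), so
-- neither adds structure to the field.
record NumberField : Set₁ where
  field
    heytingField : HeytingField 0ℓ 0ℓ 0ℓ

  open HeytingField heytingField public using (heytingCommutativeRing)

  commutativeRing : CommutativeRing 0ℓ 0ℓ
  commutativeRing = HeytingCommutativeRing.commutativeRing heytingCommutativeRing

  open CommutativeRing commutativeRing public hiding (refl)
  open Algebra.Properties.Monoid.Sum +-monoid public using (sum)

  field
    ι     : ℚ → Carrier
    ι-hom : RingMorphisms.IsRingHomomorphism ℚ.+-*-rawRing rawRing ι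
    finite-dimensional :
      ∃[ n ] Σ[ b ∈ Vector Carrier n ]
        ∀ x → Σ[ q ∈ Vector ℚ n ] x ≈ sum (λ i → ι (q i) * b i)

  fromInt : ℤ → Carrier
  fromInt z = ι (fromℤ z)

  fromInt-hom : RingMorphisms.IsRingHomomorphism
                  (CommutativeRing.rawRing ℤ.+-*-commutativeRing) rawRing fromInt
  fromInt-hom = record
    { isSemiringHomomorphism = record
      { isNearSemiringHomomorphism = record
        { +-isMonoidHomomorphism = record
          { isMagmaHomomorphism = record
            { isRelHomomorphism = record { cong = λ e → ⟦⟧-cong (cong fromℤ e) }
            ; homo = λ a b → trans (⟦⟧-cong (fromℤ-+ a b)) (+-homo _ _)
            }
          ; ε-homo = 0#-homo
          }
        ; *-homo = λ a b → trans (⟦⟧-cong (fromℤ-* a b)) (*-homo _ _)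
        }
      ; 1#-homo = 1#-homo
      }
    ; -‿homo = λ a → trans (⟦⟧-cong (fromℤ-neg a)) (-‿homo _)
    }
    where
    open RingMorphisms.IsRingHomomorphism ι-hom

    fromℤ-+ : ∀ a b → fromℤ (a ℤ.+ b) ≡ fromℤ a ℚ.+ fromℤ b
    fromℤ-+ a b = ℚ.toℚᵘ-injective (ℚᵘ.≃-trans
      (ℚᵘ.*≡* (cong (ℤ._* 1ℤ) (≡.sym (cong₂ ℤ._+_ (ℤ.*-identityʳ a) (ℤ.*-identityʳ b)))))
      (ℚᵘ.≃-sym (ℚ.toℚᵘ-homo-+ (fromℤ a) (fromℤ b))))

    fromℤ-* : ∀ a b → fromℤ (a ℤ.* b) ≡ fromℤ a ℚ.* fromℤ b
    fromℤ-* a b = ℚ.toℚᵘ-injective (ℚᵘ.≃-sym (ℚ.toℚᵘ-homo-* (fromℤ a) (fromℤ b)))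

    fromℤ-neg : ∀ a → fromℤ (ℤ.- a) ≡ ℚ.- fromℤ a
    fromℤ-neg a = ℚ.toℚᵘ-injective (ℚᵘ.≃-sym (ℚ.toℚᵘ-homo‿- (fromℤ a)))

  open Integrality commutativeRing fromInt fromInt-hom public
    using (Integral; Integral-φ; Integral-0; Integral-1; Integral-+; Integral-*; Integral-neg)

∣_∣ : NumberField → Set
∣ K ∣ = NumberField.Carrier K

module _ (K : NumberField) where
  open NumberField K

  𝒪 : CommutativeRing 0ℓ 0ℓ
  𝒪 = record
    { Carrier = Σ Carrier Integral
    ; _≈_ = λ x y → proj₁ x ≈ proj₁ y
    ; _+_ = λ (x , p) (y , q) → x + y , Integral-+ p q
    ; _*_ = λ (x , p) (y , q) → x * y , Integral-* p q
    ; -_  = λ (x , p) → - x , Integral-neg p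
    ; 0#  = 0# , Integral-0
    ; 1#  = 1# , Integral-1
    ; isCommutativeRing = record
      { isRing = record
        { +-isAbelianGroup = record
          { isGroup = record
            { isMonoid = record
              { isSemigroup = record
                { isMagma = record
                  { isEquivalence = record
                    { refl = CommutativeRing.refl commutativeRing ; sym = sym ; trans = trans }
                  ; ∙-cong = +-cong
                  }
                ; assoc = λ _ _ _ → +-assoc _ _ _
                }
              ; identity = (λ _ → +-identityˡ _) , (λ _ → +-identityʳ _)
              }
            ; inverse = (λ _ → -‿inverseˡ _) , (λ _ → -‿inverseʳ _)
            ; ⁻¹-cong = -‿cong
            }
          ; comm = λ _ _ → +-comm _ _
          }
        ; *-cong = *-cong
        ; *-assoc = λ _ _ _ → *-assoc _ _ _
        ; *-identity = (λ _ → *-identityˡ _) , (λ _ → *-identityʳ _)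
        ; distrib = (λ _ _ _ → distribˡ _ _ _) , (λ _ _ _ → distribʳ _ _ _)
        }
      ; *-comm = λ _ _ → *-comm _ _
      }
    }

  ∣𝒪_∣ : Set
  ∣𝒪_∣ = CommutativeRing.Carrier 𝒪

  int : ℤ → CommutativeRing.Carrier 𝒪
  int z = fromInt z , Integral-φ z

  𝒪-ℤ-module : RawLeftModule ℤ 0ℓ 0ℓ
  𝒪-ℤ-module = record
    { Carrierᴹ = CommutativeRing.Carrier 𝒪
    ; _≈ᴹ_ = CommutativeRing._≈_ 𝒪
    ; _+ᴹ_ = CommutativeRing._+_ 𝒪
    ; _*ₗ_ = λ z x → CommutativeRing._*_ 𝒪 (int z) x
    ; 0ᴹ = CommutativeRing.0# 𝒪
    ; -ᴹ_ = CommutativeRing.-_ 𝒪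
    }

IsℤLinear : (K L : NumberField) → (∣𝒪 K ∣ → ∣𝒪 L ∣) → Set
IsℤLinear K L = LeftModuleMorphisms.IsLeftModuleHomomorphism (𝒪-ℤ-module K) (𝒪-ℤ-module L)

IsFieldHomomorphism : (K L : NumberField) → (∣ K ∣ → ∣ L ∣) → Set
IsFieldHomomorphism K L =
  RingMorphisms.IsRingHomomorphism (NumberField.rawRing K) (NumberField.rawRing L)

-- ε ↦ (x ↦ ε x), with values in L
M : (L : NumberField) → ∣𝒪 L ∣ → ∣ L ∣ → ∣ L ∣
M L (ε , _) x = NumberField._*_ L ε x

module Ideals (R : CommutativeRing 0ℓ 0ℓ) where
  open CommutativeRing R hiding (zero; refl)

  record IsIdeal (I : Pred Carrier 0ℓ) : Set where
    field
      resp     : ∀ {x y} → x ≈ y → x ∈ I → y ∈ I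
      0∈       : 0# ∈ I
      +-closed : ∀ {x y} → x ∈ I → y ∈ I → x + y ∈ I
      *-closed : ∀ r {x} → x ∈ I → r * x ∈ I

  record IsPrimeIdeal (𝔭 : Pred Carrier 0ℓ) : Set where
    field
      isIdeal : IsIdeal 𝔭
      proper  : 1# ∉ 𝔭
      prime   : ∀ {x y} → x * y ∈ 𝔭 → x ∈ 𝔭 ⊎ y ∈ 𝔭

    open IsIdeal isIdeal public

  NonzeroIdeal : Pred Carrier 0ℓ → Set
  NonzeroIdeal I = ∃[ x ] x ∈ I × ¬ x ≈ 0#

  -- The product ideal: all finite sums of products a b with a ∈ I and b ∈ J.
  data _·_ (I J : Pred Carrier 0ℓ) : Pred Carrier 0ℓ where
    nil  : ∀ {x} → x ≈ 0# → (I · J) x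
    cons : ∀ {a b x y} → a ∈ I → b ∈ J → x ∈ I · J → y ≈ a * b + x → (I · J) y

  infixr 8 _^ᴵ_
  _^ᴵ_ : Pred Carrier 0ℓ → ℕ → Pred Carrier 0ℓ
  I ^ᴵ zero  = λ _ → ⊤
  I ^ᴵ suc n = I · (I ^ᴵ n)

  private
    ·-isIdeal : ∀ {I J} → IsIdeal I → IsIdeal (I · J)
    ·-isIdeal {I} {J} isI = record
      { resp = resp ; 0∈ = nil (CommutativeRing.refl R) ; +-closed = plus ; *-closed = mult }
      where
      module I = IsIdeal isI

      resp : ∀ {x y} → x ≈ y → (I · J) x → (I · J) y
      resp e (nil h)        = nil (trans (sym e) h)
      resp e (cons a b x h) = cons a b x (trans (sym e) h)

      plus : ∀ {x y} → (I · J) x → (I · J) y → (I · J) (x + y)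
      plus (nil h)        k = resp (sym (trans (+-congʳ h) (+-identityˡ _))) k
      plus (cons a b x h) k = cons a b (plus x k) (trans (+-congʳ h) (+-assoc _ _ _))

      mult : ∀ r {x} → (I · J) x → (I · J) (r * x)
      mult r (nil h)        = nil (trans (*-congˡ h) (zeroʳ r))
      mult r (cons a b x h) = cons (I.*-closed r a) b (mult r x)
        (trans (*-congˡ h) (trans (distribˡ _ _ _) (+-congʳ (sym (*-assoc _ _ _)))))

  ^ᴵ-isIdeal : ∀ {I} → IsIdeal I → ∀ n → IsIdeal (I ^ᴵ n)
  ^ᴵ-isIdeal isI zero    = record
    { resp = λ _ _ → tt ; 0∈ = tt ; +-closed = λ _ _ → tt ; *-closed = λ _ _ → tt }
  ^ᴵ-isIdeal isI (suc n) = ·-isIdeal isI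

  open Algebra.Properties.Ring ring using (-‿distribʳ-*)

  -- R / m R, a class being given by a representative.
  Residues : Carrier → Setoid 0ℓ 0ℓ
  Residues m = record
    { Carrier = Carrier
    ; _≈_ = λ x y → ∃[ z ] x ≈ y + m * z
    ; isEquivalence = record
      { refl  = 0# , sym (trans (+-congˡ (zeroʳ _)) (+-identityʳ _))
      ; sym   = λ (z , h) → - z , sym (trans (+-cong h (sym (-‿distribʳ-* m z)))
                  (trans (+-assoc _ _ _) (trans (+-congˡ (-‿inverseʳ _)) (+-identityʳ _))))
      ; trans = λ (z , h) (w , k) → w + z , trans h (trans (+-congʳ k)
                  (trans (+-assoc _ _ _) (+-congˡ (sym (distribˡ m w z)))))
      }
    }

  Residues-∈ : ∀ {I m} → IsIdeal I → m ∈ I → ∀ {x y} →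
               Setoid._≈_ (Residues m) x y → y ∈ I → x ∈ I
  Residues-∈ isI m∈ (z , h) y∈ =
    resp (sym h) (+-closed y∈ (resp (*-comm _ _) (*-closed z m∈)))
    where open IsIdeal isI

  ·-∈ : ∀ {I J a b x} → a ∈ I → b ∈ J → x ≈ a * b → x ∈ I · J
  ·-∈ a∈ b∈ h = cons a∈ b∈ (nil (CommutativeRing.refl R)) (trans h (sym (+-identityʳ _)))

module _ (K : NumberField) where
  open Ideals (𝒪 K)

  V : ℕ → Pred ∣𝒪 K ∣ (lsuc 0ℓ)
  V k x = ∀ 𝔭 → IsPrimeIdeal 𝔭 → NonzeroIdeal 𝔭 → x ∉ 𝔭 ^ᴵ k

  -- 𝔭 ∣ p in the sense that 𝔭 contains p𝒪.
  infix 4 _∣ᴾ_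
  _∣ᴾ_ : Pred ∣𝒪 K ∣ 0ℓ → ℕ → Set
  𝔭 ∣ᴾ p = int K (+ p) ∈ 𝔭

  𝒪/ : ℕ → Setoid 0ℓ 0ℓ
  𝒪/ m = Residues (int K (+ m))

  class : ∀ m → ∣𝒪 K ∣ → Setoid.Carrier (𝒪/ m)
  class m x = x

  -- V-mod k p is V_{K,k,p}; by V-mod-resp it does not depend on representatives.
  V-mod : ∀ k p → Pred (Setoid.Carrier (𝒪/ (p ℕ.^ k))) (lsuc 0ℓ)
  V-mod k p x = ∀ 𝔭 → IsPrimeIdeal 𝔭 → NonzeroIdeal 𝔭 → 𝔭 ∣ᴾ p → x ∉ 𝔭 ^ᴵ k

  V-mod-resp : ∀ k p {x y} → Setoid._≈_ (𝒪/ (p ℕ.^ k)) x y → x ∈ V-mod k p → y ∈ V-mod k p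
  V-mod-resp k p {x} {y} e v 𝔭 isP nz p∈𝔭 y∈ = v 𝔭 isP nz p∈𝔭
    (Residues-∈ (^ᴵ-isIdeal (IsPrimeIdeal.isIdeal isP) k) (p^∈ k) {x} {y} e y∈)
    where
    open NumberField K using (trans)
    open RingMorphisms.IsRingHomomorphism (NumberField.fromInt-hom K)

    p^∈ : ∀ k → int K (+ (p ℕ.^ k)) ∈ 𝔭 ^ᴵ k
    p^∈ zero    = tt
    p^∈ (suc k) = ·-∈ p∈𝔭 (p^∈ k)
      (trans (⟦⟧-cong (ℤ.pos-* p (p ℕ.^ k))) (*-homo (+ p) (+ (p ℕ.^ k))))

{-# OPTIONS --safe #-}
module Submission where

-- (b) ⇒ (a): a nonzero prime ideal contains a rational prime. (a) ⇒ (b): every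
-- class modulo a power of p that is k-free at p contains a k-free element. This
-- is a sieve over a box [0,M)ⁿ in a lattice of full rank: if 0 ≠ α ∈ 𝔭² and
-- q ∈ 𝔭, then q² ≤ |O/αO| = O(size(α)ⁿ), so the points of a cell of side
-- c q^(2/n) that are bad at q belong to incomparable primes over q, of which
-- there are at most rank O. Hence the number of bad points is at most
-- O(Mⁿ Σ 1/q²) + O(number of q) < Mⁿ.
-- (b) ⇒ (c): for y ≠ 0 every η with A(x y) = η A(y) is a root of each integer
-- polynomial f with f(x) = 0. Indeed there are arbitrarily large p with a prime
-- 𝔮 ∋ p and an integer r such that η ≡ r mod 𝔮ˡ; then A((x − r) y) ∈ 𝔮ˡ, so by
-- (b) some 𝔭 ∋ p contains (x − r) y, hence x − r, whence p | f(r) and f(η) ∈ 𝔮.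
-- As f has finitely many roots, two of the elements y + j (j ∈ ℕ) have the same
-- η, and subtracting gives A(x) = η A(1) and A(x y) = η A(y). So
-- A(x y) A(1) = A(x) A(y), and τ = A / A(1) is multiplicative.

open import Axiom.ExcludedMiddle using (ExcludedMiddle)
open import Algebra.Apartness.Bundles using (HeytingField)
open import Algebra.Bundles using (CommutativeRing)
open import Algebra.Module.Morphism.Structures using (module LeftModuleMorphisms)
open import Algebra.Morphism.Structures using (module RingMorphisms)
import Algebra.Properties.CommutativeSemiring.Exp
import Algebra.Properties.Ring
import Algebra.Properties.Semiring.Sum
import Algebra.Solver.Ring
open import Algebra.Solver.Ring.AlmostCommutativeRing
  using (fromCommutativeRing; _-Raw-AlmostCommutative⟶_)
open import Data.Fin.Base as Fin using (Fin; zero; suc; punchIn)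
import Data.Fin.Properties as Fin
open import Data.Integer.Base as ℤ using (ℤ; +_; -[1+_]; 0ℤ; 1ℤ; -1ℤ)
import Data.Integer.DivMod as ℤ
open import Data.Integer.Divisibility.Signed using (∣ᵤ⇒∣; divides)
import Data.Integer.Properties as ℤ
open import Data.Integer.Tactic.RingSolver using () renaming (solve-∀ to ℤ-ring)
open import Data.List.Base as List using (List; []; _∷_; length)
open import Data.List.Membership.Propositional using () renaming (_∈_ to _∈ˡ_)
open import Data.List.Membership.Propositional.Properties using (∈-lookup; ∈-allFin)
open import Data.List.Properties using (length-tabulate)
open import Data.List.Relation.Unary.All as All using (All; []; _∷_)
open import Data.List.Relation.Unary.All.Properties using (all-filter) renaming (filter⁺ to All-filter⁺)
open import Data.List.Relation.Unary.AllPairs using ([]; _∷_)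
open import Data.List.Relation.Unary.Any using (here; there)
open import Data.List.Relation.Unary.Unique.Propositional using (Unique)
open import Data.List.Relation.Unary.Unique.Propositional.Properties using (filter⁺; allFin⁺)
open import Data.Maybe.Base as Maybe using (Maybe)
open import Data.Nat.Base as ℕ using (ℕ; zero; suc; z≤n; s≤s; _!)
open import Data.Nat.Coprimality using (Coprime; coprime-Bézout; coprime-divisor)
open import Data.Nat.Divisibility using (_∣_; _∣?_)
import Data.Nat.Divisibility as ∣
open import Data.Nat.DivMod
  using (_/_; _%_; m≡m%n+[m/n]*n; m%n<n; m<n*o⇒m/o<n; m<n⇒m/n≡0; /-monoˡ-≤; m/n*n≤m)
open import Data.Nat.GCD using (module Bézout)
open import Data.Nat.ListAction using (product)
open import Data.Nat.Primality
  using (Prime; prime⇒irreducible; prime⇒nonTrivial; euclidsLemma; prime?; ¬prime[0]; ¬prime[1])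
open import Data.Nat.Primality.Factorisation using (factorise; module PrimeFactorisation)
import Data.Nat.Properties as ℕ
open import Data.Nat.Tactic.RingSolver using () renaming (solve-∀ to ℕ-ring)
open import Data.Product.Base using (Σ; Σ-syntax; ∃-syntax; _×_; _,_; proj₁; proj₂)
open import Data.Rational.Base as ℚ using (ℚ)
open import Data.Rational.Literals using (fromℤ)
import Data.Rational.Properties as ℚ
import Data.Rational.Unnormalised.Base as ℚᵘ
import Data.Rational.Unnormalised.Properties as ℚᵘ
open import Data.Sum.Base using (_⊎_; inj₁; inj₂; [_,_]′)
open import Data.Vec.Base as Vec using (Vec; []; _∷_)
open import Data.Vec.Functional as Vector using ()
open import Data.Vec.Functional.Properties using (insertAt-lookup; insertAt-punchIn)
open import Data.Vec.Properties using (lookup∘tabulate; lookup-map)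
open import Function.Base using (_∘_)
open import Function.Bundles using (_⇔_; mk⇔)
open import Level using (0ℓ; lift; lower; Lift) renaming (suc to lsuc)
open import Relation.Binary.Definitions using (tri<; tri≈; tri>)
open import Relation.Binary.PropositionalEquality as ≡ using (_≡_; _≢_; refl; cong; cong₂; subst)
open import Relation.Nullary.Decidable using (Dec; yes; no; ¬?; map′; decidable-stable; dec⇒maybe)
open import Relation.Nullary.Negation using (¬_; contradiction)
open import Relation.Unary using (Pred; _∈_; _∉_)
open import Defs

module ℤΣ = Algebra.Properties.Semiring.Sum ℤ.+-*-semiring
module ℕΣ = Algebra.Properties.Semiring.Sum ℕ.+-*-semiring

decide : ExcludedMiddle (lsuc 0ℓ) → (P : Set) → Dec P
decide em P = map′ lower lift (em {Lift (lsuc 0ℓ) P})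

least : ExcludedMiddle (lsuc 0ℓ) → (P : ℕ → Set) → ∀ n → P n →
        Σ[ m ∈ ℕ ] P m × (∀ k → P k → m ℕ.≤ k)
least em P zero    p = 0 , p , λ _ _ → z≤n
least em P (suc n) p with decide em (P 0)
... | yes p₀ = 0 , p₀ , λ _ _ → z≤n
... | no ¬p₀ with least em (P ∘ suc) n p
...   | m , q , min = suc m , q , λ { zero h → contradiction h ¬p₀ ; (suc k) h → s≤s (min k h) }

-- Linear algebra over ℤ

private
  eliminate-sum : ∀ {n} (a y : ℤ) (c u v : Fin n → ℤ) →
    ℤ.- ℤΣ.sum (λ k → c k ℤ.* u k) ℤ.* y ℤ.+ ℤΣ.sum (λ k → a ℤ.* c k ℤ.* v k) ≡
    ℤΣ.sum (λ k → c k ℤ.* (a ℤ.* v k ℤ.- u k ℤ.* y))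
  eliminate-sum {zero}  a y c u v = refl
  eliminate-sum {suc n} a y c u v = ≡.trans
    (regroup (c zero) (u zero) a (v zero) y _ _)
    (cong (ℤ._+_ (c zero ℤ.* (a ℤ.* v zero ℤ.- u zero ℤ.* y))) (eliminate-sum a y (c ∘ suc) (u ∘ suc) (v ∘ suc)))
    where
    regroup : ∀ c u a v y s t →
      ℤ.- (c ℤ.* u ℤ.+ s) ℤ.* y ℤ.+ (a ℤ.* c ℤ.* v ℤ.+ t) ≡
      c ℤ.* (a ℤ.* v ℤ.- u ℤ.* y) ℤ.+ (ℤ.- s ℤ.* y ℤ.+ t)
    regroup = ℤ-ring

linearly-dependent : ∀ n (v : Fin (suc n) → Fin n → ℤ) →
  Σ[ c ∈ (Fin (suc n) → ℤ) ] (∃[ i ] c i ≢ 0ℤ) × (∀ k → ℤΣ.sum (λ i → c i ℤ.* v i k) ≡ 0ℤ)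
linearly-dependent zero    v = (λ _ → 1ℤ) , (zero , λ ()) , λ ()
linearly-dependent (suc n) v with Fin.any? (λ i → ¬? (v i zero ℤ.≟ 0ℤ))
... | no ¬pivot =
  let c , (i , cᵢ≢0) , rel = linearly-dependent n (λ i k → v (suc i) (suc k))
      column₀ : ∀ i → v i zero ≡ 0ℤ
      column₀ i = decidable-stable (v i zero ℤ.≟ 0ℤ) (λ ne → ¬pivot (i , ne))
  in 0ℤ Vector.∷ c , (suc i , cᵢ≢0) , λ where
    zero    → ≡.trans (ℤ.+-identityˡ _) (≡.trans
                (ℤΣ.sum-cong-≗ (λ i → ≡.trans (cong (c i ℤ.*_) (column₀ (suc i))) (ℤ.*-zeroʳ (c i))))
                (ℤΣ.sum-replicate-zero (suc n)))
    (suc k) → ≡.trans (ℤ.+-identityˡ _) (rel k)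
... | yes (j , a≢0) = c , (punchIn j (proj₁ nonzero) , nonzero′) , relation
  where
  a = v j zero
  w = λ (k : Fin (suc n)) l → a ℤ.* v (punchIn j k) l ℤ.- v (punchIn j k) zero ℤ.* v j l
  rec = linearly-dependent n (λ k l → w k (suc l))
  c′ = proj₁ rec
  nonzero = proj₁ (proj₂ rec)
  c₀ = ℤ.- ℤΣ.sum (λ k → c′ k ℤ.* v (punchIn j k) zero)
  c = Vector.insertAt (λ k → a ℤ.* c′ k) j c₀
  nonzero′ : c (punchIn j (proj₁ nonzero)) ≢ 0ℤ
  nonzero′ e with ℤ.i*j≡0⇒i≡0∨j≡0 a (≡.trans (≡.sym (insertAt-punchIn (λ k → a ℤ.* c′ k) j c₀ _)) e)
  ... | inj₁ h = a≢0 h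
  ... | inj₂ h = proj₂ nonzero h
  rows : ∀ l → ℤΣ.sum (λ k → c′ k ℤ.* w k l) ≡ 0ℤ
  rows zero = ≡.trans (ℤΣ.sum-cong-≗ λ k → cancel (c′ k) a (v (punchIn j k) zero))
                      (ℤΣ.sum-replicate-zero (suc n))
    where
    cancel : ∀ c a u → c ℤ.* (a ℤ.* u ℤ.- u ℤ.* a) ≡ 0ℤ
    cancel = ℤ-ring
  rows (suc l) = proj₂ (proj₂ rec) l
  open ≡.≡-Reasoning
  relation : ∀ l → ℤΣ.sum (λ i → c i ℤ.* v i l) ≡ 0ℤ
  relation l = begin
    ℤΣ.sum (λ i → c i ℤ.* v i l)
      ≡⟨ ℤΣ.sum-remove {i = j} (λ i → c i ℤ.* v i l) ⟩
    c j ℤ.* v j l ℤ.+ ℤΣ.sum (λ k → c (punchIn j k) ℤ.* v (punchIn j k) l)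
      ≡⟨ cong₂ ℤ._+_ (cong (ℤ._* v j l) (insertAt-lookup (λ k → a ℤ.* c′ k) j c₀))
           (ℤΣ.sum-cong-≗ λ k → cong (ℤ._* v (punchIn j k) l) (insertAt-punchIn (λ k → a ℤ.* c′ k) j c₀ k)) ⟩
    c₀ ℤ.* v j l ℤ.+ ℤΣ.sum (λ k → a ℤ.* c′ k ℤ.* v (punchIn j k) l)
      ≡⟨ eliminate-sum a (v j l) c′ (λ k → v (punchIn j k) zero) (λ k → v (punchIn j k) l) ⟩
    ℤΣ.sum (λ k → c′ k ℤ.* w k l)
      ≡⟨ rows l ⟩
    0ℤ ∎

norm : ∀ {n} → (Fin n → ℤ) → ℕ
norm m = ℕΣ.sum (λ i → ℤ.∣ m i ∣)

∣i∣≤norm : ∀ {n} (m : Fin n → ℤ) i → ℤ.∣ m i ∣ ℕ.≤ norm m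
∣i∣≤norm m zero    = ℕ.m≤m+n _ _
∣i∣≤norm m (suc i) = ℕ.≤-trans (∣i∣≤norm (m ∘ suc) i) (ℕ.m≤n+m _ _)

norm-cong : ∀ {n} {m m′ : Fin n → ℤ} → (∀ i → m i ≡ m′ i) → norm m ≡ norm m′
norm-cong e = ℕΣ.sum-cong-≗ (λ i → cong ℤ.∣_∣ (e i))

norm≡0⇒≡0 : ∀ {n} (m : Fin n → ℤ) → norm m ≡ 0 → ∀ i → m i ≡ 0ℤ
norm≡0⇒≡0 m e i = ℤ.∣i∣≡0⇒i≡0 (ℕ.n≤0⇒n≡0 (subst (ℤ.∣ m i ∣ ℕ.≤_) e (∣i∣≤norm m i)))

norm-0 : ∀ n → norm {n} (λ _ → 0ℤ) ≡ 0
norm-0 n = ℕΣ.sum-replicate-zero n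

norm-+ : ∀ {n} (m m′ : Fin n → ℤ) → norm (λ i → m i ℤ.+ m′ i) ℕ.≤ norm m ℕ.+ norm m′
norm-+ {zero}  m m′ = z≤n
norm-+ {suc n} m m′ = ℕ.≤-trans
  (ℕ.+-mono-≤ (ℤ.∣i+j∣≤∣i∣+∣j∣ (m zero) (m′ zero)) (norm-+ (m ∘ suc) (m′ ∘ suc)))
  (ℕ.≤-reflexive (interchange ℤ.∣ m zero ∣ ℤ.∣ m′ zero ∣ _ _))
  where
  interchange : ∀ a b c d → (a ℕ.+ b) ℕ.+ (c ℕ.+ d) ≡ (a ℕ.+ c) ℕ.+ (b ℕ.+ d)
  interchange = ℕ-ring

norm-* : ∀ {n} z (m : Fin n → ℤ) → norm (λ i → z ℤ.* m i) ≡ ℤ.∣ z ∣ ℕ.* norm m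
norm-* z m = ≡.trans (ℕΣ.sum-cong-≗ λ i → ℤ.abs-* z (m i))
                     (≡.sym (ℕΣ.*-distribˡ-sum ℤ.∣ z ∣ (λ i → ℤ.∣ m i ∣)))

norm-≤ : ∀ {n} (m : Fin n → ℤ) b → (∀ i → ℤ.∣ m i ∣ ℕ.≤ b) → norm m ℕ.≤ n ℕ.* b
norm-≤ {zero}  m b h = z≤n
norm-≤ {suc n} m b h = ℕ.+-mono-≤ (h zero) (norm-≤ (m ∘ suc) b (h ∘ suc))

exponential-beats-constant : ∀ e c d → c ℕ.< d → Σ[ j ∈ ℕ ] e ℕ.* c ℕ.^ suc j ℕ.< d ℕ.^ suc j
exponential-beats-constant e c d c<d = e ℕ.* c , ℕ.<-≤-trans
  (ℕ.≤-trans (s≤s (ℕ.≤-reflexive (assoc e c (c ℕ.^ j)))) (bernoulli c j)) (ℕ.^-monoˡ-≤ (suc j) c<d)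
  where
  j = e ℕ.* c
  assoc : ∀ e c x → e ℕ.* (c ℕ.* x) ≡ e ℕ.* c ℕ.* x
  assoc = ℕ-ring
  bernoulli : ∀ c j → suc (j ℕ.* c ℕ.^ j) ℕ.≤ suc c ℕ.^ suc j
  bernoulli c j = ℕ.≤-trans (ℕ.+-mono-≤ {x = 1} (ℕ.m^n>0 (suc c) j) ℕ.≤-refl)
    (ℕ.+-monoʳ-≤ (suc c ℕ.^ j) (grow j))
    where
    open ℕ.≤-Reasoning
    grow : ∀ j → j ℕ.* c ℕ.^ j ℕ.≤ c ℕ.* suc c ℕ.^ j
    grow zero    = z≤n
    grow (suc j) = begin
      c ℕ.^ suc j ℕ.+ j ℕ.* (c ℕ.* c ℕ.^ j) ≡⟨ cong (ℕ._+_ (c ℕ.^ suc j)) (swap j c (c ℕ.^ j)) ⟩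
      c ℕ.* c ℕ.^ j ℕ.+ c ℕ.* (j ℕ.* c ℕ.^ j) ≤⟨ ℕ.+-mono-≤ (ℕ.*-monoʳ-≤ c (ℕ.^-monoˡ-≤ j (ℕ.n≤1+n c))) (ℕ.*-monoʳ-≤ c (grow j)) ⟩
      c ℕ.* suc c ℕ.^ j ℕ.+ c ℕ.* (c ℕ.* suc c ℕ.^ j) ≡⟨ ≡.sym (ℕ.*-distribˡ-+ c (suc c ℕ.^ j) (c ℕ.* suc c ℕ.^ j)) ⟩
      c ℕ.* (suc c ℕ.^ j ℕ.+ c ℕ.* suc c ℕ.^ j) ∎
      where
      swap : ∀ a b c → a ℕ.* (b ℕ.* c) ≡ b ℕ.* (a ℕ.* c)
      swap = ℕ-ring

^-distribʳ-* : ∀ n a b → (a ℕ.* b) ℕ.^ n ≡ a ℕ.^ n ℕ.* b ℕ.^ n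
^-distribʳ-* zero    a b = refl
^-distribʳ-* (suc n) a b = ≡.trans (cong (a ℕ.* b ℕ.*_) (^-distribʳ-* n a b)) (interchange a b (a ℕ.^ n) (b ℕ.^ n))
  where
  interchange : ∀ a b c d → a ℕ.* b ℕ.* (c ℕ.* d) ≡ a ℕ.* c ℕ.* (b ℕ.* d)
  interchange = ℕ-ring

bézout : ∀ {m n} → Coprime m n → Σ[ u ∈ ℤ ] Σ[ v ∈ ℤ ] u ℤ.* + m ℤ.+ v ℤ.* + n ≡ 1ℤ
bézout {m} {n} c with coprime-Bézout c
... | Bézout.+- x y e = + x , ℤ.- + y , (begin
  + x ℤ.* + m ℤ.+ ℤ.- + y ℤ.* + n ≡⟨ cong (ℤ._+ (ℤ.- + y ℤ.* + n)) (≡.sym (cast e)) ⟩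
  (1ℤ ℤ.+ + y ℤ.* + n) ℤ.+ ℤ.- + y ℤ.* + n ≡⟨ cancel (+ y) (+ n) ⟩
  1ℤ ∎)
  where
  open ≡.≡-Reasoning
  cast : 1 ℕ.+ y ℕ.* n ≡ x ℕ.* m → 1ℤ ℤ.+ + y ℤ.* + n ≡ + x ℤ.* + m
  cast e = ≡.trans (cong (ℤ._+_ 1ℤ) (≡.sym (ℤ.pos-* y n))) (≡.trans (cong +_ e) (ℤ.pos-* x m))
  cancel : ∀ y n → (1ℤ ℤ.+ y ℤ.* n) ℤ.+ ℤ.- y ℤ.* n ≡ 1ℤ
  cancel = ℤ-ring
... | Bézout.-+ x y e = ℤ.- + x , + y , (begin
  ℤ.- + x ℤ.* + m ℤ.+ + y ℤ.* + n ≡⟨ cong (ℤ._+_ (ℤ.- + x ℤ.* + m)) (≡.sym (cast e)) ⟩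
  ℤ.- + x ℤ.* + m ℤ.+ (1ℤ ℤ.+ + x ℤ.* + m) ≡⟨ cancel (+ x) (+ m) ⟩
  1ℤ ∎)
  where
  open ≡.≡-Reasoning
  cast : 1 ℕ.+ x ℕ.* m ≡ y ℕ.* n → 1ℤ ℤ.+ + x ℤ.* + m ≡ + y ℤ.* + n
  cast e = ≡.trans (cong (ℤ._+_ 1ℤ) (≡.sym (ℤ.pos-* x m))) (≡.trans (cong +_ e) (ℤ.pos-* y n))
  cancel : ∀ x m → ℤ.- x ℤ.* m ℤ.+ (1ℤ ℤ.+ x ℤ.* m) ≡ 1ℤ
  cancel = ℤ-ring

prime∤⇒coprime : ∀ {p m} → Prime p → ¬ p ∣ m → Coprime p m
prime∤⇒coprime P p∤m (d∣p , d∣m) with prime⇒irreducible P d∣p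
... | inj₁ d≡1  = d≡1
... | inj₂ refl = contradiction d∣m p∤m

eval : ∀ {n} → Vec ℤ n → ℤ → ℤ
eval []      r = 0ℤ
eval (a ∷ p) r = a ℤ.+ r ℤ.* eval p r

module IntegerCoefficients (R : CommutativeRing 0ℓ 0ℓ) (φ : ℤ → CommutativeRing.Carrier R)
  (φ-hom : RingMorphisms.IsRingHomomorphism
             (CommutativeRing.rawRing ℤ.+-*-commutativeRing) (CommutativeRing.rawRing R) φ) where
  open CommutativeRing R hiding (zero) renaming (refl to ≈-refl; sym to ≈-sym; trans to ≈-trans)
  open RingMorphisms.IsRingHomomorphism φ-hom public
    using () renaming (+-homo to φ-+; *-homo to φ-*; -‿homo to φ-neg; 0#-homo to φ-0; 1#-homo to φ-1; ⟦⟧-cong to φ-cong)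
  open Integrality R φ φ-hom using (⟦_⟧)
  open Algebra.Properties.CommutativeSemiring.Exp commutativeSemiring using (_^_)
  open Algebra.Properties.Semiring.Sum semiring using (sum; sum-cong-≋; *-distribˡ-sum)
  open import Relation.Binary.Reasoning.Setoid setoid

  φ-morphism : CommutativeRing.rawRing ℤ.+-*-commutativeRing -Raw-AlmostCommutative⟶ fromCommutativeRing R
  φ-morphism = record { ⟦_⟧ = φ ; +-homo = φ-+ ; *-homo = φ-* ; -‿homo = φ-neg ; 0-homo = φ-0 ; 1-homo = φ-1 }

  private
    module Solver = Algebra.Solver.Ring
      (CommutativeRing.rawRing ℤ.+-*-commutativeRing) (fromCommutativeRing R) φ-morphism
      (λ i j → Maybe.map φ-cong (dec⇒maybe (i ℤ.≟ j)))
  open Solver public using (solve; _:=_; _:+_; _:*_; _:-_; :-_; con)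

  x-y≈0⇒x≈y : ∀ x y → x - y ≈ 0# → x ≈ y
  x-y≈0⇒x≈y x y h = begin
    x ≈⟨ solve 2 (λ x y → x := (x :- y) :+ y) ≈-refl x y ⟩
    (x - y) + y ≈⟨ +-congʳ h ⟩
    0# + y ≈⟨ +-identityˡ y ⟩
    y ∎

  cancelˡ : (∀ {x y} → ¬ x ≈ 0# → x * y ≈ 0# → y ≈ 0#) → ∀ {x y z} → ¬ x ≈ 0# → x * y ≈ x * z → y ≈ z
  cancelˡ no-zero-divisor {x} {y} {z} x≉0 h = x-y≈0⇒x≈y y z (no-zero-divisor x≉0 (begin
    x * (y - z) ≈⟨ solve 3 (λ x y z → x :* (y :- z) := x :* y :- x :* z) ≈-refl x y z ⟩
    x * y - x * z ≈⟨ +-congʳ h ⟩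
    x * z - x * z ≈⟨ -‿inverseʳ _ ⟩
    0# ∎))

  ⟦⟧-tabulate : ∀ {n} (c : Fin n → ℤ) x → sum (λ i → φ (c i) * x ^ Fin.toℕ i) ≈ ⟦ Vec.tabulate c ⟧ x
  ⟦⟧-tabulate {zero}  c x = ≈-refl
  ⟦⟧-tabulate {suc n} c x = +-cong (*-identityʳ _) (begin
    sum (λ i → φ (c (suc i)) * (x * x ^ Fin.toℕ i))
      ≈⟨ sum-cong-≋ (λ i → solve 3 (λ a x y → a :* (x :* y) := x :* (a :* y)) ≈-refl (φ (c (suc i))) x (x ^ Fin.toℕ i)) ⟩
    sum (λ i → x * (φ (c (suc i)) * x ^ Fin.toℕ i))
      ≈⟨ ≈-sym (*-distribˡ-sum x (λ i → φ (c (suc i)) * x ^ Fin.toℕ i)) ⟩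
    x * sum (λ i → φ (c (suc i)) * x ^ Fin.toℕ i)
      ≈⟨ *-congˡ (⟦⟧-tabulate (c ∘ suc) x) ⟩
    x * ⟦ Vec.tabulate (c ∘ suc) ⟧ x ∎)

-- What the proof uses of the ring of integers of a number field.
record NumberRing : Set₁ where
  field
    commutativeRing : CommutativeRing 0ℓ 0ℓ
    φ     : ℤ → CommutativeRing.Carrier commutativeRing
    φ-hom : RingMorphisms.IsRingHomomorphism
              (CommutativeRing.rawRing ℤ.+-*-commutativeRing) (CommutativeRing.rawRing commutativeRing) φ
  open CommutativeRing commutativeRing public
    hiding (zero) renaming (refl to ≈-refl; sym to ≈-sym; trans to ≈-trans)
  open Integrality commutativeRing φ φ-hom public using (⟦_⟧; Integral)
  open Algebra.Properties.CommutativeSemiring.Exp commutativeSemiring public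
    using () renaming (_^_ to _^ᴿ_)
  open Algebra.Properties.Semiring.Sum semiring public
    using (sum)
  field
    1≉0             : ¬ 1# ≈ 0#
    no-zero-divisor : ∀ {x y} → ¬ x ≈ 0# → x * y ≈ 0# → y ≈ 0#
    φ-injective     : ∀ {z} → φ z ≈ 0# → z ≡ 0ℤ
    integral        : ∀ x → Integral x
    rank            : ℕ
    dependent       : (v : Fin (suc rank) → Carrier) →
      Σ[ c ∈ (Fin (suc rank) → ℤ) ] (∃[ i ] c i ≢ 0ℤ) × sum (λ i → φ (c i) * v i) ≈ 0#

module Arithmetic (em : ExcludedMiddle (lsuc 0ℓ)) (N : NumberRing) where
  open NumberRing N public
  open IntegerCoefficients commutativeRing φ φ-hom public
  open Ideals commutativeRing public
  open import Relation.Binary.Reasoning.Setoid setoid public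
  open Algebra.Properties.Ring ring public using (-‿distribʳ-*)

  ℕφ : ℕ → Carrier
  ℕφ n = φ (+ n)

  ℕφ-* : ∀ m n → ℕφ (m ℕ.* n) ≈ ℕφ m * ℕφ n
  ℕφ-* m n = ≈-trans (φ-cong (ℤ.pos-* m n)) (φ-* (+ m) (+ n))

  φ≉0 : ∀ {z} → z ≢ 0ℤ → ¬ φ z ≈ 0#
  φ≉0 z≢0 h = z≢0 (φ-injective h)

  *-cancelˡ : ∀ {x y z} → ¬ x ≈ 0# → x * y ≈ x * z → y ≈ z
  *-cancelˡ = cancelˡ no-zero-divisor

  *≉0 : ∀ {x y} → ¬ x ≈ 0# → ¬ y ≈ 0# → ¬ x * y ≈ 0#
  *≉0 x≉0 y≉0 h = y≉0 (no-zero-divisor x≉0 h)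

  -- Integer polynomials

  annihilating-polynomial : ∀ x →
    Σ[ p ∈ Vec ℤ (suc rank) ] (∃[ i ] Vec.lookup p i ≢ 0ℤ) × ⟦ p ⟧ x ≈ 0#
  annihilating-polynomial x =
    let c , (i , cᵢ≢0) , rel = dependent (λ i → x ^ᴿ Fin.toℕ i)
    in Vec.tabulate c ,
       (i , λ e → cᵢ≢0 (≡.trans (≡.sym (lookup∘tabulate c i)) e)) ,
       ≈-trans (≈-sym (⟦⟧-tabulate c x)) rel

  ⟦⟧-φ : ∀ {n} (p : Vec ℤ n) r → ⟦ p ⟧ (φ r) ≈ φ (eval p r)
  ⟦⟧-φ []      r = ≈-sym φ-0
  ⟦⟧-φ (a ∷ p) r = ≈-sym (begin
    φ (a ℤ.+ r ℤ.* eval p r) ≈⟨ φ-+ _ _ ⟩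
    φ a + φ (r ℤ.* eval p r) ≈⟨ +-congˡ (φ-* _ _) ⟩
    φ a + φ r * φ (eval p r) ≈⟨ +-congˡ (*-congˡ (≈-sym (⟦⟧-φ p r))) ⟩
    φ a + φ r * ⟦ p ⟧ (φ r) ∎)

  cofactor : ∀ {x} → ¬ x ≈ 0# → Σ[ e ∈ Carrier ] Σ[ c ∈ ℕ ] x * e ≈ ℕφ (suc c)
  cofactor {x} x≉0 = go _ (proj₁ (proj₂ (integral x))) (proj₂ (proj₂ (integral x)))
    where
    go : ∀ n (p : Vec ℤ n) → x ^ᴿ n + ⟦ p ⟧ x ≈ 0# → Σ[ e ∈ Carrier ] Σ[ c ∈ ℕ ] x * e ≈ ℕφ (suc c)
    go zero    []      h = contradiction (≈-trans (≈-sym (+-identityʳ 1#)) h) 1≉0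
    go (suc n) (a ∷ p) h = by-constant a (begin
      x * (x ^ᴿ n + ⟦ p ⟧ x) ≈⟨ solve 4 (λ x y z a → x :* (y :+ z) := (x :* y :+ (a :+ x :* z)) :- a) ≈-refl x _ _ (φ a) ⟩
      (x * x ^ᴿ n + (φ a + x * ⟦ p ⟧ x)) - φ a ≈⟨ +-congʳ h ⟩
      0# - φ a ≈⟨ +-identityˡ _ ⟩
      - φ a ≈⟨ ≈-sym (φ-neg a) ⟩
      φ (ℤ.- a) ∎)
      where
      by-constant : ∀ a → x * (x ^ᴿ n + ⟦ p ⟧ x) ≈ φ (ℤ.- a) → Σ[ e ∈ Carrier ] Σ[ c ∈ ℕ ] x * e ≈ ℕφ (suc c)
      by-constant (+ zero)   k = go n p (no-zero-divisor x≉0 (≈-trans k φ-0))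
      by-constant (+ suc c)  k = - (x ^ᴿ n + ⟦ p ⟧ x) , c , (begin
        x * - (x ^ᴿ n + ⟦ p ⟧ x) ≈⟨ ≈-sym (-‿distribʳ-* x _) ⟩
        - (x * (x ^ᴿ n + ⟦ p ⟧ x)) ≈⟨ -‿cong k ⟩
        - φ -[1+ c ] ≈⟨ ≈-sym (φ-neg -[1+ c ]) ⟩
        ℕφ (suc c) ∎)
      by-constant -[1+ c ]   k = x ^ᴿ n + ⟦ p ⟧ x , c , k

  -- Ideals

  module Ideal {I : Pred Carrier 0ℓ} (isI : IsIdeal I) where
    open IsIdeal isI public

    *-closedʳ : ∀ {x} r → x ∈ I → x * r ∈ I
    *-closedʳ r x∈ = resp (*-comm r _) (*-closed r x∈)

    neg-closed : ∀ {x} → x ∈ I → - x ∈ I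
    neg-closed {x} x∈ = resp (solve 1 (λ x → :- con 1ℤ :* x := :- x) ≈-refl x) (*-closed (- φ 1ℤ) x∈)

    sub-closed : ∀ {x y} → x ∈ I → y ∈ I → x - y ∈ I
    sub-closed x∈ y∈ = +-closed x∈ (neg-closed y∈)

    sum-closed : ∀ {n} (f : Fin n → Carrier) → (∀ i → f i ∈ I) → sum f ∈ I
    sum-closed {zero}  f h = 0∈
    sum-closed {suc n} f h = +-closed (h zero) (sum-closed (f ∘ suc) (h ∘ suc))

    ≡-∈ : ∀ {x y} → x - y ∈ I → y ∈ I → x ∈ I
    ≡-∈ {x} {y} d y∈ = resp (solve 2 (λ x y → (x :- y) :+ y := x) ≈-refl x y) (+-closed d y∈)

    ≡-∈′ : ∀ {x y} → x - y ∈ I → x ∈ I → y ∈ I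
    ≡-∈′ {x} {y} d x∈ = resp (solve 2 (λ x y → x :- (x :- y) := y) ≈-refl x y) (sub-closed x∈ d)

    ∣⇒∈ : ∀ {q z} → ℕφ q ∈ I → q ∣ ℤ.∣ z ∣ → φ z ∈ I
    ∣⇒∈ {q} {z} q∈ d with ∣ᵤ⇒∣ {+ q} {z} d
    ... | divides k refl = resp (≈-sym (φ-* k (+ q))) (*-closed (φ k) q∈)

    ⟦⟧-≡ : ∀ {n} (p : Vec ℤ n) {x y} → x - y ∈ I → ⟦ p ⟧ x - ⟦ p ⟧ y ∈ I
    ⟦⟧-≡ []      d = resp (≈-sym (-‿inverseʳ 0#)) 0∈
    ⟦⟧-≡ (a ∷ p) {x} {y} d = resp
      (solve 5 (λ a x y u v → (x :- y) :* u :+ y :* (u :- v) := (a :+ x :* u) :- (a :+ y :* v)) ≈-refl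
        (φ a) x y (⟦ p ⟧ x) (⟦ p ⟧ y))
      (+-closed (*-closedʳ _ d) (*-closed y (⟦⟧-≡ p d)))

  ·-isIdeal : ∀ {I J} → IsIdeal I → IsIdeal J → IsIdeal (I · J)
  ·-isIdeal {I} {J} isI isJ = record
    { resp = resp ; 0∈ = nil ≈-refl ; +-closed = plus ; *-closed = mult }
    where
    module I = IsIdeal isI

    resp : ∀ {x y} → x ≈ y → (I · J) x → (I · J) y
    resp e (nil h)        = nil (≈-trans (≈-sym e) h)
    resp e (cons a b x h) = cons a b x (≈-trans (≈-sym e) h)

    plus : ∀ {x y} → (I · J) x → (I · J) y → (I · J) (x + y)
    plus (nil h)        k = resp (≈-sym (≈-trans (+-congʳ h) (+-identityˡ _))) k
    plus (cons a b x h) k = cons a b (plus x k) (≈-trans (+-congʳ h) (+-assoc _ _ _))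

    mult : ∀ r {x} → (I · J) x → (I · J) (r * x)
    mult r (nil h)        = nil (≈-trans (*-congˡ h) (zeroʳ r))
    mult r (cons a b x h) = cons (I.*-closed r a) b (mult r x)
      (≈-trans (*-congˡ h) (≈-trans (distribˡ _ _ _) (+-congʳ (≈-sym (*-assoc _ _ _)))))

  ·-mono : ∀ {I J J′ : Pred Carrier 0ℓ} → (∀ {x} → x ∈ J → x ∈ J′) → ∀ {x} → x ∈ I · J → x ∈ I · J′
  ·-mono J⊆J′ (nil h)        = nil h
  ·-mono J⊆J′ (cons a b x h) = cons a (J⊆J′ b) (·-mono J⊆J′ x) h

  ·⊆ˡ : ∀ {I J : Pred Carrier 0ℓ} → IsIdeal I → ∀ {x} → x ∈ I · J → x ∈ I
  ·⊆ˡ isI (nil h)        = IsIdeal.resp isI (≈-sym h) (IsIdeal.0∈ isI)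
  ·⊆ˡ isI (cons {b = b} a _ x h) = IsIdeal.resp isI (≈-sym h)
    (IsIdeal.+-closed isI (Ideal.*-closedʳ isI b a) (·⊆ˡ isI x))

  ^⊆ : ∀ {I} → IsIdeal I → ∀ {k} → 1 ℕ.≤ k → ∀ {x} → x ∈ I ^ᴵ k → x ∈ I
  ^⊆ isI (s≤s _) = ·⊆ˡ isI

  ^⊆square : ∀ {I} → IsIdeal I → ∀ {k} → 2 ℕ.≤ k → ∀ {x} → x ∈ I ^ᴵ k → x ∈ I · I
  ^⊆square isI (s≤s 1≤k) = ·-mono (^⊆ isI 1≤k)

  ℕφ^∈ : ∀ {I} p → ℕφ p ∈ I → ∀ k → ℕφ (p ℕ.^ k) ∈ I ^ᴵ k
  ℕφ^∈ p p∈ zero    = _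
  ℕφ^∈ p p∈ (suc k) = ·-∈ p∈ (ℕφ^∈ p p∈ k) (ℕφ-* p (p ℕ.^ k))

  module PrimeIdeal {𝔭 : Pred Carrier 0ℓ} (is𝔭 : IsPrimeIdeal 𝔭) where
    open IsPrimeIdeal is𝔭 public using (isIdeal; proper; prime)
    open Ideal isIdeal public

    ∈⇒∣ : ∀ {q z} → Prime q → ℕφ q ∈ 𝔭 → φ z ∈ 𝔭 → q ∣ ℤ.∣ z ∣
    ∈⇒∣ {q} {z} Q q∈ z∈ = decidable-stable (q ∣? ℤ.∣ z ∣) λ q∤z →
      let u , v , e = bézout (prime∤⇒coprime Q q∤z)
      in proper (resp
        (begin
          φ u * ℕφ q + φ v * ℕφ ℤ.∣ z ∣ ≈⟨ +-cong (≈-sym (φ-* _ _)) (≈-sym (φ-* _ _)) ⟩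
          φ (u ℤ.* + q) + φ (v ℤ.* + ℤ.∣ z ∣) ≈⟨ ≈-sym (φ-+ _ _) ⟩
          φ (u ℤ.* + q ℤ.+ v ℤ.* + ℤ.∣ z ∣) ≈⟨ φ-cong e ⟩
          φ 1ℤ ≈⟨ φ-1 ⟩
          1# ∎)
        (+-closed (*-closed (φ u) q∈) (*-closed (φ v) (abs∈ z z∈))))
      where
      abs∈ : ∀ z → φ z ∈ 𝔭 → ℕφ ℤ.∣ z ∣ ∈ 𝔭
      abs∈ (+ n)     h = h
      abs∈ -[1+ n ]  h = resp (≈-sym (φ-neg -[1+ n ])) (neg-closed h)

    ∤⇒∉ : ∀ {q z} → Prime q → ℕφ q ∈ 𝔭 → ¬ q ∣ ℤ.∣ z ∣ → φ z ∉ 𝔭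
    ∤⇒∉ {z = z} Q q∈ q∤z z∈ = q∤z (∈⇒∣ {z = z} Q q∈ z∈)

    prime-below : ∀ c → ℕφ (suc c) ∈ 𝔭 → Σ[ q ∈ ℕ ] Prime q × ℕφ q ∈ 𝔭
    prime-below c h = go factors factorsPrime (subst (λ n → ℕφ n ∈ 𝔭) isFactorisation h)
      where
      open PrimeFactorisation (factorise (suc c))
      go : ∀ ps → All Prime ps → ℕφ (product ps) ∈ 𝔭 → Σ[ q ∈ ℕ ] Prime q × ℕφ q ∈ 𝔭
      go []       _        h = contradiction (resp φ-1 h) proper
      go (p ∷ ps) (P ∷ Ps) h with prime (resp (ℕφ-* p (product ps)) h)
      ... | inj₁ p∈ = p , P , p∈
      ... | inj₂ k  = go ps Ps k

    rational-prime : NonzeroIdeal 𝔭 → Σ[ q ∈ ℕ ] Prime q × ℕφ q ∈ 𝔭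
    rational-prime (x , x∈ , x≉0) =
      let e , c , h = cofactor x≉0 in prime-below c (resp h (*-closedʳ e x∈))

  prime-nonzero : ∀ {𝔭} q → Prime q → ℕφ q ∈ 𝔭 → NonzeroIdeal 𝔭
  prime-nonzero q Q q∈ = ℕφ q , q∈ , φ≉0 λ { refl → contradiction Q ¬prime[0] }

HasDenominator : (N : NumberRing) → let open NumberRing N in
  ∀ {n} → (Fin n → Carrier) → ℕ → Carrier → Set
HasDenominator N {n} b d x = Σ[ m ∈ (Fin n → ℤ) ] φ (+ d) * x ≈ sum (λ i → φ (m i) * b i)
  where open NumberRing N

-- A ℤ-lattice span ⊆ O of full rank n with (suc d) O ⊆ span; κ reads off the
-- coordinates of (suc d) x.
record Coordinates (N : NumberRing) : Set where
  open NumberRing N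
  field
    n           : ℕ
    d           : ℕ
    span        : (Fin n → ℤ) → Carrier
    κ           : Carrier → Fin n → ℤ
    κ-cong      : ∀ {x y} → x ≈ y → ∀ i → κ x i ≡ κ y i
    κ-injective : ∀ {x y} → (∀ i → κ x i ≡ κ y i) → x ≈ y
    κ-+         : ∀ x y i → κ (x + y) i ≡ κ x i ℤ.+ κ y i
    κ-scale     : ∀ z x i → κ (φ z * x) i ≡ z ℤ.* κ x i
    κ-span      : ∀ w i → κ (span w) i ≡ + suc d ℤ.* w i
    C           : ℕ
    κ-*         : ∀ x y → norm (κ (x * y)) ℕ.≤ C ℕ.* (norm (κ x) ℕ.* norm (κ y))

common-multiple : ∀ {k} (P : Fin k → ℕ → Set) → (∀ i {d e} → d ∣ e → P i d → P i e) →
                  (∀ i → Σ[ d ∈ ℕ ] P i (suc d)) → Σ[ d ∈ ℕ ] (∀ i → P i (suc d))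
common-multiple {zero}  P closed h = 0 , λ ()
common-multiple {suc k} P closed h =
  let d₀ , p₀ = h zero
      d  , p  = common-multiple (P ∘ suc) (λ i → closed (suc i)) (h ∘ suc)
  in d ℕ.+ d₀ ℕ.* suc d , λ where
       zero    → closed zero (∣.m∣m*n (suc d)) p₀
       (suc i) → closed (suc i) (∣.n∣m*n (suc d₀)) (p i)

module Lattice (em : ExcludedMiddle (lsuc 0ℓ)) (N : NumberRing) where
  open Arithmetic em N

  comb : ∀ {n} → (Fin n → Carrier) → (Fin n → ℤ) → Carrier
  comb b m = sum (λ i → φ (m i) * b i)

  comb-cong : ∀ {n} (b : Fin n → Carrier) {m m′} → (∀ i → m i ≡ m′ i) → comb b m ≈ comb b m′
  comb-cong {zero}  b e = ≈-refl
  comb-cong {suc n} b e = +-cong (*-congʳ (φ-cong (e zero))) (comb-cong (b ∘ suc) (e ∘ suc))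

  comb-0 : ∀ {n} (b : Fin n → Carrier) → comb b (λ _ → 0ℤ) ≈ 0#
  comb-0 {zero}  b = ≈-refl
  comb-0 {suc n} b = ≈-trans (+-cong (≈-trans (*-congʳ φ-0) (zeroˡ _)) (comb-0 (b ∘ suc))) (+-identityˡ 0#)

  comb-+ : ∀ {n} (b : Fin n → Carrier) m m′ → comb b (λ i → m i ℤ.+ m′ i) ≈ comb b m + comb b m′
  comb-+ {zero}  b m m′ = ≈-sym (+-identityˡ 0#)
  comb-+ {suc n} b m m′ = ≈-trans
    (+-cong (*-congʳ (φ-+ (m zero) (m′ zero))) (comb-+ (b ∘ suc) (m ∘ suc) (m′ ∘ suc)))
    (solve 5 (λ a b c s t → (a :+ b) :* c :+ (s :+ t) := (a :* c :+ s) :+ (b :* c :+ t)) ≈-refl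
      (φ (m zero)) (φ (m′ zero)) (b zero) (comb (b ∘ suc) (m ∘ suc)) (comb (b ∘ suc) (m′ ∘ suc)))

  comb-* : ∀ {n} (b : Fin n → Carrier) z m → comb b (λ i → z ℤ.* m i) ≈ φ z * comb b m
  comb-* {zero}  b z m = ≈-sym (zeroʳ (φ z))
  comb-* {suc n} b z m = ≈-trans
    (+-cong (*-congʳ (φ-* z (m zero))) (comb-* (b ∘ suc) z (m ∘ suc)))
    (solve 4 (λ z a b s → (z :* a) :* b :+ z :* s := z :* (a :* b :+ s)) ≈-refl
      (φ z) (φ (m zero)) (b zero) (comb (b ∘ suc) (m ∘ suc)))

  comb-*ˡ : ∀ {n} y (b : Fin n → Carrier) m → comb (λ i → y * b i) m ≈ y * comb b m
  comb-*ˡ {zero}  y b m = ≈-sym (zeroʳ y)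
  comb-*ˡ {suc n} y b m = ≈-trans (+-congˡ (comb-*ˡ y (b ∘ suc) (m ∘ suc)))
    (solve 4 (λ y a b s → a :* (y :* b) :+ y :* s := y :* (a :* b :+ s)) ≈-refl
      y (φ (m zero)) (b zero) (comb (b ∘ suc) (m ∘ suc)))

  Independent : ∀ {n} → (Fin n → Carrier) → Set
  Independent b = ∀ m → comb b m ≈ 0# → ∀ i → m i ≡ 0ℤ

  comb-injective : ∀ {n} {b : Fin n → Carrier} → Independent b →
                   ∀ {m m′} → comb b m ≈ comb b m′ → ∀ i → m i ≡ m′ i
  comb-injective {b = b} ind {m} {m′} e i = ℤ.i-j≡0⇒i≡j (m i) (m′ i)
    (≡.trans (cong (ℤ._+_ (m i)) (≡.sym (ℤ.-1*i≡-i (m′ i)))) (ind _ (begin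
      comb b (λ i → m i ℤ.+ -1ℤ ℤ.* m′ i) ≈⟨ comb-+ b m _ ⟩
      comb b m + comb b (λ i → -1ℤ ℤ.* m′ i) ≈⟨ +-cong e (comb-* b -1ℤ m′) ⟩
      comb b m′ + φ -1ℤ * comb b m′ ≈⟨ solve 1 (λ x → x :+ con -1ℤ :* x := con 0ℤ) ≈-refl (comb b m′) ⟩
      φ 0ℤ ≈⟨ φ-0 ⟩
      0# ∎) i))

  maximal-family : Σ[ n ∈ ℕ ] Σ[ b ∈ (Fin n → Carrier) ] Independent b ×
                   (∀ (b′ : Fin (suc n) → Carrier) → ¬ Independent b′)
  maximal-family with least em (λ n → ¬ (Σ[ b ∈ (Fin n → Carrier) ] Independent b)) (suc rank) too-many
    where
    too-many : ¬ (Σ[ b ∈ (Fin (suc rank) → Carrier) ] Independent b)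
    too-many (b , ind) = let c , (i , cᵢ≢0) , rel = dependent b in cᵢ≢0 (ind c rel i)
  ... | zero  , none , _   = contradiction ((λ ()) , λ _ _ ()) none
  ... | suc n , none , min =
    let b , ind = decidable-stable (decide em _) (λ h → ℕ.<⇒≱ ℕ.≤-refl (min n h))
    in n , b , ind , λ b′ ind′ → none (b′ , ind′)

  denominator-∣ : ∀ {n} (b : Fin n → Carrier) {d e x} → d ∣ e → HasDenominator N b d x → HasDenominator N b e x
  denominator-∣ b {d} {x = x} (∣.divides q refl) (m , h) = (λ i → + q ℤ.* m i) , (begin
    ℕφ (q ℕ.* d) * x ≈⟨ *-congʳ (ℕφ-* q d) ⟩
    (ℕφ q * ℕφ d) * x ≈⟨ *-assoc _ _ _ ⟩
    ℕφ q * (ℕφ d * x) ≈⟨ *-congˡ h ⟩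
    ℕφ q * comb b m ≈⟨ ≈-sym (comb-* b (+ q) m) ⟩
    comb b (λ i → + q ℤ.* m i) ∎)

  denominators : ∀ {n} {b : Fin n → Carrier} → Independent b →
                 (∀ (b′ : Fin (suc n) → Carrier) → ¬ Independent b′) →
                 ∀ x → Σ[ d ∈ ℕ ] HasDenominator N b (suc d) x
  denominators {n} {b} ind max x with decide em
    (Σ[ c ∈ (Fin (suc n) → ℤ) ] (∃[ i ] c i ≢ 0ℤ) × comb (x Vector.∷ b) c ≈ 0#)
  ... | no none = contradiction
    (λ c rel i → decidable-stable (c i ℤ.≟ 0ℤ) λ ne → none (c , (i , ne) , rel)) (max (x Vector.∷ b))
  ... | yes (c , (i , cᵢ≢0) , rel) = by-sign (c zero) refl
    where
    c′ = c ∘ suc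
    by-sign : ∀ c₀ → c zero ≡ c₀ → Σ[ d ∈ ℕ ] HasDenominator N b (suc d) x
    by-sign (+ zero)  e = contradiction (all-zero i) cᵢ≢0
      where
      rest : comb b c′ ≈ 0#
      rest = begin
        comb b c′ ≈⟨ solve 2 (λ x s → s := con 0ℤ :* x :+ s) ≈-refl x (comb b c′) ⟩
        φ 0ℤ * x + comb b c′ ≈⟨ +-congʳ (*-congʳ (φ-cong (≡.sym e))) ⟩
        φ (c zero) * x + comb b c′ ≈⟨ rel ⟩
        0# ∎
      all-zero : ∀ i → c i ≡ 0ℤ
      all-zero zero    = e
      all-zero (suc j) = ind c′ rest j
    by-sign (+ suc d) e = d , (λ i → -1ℤ ℤ.* c′ i) , (begin
      φ (+ suc d) * x ≈⟨ *-congʳ (φ-cong (≡.sym e)) ⟩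
      φ (c zero) * x ≈⟨ solve 2 (λ u s → u := (u :+ s) :+ con -1ℤ :* s) ≈-refl (φ (c zero) * x) (comb b c′) ⟩
      (φ (c zero) * x + comb b c′) + φ -1ℤ * comb b c′ ≈⟨ +-congʳ rel ⟩
      0# + φ -1ℤ * comb b c′ ≈⟨ +-identityˡ _ ⟩
      φ -1ℤ * comb b c′ ≈⟨ ≈-sym (comb-* b -1ℤ c′) ⟩
      comb b (λ i → -1ℤ ℤ.* c′ i) ∎)
    by-sign -[1+ d ]  e = d , c′ , (begin
      φ (+ suc d) * x ≈⟨ *-congʳ (φ-cong (≡.sym (cong ℤ.-_ e))) ⟩
      φ (ℤ.- c zero) * x ≈⟨ *-congʳ (φ-neg (c zero)) ⟩
      - φ (c zero) * x ≈⟨ solve 3 (λ u x s → :- u :* x := s :- (u :* x :+ s)) ≈-refl (φ (c zero)) x (comb b c′) ⟩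
      comb b c′ - (φ (c zero) * x + comb b c′) ≈⟨ +-congˡ (-‿cong rel) ⟩
      comb b c′ - 0# ≈⟨ +-congˡ -0#≈0# ⟩
      comb b c′ + 0# ≈⟨ +-identityʳ _ ⟩
      comb b c′ ∎)
      where open Algebra.Properties.Ring (CommutativeRing.ring commutativeRing) using (-0#≈0#)

  record Basis : Set where
    field
      {n}          : ℕ
      b            : Fin n → Carrier
      independent  : Independent b
      products     : ∀ i j → Σ[ m ∈ (Fin n → ℤ) ] b i * b j ≈ comb b m
      denominator  : ∀ x → Σ[ d ∈ ℕ ] HasDenominator N b (suc d) x

  -- Rescaling a maximal independent family by a common denominator of its
  -- products makes the lattice it spans closed under multiplication.
  basis : Basis
  basis = record
    { b           = b′
    ; independent = λ m h i → ind m (no-zero-divisor D≉0 (≈-trans (≈-sym (comb-*ˡ D b m)) h)) i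
    ; products    = λ i j → let m , h = proj₂ common i j in m , (begin
        (D * b i) * (D * b j) ≈⟨ solve 3 (λ d x y → (d :* x) :* (d :* y) := d :* (d :* (x :* y))) ≈-refl D (b i) (b j) ⟩
        D * (D * (b i * b j)) ≈⟨ *-congˡ h ⟩
        D * comb b m ≈⟨ ≈-sym (comb-*ˡ D b m) ⟩
        comb b′ m ∎)
    ; denominator = λ x → let e , m , h = den x in proj₁ common ℕ.+ e ℕ.* suc (proj₁ common) , m , (begin
        ℕφ (suc e ℕ.* suc (proj₁ common)) * x ≈⟨ *-congʳ (ℕφ-* (suc e) (suc (proj₁ common))) ⟩
        (ℕφ (suc e) * D) * x ≈⟨ solve 3 (λ e d x → (e :* d) :* x := d :* (e :* x)) ≈-refl (ℕφ (suc e)) D x ⟩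
        D * (ℕφ (suc e) * x) ≈⟨ *-congˡ h ⟩
        D * comb b m ≈⟨ ≈-sym (comb-*ˡ D b m) ⟩
        comb b′ m ∎)
    }
    where
    b   = proj₁ (proj₂ maximal-family)
    ind = proj₁ (proj₂ (proj₂ maximal-family))
    den = denominators ind (proj₂ (proj₂ (proj₂ maximal-family)))
    common : Σ[ d ∈ ℕ ] (∀ i j → HasDenominator N b (suc d) (b i * b j))
    common = common-multiple (λ i d → ∀ j → HasDenominator N b d (b i * b j))
      (λ i d∣e h j → denominator-∣ b d∣e (h j))
      (λ i → common-multiple (λ j d → HasDenominator N b d (b i * b j))
        (λ j → denominator-∣ b) (λ j → den (b i * b j)))
    D   = ℕφ (suc (proj₁ common))
    b′  = λ i → D * b i
    D≉0 : ¬ D ≈ 0#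
    D≉0 = φ≉0 λ ()

same-quotient⇒close : ∀ e d a b .{{_ : ℕ.NonZero d}} → (a ℕ.* e) / d ≡ (b ℕ.* e) / d →
                      ℤ.∣ + e ℤ.* (+ a ℤ.- + b) ∣ ℕ.≤ d
same-quotient⇒close e d a b same = ℕ.≤-trans (ℕ.≤-reflexive (cong ℤ.∣_∣ difference))
  (ℕ.≤-trans (ℤ.∣m⊝n∣≤m⊔n ρ σ) (ℕ.⊔-lub (ℕ.<⇒≤ (m%n<n (a ℕ.* e) d)) (ℕ.<⇒≤ (m%n<n (b ℕ.* e) d))))
  where
  ρ = (a ℕ.* e) % d
  σ = (b ℕ.* e) % d
  q = (a ℕ.* e) / d
  open ≡.≡-Reasoning
  split : ∀ a → + a ℤ.* + e ≡ + ((a ℕ.* e) % d) ℤ.+ + ((a ℕ.* e) / d) ℤ.* + d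
  split a = ≡.trans (≡.sym (ℤ.pos-* a e)) (≡.trans (cong +_ (m≡m%n+[m/n]*n (a ℕ.* e) d))
    (cong (ℤ._+_ (+ ((a ℕ.* e) % d))) (ℤ.pos-* ((a ℕ.* e) / d) d)))
  expand : ∀ e a b → e ℤ.* (a ℤ.- b) ≡ a ℤ.* e ℤ.- b ℤ.* e
  expand = ℤ-ring
  cancel : ∀ ρ σ qd → (ρ ℤ.+ qd) ℤ.- (σ ℤ.+ qd) ≡ ρ ℤ.- σ
  cancel = ℤ-ring
  difference : + e ℤ.* (+ a ℤ.- + b) ≡ ρ ℤ.⊖ σ
  difference = begin
    + e ℤ.* (+ a ℤ.- + b) ≡⟨ expand (+ e) (+ a) (+ b) ⟩
    + a ℤ.* + e ℤ.- + b ℤ.* + e ≡⟨ cong₂ ℤ._-_ (split a) (split b) ⟩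
    (+ ρ ℤ.+ + q ℤ.* + d) ℤ.- (+ σ ℤ.+ + ((b ℕ.* e) / d) ℤ.* + d) ≡⟨ cong (λ t → (+ ρ ℤ.+ + q ℤ.* + d) ℤ.- (+ σ ℤ.+ + t ℤ.* + d)) (≡.sym same) ⟩
    (+ ρ ℤ.+ + q ℤ.* + d) ℤ.- (+ σ ℤ.+ + q ℤ.* + d) ≡⟨ cancel (+ ρ) (+ σ) (+ q ℤ.* + d) ⟩
    + ρ ℤ.- + σ ≡⟨ ℤ.[+m]-[+n]≡m⊖n ρ σ ⟩
    ρ ℤ.⊖ σ ∎

f≤sum : ∀ {k} (f : Fin k → ℕ) i → f i ℕ.≤ ℕΣ.sum f
f≤sum f zero    = ℕ.m≤m+n _ _
f≤sum f (suc i) = ℕ.≤-trans (f≤sum (f ∘ suc) i) (ℕ.m≤n+m _ _)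

m≤n⇒m∣n! : ∀ {m n} → suc m ℕ.≤ n → suc m ∣ n !
m≤n⇒m∣n! {m} {suc n} (s≤s m≤n) with ℕ.m≤n⇒m<n∨m≡n m≤n
... | inj₁ m<n  = ∣.∣-trans (m≤n⇒m∣n! m<n) (∣.n∣m*n (suc n))
... | inj₂ refl = ∣.m∣m*n (n !)

module Discreteness (em : ExcludedMiddle (lsuc 0ℓ)) (N : NumberRing) (B : Lattice.Basis em N) where
  open Arithmetic em N
  open Lattice em N
  open Basis B

  Den : ℕ → Carrier → Set
  Den = HasDenominator N b

  den-resp : ∀ {d x y} → x ≈ y → Den d x → Den d y
  den-resp e (m , h) = m , ≈-trans (*-congˡ (≈-sym e)) h

  den-+ : ∀ {d x y} → Den d x → Den d y → Den d (x + y)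
  den-+ (m , h) (m′ , h′) = (λ i → m i ℤ.+ m′ i) ,
    ≈-trans (distribˡ _ _ _) (≈-trans (+-cong h h′) (≈-sym (comb-+ b m m′)))

  den-φ* : ∀ {d x} z → Den d x → Den d (φ z * x)
  den-φ* {d} {x} z (m , h) = (λ i → z ℤ.* m i) , (begin
    ℕφ d * (φ z * x) ≈⟨ solve 3 (λ d z x → d :* (z :* x) := z :* (d :* x)) ≈-refl (ℕφ d) (φ z) x ⟩
    φ z * (ℕφ d * x) ≈⟨ *-congˡ h ⟩
    φ z * comb b m ≈⟨ ≈-sym (comb-* b z m) ⟩
    comb b (λ i → z ℤ.* m i) ∎)

  den-0 : ∀ {d} → Den d 0#
  den-0 = (λ _ → 0ℤ) , ≈-trans (zeroʳ _) (≈-sym (comb-0 b))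

  Bounded : ℕ → Carrier → Set
  Bounded s x = Σ[ m ∈ (Fin n → ℤ) ] x ≈ comb b m × norm m ℕ.≤ s

  combination-bounded : ∀ {k} (v : Fin k → Carrier) s → (∀ i → Bounded s (v i)) →
                        ∀ c → Bounded (norm c ℕ.* s) (comb v c)
  combination-bounded {zero}  v s h c = (λ _ → 0ℤ) , ≈-sym (comb-0 b) , ℕ.≤-reflexive (norm-0 n)
  combination-bounded {suc k} v s h c =
    let m  , e  , l  = h zero
        m′ , e′ , l′ = combination-bounded (v ∘ suc) s (h ∘ suc) (c ∘ suc)
        c₀ = c zero
    in (λ i → c₀ ℤ.* m i ℤ.+ m′ i) ,
       (begin
         φ c₀ * v zero + comb (v ∘ suc) (c ∘ suc) ≈⟨ +-cong (*-congˡ e) e′ ⟩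
         φ c₀ * comb b m + comb b m′ ≈⟨ +-congʳ (≈-sym (comb-* b c₀ m)) ⟩
         comb b (λ i → c₀ ℤ.* m i) + comb b m′ ≈⟨ ≈-sym (comb-+ b (λ i → c₀ ℤ.* m i) m′) ⟩
         comb b (λ i → c₀ ℤ.* m i ℤ.+ m′ i) ∎) ,
       ℕ.≤-trans (norm-+ (λ i → c₀ ℤ.* m i) m′)
         (ℕ.≤-trans (ℕ.+-mono-≤ (ℕ.≤-trans (ℕ.≤-reflexive (norm-* c₀ m)) (ℕ.*-monoʳ-≤ ℤ.∣ c₀ ∣ l)) l′)
           (ℕ.≤-reflexive (≡.sym (ℕ.*-distribʳ-+ s ℤ.∣ c₀ ∣ (norm (c ∘ suc))))))

  C : ℕ
  C = suc (ℕΣ.sum λ i → ℕΣ.sum λ j → norm (proj₁ (products i j)))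

  product-bounded : ∀ m m′ → Bounded (C ℕ.* (norm m ℕ.* norm m′)) (comb b m * comb b m′)
  product-bounded m m′ =
    let μ , e , l = combination-bounded (λ i → comb b m′ * b i) (norm m′ ℕ.* C) row m
    in μ , ≈-trans (*-comm _ _) (≈-trans (≈-sym (comb-*ˡ (comb b m′) b m)) e) ,
       ℕ.≤-trans l (ℕ.≤-reflexive (regroup (norm m) (norm m′) C))
    where
    regroup : ∀ a b c → a ℕ.* (b ℕ.* c) ≡ c ℕ.* (a ℕ.* b)
    regroup = ℕ-ring
    row : ∀ i → Bounded (norm m′ ℕ.* C) (comb b m′ * b i)
    row i = let μ , e , l = combination-bounded (λ j → b i * b j) C entry m′
            in μ , ≈-trans (*-comm _ _) (≈-trans (≈-sym (comb-*ˡ (b i) b m′)) e) , l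
      where
      entry : ∀ j → Bounded C (b i * b j)
      entry j = proj₁ (products i j) , proj₂ (products i j) ,
        ℕ.m≤n⇒m≤1+n (ℕ.≤-trans (f≤sum (λ j → norm (proj₁ (products i j))) j)
                                (f≤sum (λ i → ℕΣ.sum λ j → norm (proj₁ (products i j))) i))

  private
    ^ᴿ-≉0 : ∀ {y} j → ¬ y ≈ 0# → ¬ y ^ᴿ j ≈ 0#
    ^ᴿ-≉0 zero    h = 1≉0
    ^ᴿ-≉0 (suc j) h = *≉0 h (^ᴿ-≉0 j h)

    degree-positive : ∀ {y} h (p : Vec ℤ h) → y ^ᴿ h + ⟦ p ⟧ y ≈ 0# → 0 ℕ.< h
    degree-positive zero    [] eq = contradiction (≈-trans (≈-sym (+-identityʳ 1#)) eq) 1≉0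
    degree-positive (suc h) _  _  = s≤s z≤n

    -- The powers y , y² , … have a common denominator, as y is integral.
    module Powers {y} (h : ℕ) (p : Vec ℤ h) (eq : y ^ᴿ h + ⟦ p ⟧ y ≈ 0#) (d : ℕ) (den-y : Den d y) where

      den-^ : ∀ j → Den (d ℕ.^ suc j) (y ^ᴿ suc j)
      den-^ zero    = subst (λ d → Den d (y * 1#)) (≡.sym (ℕ.*-identityʳ d)) (den-resp (≈-sym (*-identityʳ y)) den-y)
      den-^ (suc j) =
        let m , e = den-y ; m′ , e′ = den-^ j ; μ , k , _ = product-bounded m m′
        in μ , (begin
          ℕφ (d ℕ.* d ℕ.^ suc j) * (y * y ^ᴿ suc j)
            ≈⟨ *-congʳ (ℕφ-* d (d ℕ.^ suc j)) ⟩
          (ℕφ d * ℕφ (d ℕ.^ suc j)) * (y * y ^ᴿ suc j)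
            ≈⟨ solve 4 (λ a b c d → (a :* b) :* (c :* d) := (a :* c) :* (b :* d)) ≈-refl (ℕφ d) (ℕφ (d ℕ.^ suc j)) y (y ^ᴿ suc j) ⟩
          (ℕφ d * y) * (ℕφ (d ℕ.^ suc j) * y ^ᴿ suc j)
            ≈⟨ *-cong e e′ ⟩
          comb b m * comb b m′ ≈⟨ k ⟩
          comb b μ ∎)

      E = d ℕ.^ h

      den-⟦⟧ : ∀ {k} (q : Vec ℤ k) u → (∀ i → i ℕ.< k → Den E (y ^ᴿ i * u)) → Den E (⟦ q ⟧ y * u)
      den-⟦⟧ []      u _ = den-resp (≈-sym (zeroˡ u)) den-0
      den-⟦⟧ (a ∷ q) u w = den-resp
        (solve 4 (λ a y s u → a :* u :+ s :* (y :* u) := (a :+ y :* s) :* u) ≈-refl (φ a) y (⟦ q ⟧ y) u)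
        (den-+ (den-φ* a (den-resp (*-identityˡ u) (w 0 (s≤s z≤n))))
               (den-⟦⟧ q (y * u) λ i i<k → den-resp
                 (solve 3 (λ y t u → (y :* t) :* u := t :* (y :* u)) ≈-refl y (y ^ᴿ i) u) (w (suc i) (s≤s i<k))))

      window : ∀ s i → i ℕ.< h → Den E (y ^ᴿ i * y ^ᴿ suc s)
      window zero i i<h = den-resp
        (solve 2 (λ y t → y :* t := t :* (y :* con 1ℤ)) ≈-refl y (y ^ᴿ i) ⟨≈⟩ *-congˡ (*-congˡ φ-1))
        (denominator-∣ b (∣.∣-trans (∣.m∣m*n (d ℕ.^ (h ℕ.∸ suc i)))
          (∣.∣-reflexive (≡.trans (≡.sym (ℕ.^-distribˡ-+-* d (suc i) (h ℕ.∸ suc i))) (cong (d ℕ.^_) (ℕ.m+[n∸m]≡n i<h)))))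
          (den-^ i))
        where
        _⟨≈⟩_ = ≈-trans
      window (suc s) i i<h with ℕ.m≤n⇒m<n∨m≡n i<h
      ... | inj₁ i+1<h = den-resp
        (solve 3 (λ y t u → (y :* t) :* u := t :* (y :* u)) ≈-refl y (y ^ᴿ i) (y ^ᴿ suc s))
        (window s (suc i) i+1<h)
      ... | inj₂ refl = den-resp
        (begin
          φ -1ℤ * (⟦ p ⟧ y * u)
            ≈⟨ solve 4 (λ y t s u → con -1ℤ :* (s :* u) := t :* (y :* u) :- (y :* t :+ s) :* u) ≈-refl y (y ^ᴿ i) (⟦ p ⟧ y) u ⟩
          y ^ᴿ i * (y * u) - (y * y ^ᴿ i + ⟦ p ⟧ y) * u
            ≈⟨ +-congˡ (-‿cong (≈-trans (*-congʳ eq) (zeroˡ u))) ⟩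
          y ^ᴿ i * (y * u) - 0#
            ≈⟨ ≈-trans (+-congˡ -0#≈0#) (+-identityʳ _) ⟩
          y ^ᴿ i * (y * u) ∎)
        (den-φ* -1ℤ (den-⟦⟧ p u (window s)))
        where
        u = y ^ᴿ suc s
        open Algebra.Properties.Ring (CommutativeRing.ring commutativeRing) using (-0#≈0#)

      bounded-denominator : ∀ j → Den E (y ^ᴿ suc j)
      bounded-denominator j = den-resp (*-identityˡ _) (window j 0 (degree-positive h p eq))

  powers-bounded : ∀ {y} d m → ℕφ d * y ≈ comb b m → ∀ j →
    Σ[ μ ∈ (Fin n → ℤ) ] ℕφ (d ℕ.^ suc j) * y ^ᴿ suc j ≈ comb b μ ×
      C ℕ.* norm μ ℕ.≤ (C ℕ.* norm m) ℕ.^ suc j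
  powers-bounded {y} d m e zero = m ,
    ≈-trans (*-cong (φ-cong (cong +_ (ℕ.*-identityʳ d))) (*-identityʳ y)) e ,
    ℕ.≤-reflexive (≡.sym (ℕ.*-identityʳ _))
  powers-bounded {y} d m e (suc j) =
    let m′ , e′ , l′ = powers-bounded d m e j ; μ , k , l = product-bounded m m′
    in μ , (begin
      ℕφ (d ℕ.* d ℕ.^ suc j) * (y * y ^ᴿ suc j)
        ≈⟨ *-congʳ (ℕφ-* d (d ℕ.^ suc j)) ⟩
      (ℕφ d * ℕφ (d ℕ.^ suc j)) * (y * y ^ᴿ suc j)
        ≈⟨ solve 4 (λ a b c d → (a :* b) :* (c :* d) := (a :* c) :* (b :* d)) ≈-refl (ℕφ d) (ℕφ (d ℕ.^ suc j)) y (y ^ᴿ suc j) ⟩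
      (ℕφ d * y) * (ℕφ (d ℕ.^ suc j) * y ^ᴿ suc j)
        ≈⟨ *-cong e e′ ⟩
      comb b m * comb b m′ ≈⟨ k ⟩
      comb b μ ∎) ,
      ℕ.≤-trans (ℕ.*-monoʳ-≤ C l) (ℕ.≤-trans (ℕ.≤-reflexive (regroup C (norm m) (norm m′))) (ℕ.*-monoʳ-≤ (C ℕ.* norm m) l′))
    where
    regroup : ∀ c a b → c ℕ.* (c ℕ.* (a ℕ.* b)) ≡ (c ℕ.* a) ℕ.* (c ℕ.* b)
    regroup = ℕ-ring

  discrete : ∀ {y} d m → ℕφ d * y ≈ comb b m → C ℕ.* norm m ℕ.< d → y ≈ 0#
  discrete {y} d m e small = decidable-stable (decide em _) λ y≉0 →
    let h , p , eq = integral y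
        open Powers h p eq d (m , e)
        j , growth = exponential-beats-constant E (C ℕ.* norm m) d small
        μ , eμ , lμ = powers-bounded d m e j
        ν , eν = bounded-denominator j
        dʲ = d ℕ.^ suc j
        same : ∀ i → + dʲ ℤ.* ν i ≡ + E ℤ.* μ i
        same = comb-injective independent (begin
          comb b (λ i → + dʲ ℤ.* ν i) ≈⟨ comb-* b (+ dʲ) ν ⟩
          ℕφ dʲ * comb b ν ≈⟨ *-congˡ (≈-sym eν) ⟩
          ℕφ dʲ * (ℕφ E * y ^ᴿ suc j) ≈⟨ solve 3 (λ a b c → a :* (b :* c) := b :* (a :* c)) ≈-refl (ℕφ dʲ) (ℕφ E) (y ^ᴿ suc j) ⟩
          ℕφ E * (ℕφ dʲ * y ^ᴿ suc j) ≈⟨ *-congˡ eμ ⟩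
          ℕφ E * comb b μ ≈⟨ ≈-sym (comb-* b (+ E) μ) ⟩
          comb b (λ i → + E ℤ.* μ i) ∎)
        norms : dʲ ℕ.* norm ν ≡ E ℕ.* norm μ
        norms = ≡.trans (≡.sym (norm-* (+ dʲ) ν)) (≡.trans (norm-cong same) (norm-* (+ E) μ))
        bound : dʲ ℕ.* norm ν ℕ.< dʲ ℕ.* 1
        bound = ℕ.<-≤-trans (ℕ.≤-<-trans (ℕ.≤-trans (ℕ.≤-reflexive norms)
          (ℕ.*-monoʳ-≤ E (ℕ.≤-trans (ℕ.m≤n*m (norm μ) C) lμ))) growth) (ℕ.≤-reflexive (≡.sym (ℕ.*-identityʳ dʲ)))
        ν≡0 = norm≡0⇒≡0 ν (ℕ.n≤0⇒n≡0 (ℕ.≤-pred (ℕ.*-cancelˡ-< dʲ (norm ν) 1 bound)))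
        d≢0 : d ≢ 0
        d≢0 d≡0 = ℕ.<⇒≱ small (subst (ℕ._≤ C ℕ.* norm m) (≡.sym d≡0) z≤n)
    in ^ᴿ-≉0 (suc j) y≉0 (no-zero-divisor (φ≉0 (λ E≡0 → d≢0 (ℕ.m^n≡0⇒m≡0 d h (ℤ.+-injective E≡0))))
         (≈-trans eν (≈-trans (comb-cong b ν≡0) (comb-0 b))))

module UniformDenominator (em : ExcludedMiddle (lsuc 0ℓ)) (N : NumberRing) (B : Lattice.Basis em N) where
  open Arithmetic em N
  open Lattice em N
  open Basis B
  open Discreteness em N B

  private
    E : ℕ
    E = suc (C ℕ.* n)

  -- Among the multiples j x with j ≤ Eⁿ two agree modulo the lattice up to
  -- an element too small to be nonzero.
  uniform-denominator : ∀ x → Den ((E ℕ.^ n) !) x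
  uniform-denominator x = denominator-∣ b (m≤n⇒m∣n! t≤) (w , x-y≈0⇒x≈y _ _ y≈0)
    where
    δ = suc (proj₁ (denominator x))
    m = proj₁ (proj₂ (denominator x))
    δx≈m : ℕφ δ * x ≈ comb b m
    δx≈m = proj₂ (proj₂ (denominator x))

    r : ℕ → Fin n → ℕ
    r j i = (+ j ℤ.* m i) ℤ.%ℕ δ
    q : ℕ → Fin n → ℤ
    q j i = (+ j ℤ.* m i) ℤ./ℕ δ

    cell : ∀ j i → (r j i ℕ.* E) / δ ℕ.< E
    cell j i = m<n*o⇒m/o<n (ℕ.<-≤-trans (ℕ.*-monoˡ-< E (ℤ.n%ℕd<d (+ j ℤ.* m i) δ)) (ℕ.≤-reflexive (ℕ.*-comm δ E)))

    cells : ℕ → Fin n → Fin E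
    cells j i = Fin.fromℕ< (cell j i)

    collision = Fin.pigeonhole (ℕ.n<1+n (E ℕ.^ n)) (λ (j : Fin (suc (E ℕ.^ n))) → Fin.funToFin (cells (Fin.toℕ j)))
    j₁ = Fin.toℕ (proj₁ collision)
    j₂ = Fin.toℕ (proj₁ (proj₂ collision))

    same-cell : ∀ i → (r j₂ i ℕ.* E) / δ ≡ (r j₁ i ℕ.* E) / δ
    same-cell i = ≡.trans (≡.sym (Fin.toℕ-fromℕ< (cell j₂ i)))
      (≡.trans (cong Fin.toℕ (≡.sym (≡.trans (≡.sym (Fin.finToFun-funToFin (cells j₁) i))
        (≡.trans (cong (λ c → Fin.finToFun c i) (proj₂ (proj₂ (proj₂ collision)))) (Fin.finToFun-funToFin (cells j₂) i)))))
        (Fin.toℕ-fromℕ< (cell j₁ i)))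

    t = proj₁ (ℕ.m≤n⇒∃[o]m+o≡n (proj₁ (proj₂ (proj₂ collision))))
    j₂≡ : suc (j₁ ℕ.+ t) ≡ j₂
    j₂≡ = proj₂ (ℕ.m≤n⇒∃[o]m+o≡n (proj₁ (proj₂ (proj₂ collision))))
    t≤ : suc t ℕ.≤ E ℕ.^ n
    t≤ = ℕ.≤-trans (s≤s (ℕ.m≤n+m t j₁)) (ℕ.≤-trans (ℕ.≤-reflexive j₂≡) (Fin.toℕ≤pred[n] (proj₁ (proj₂ collision))))

    w s : Fin n → ℤ
    w i = q j₂ i ℤ.- q j₁ i
    s i = + r j₂ i ℤ.- + r j₁ i

    δy≈s : ℕφ δ * (ℕφ (suc t) * x - comb b w) ≈ comb b s
    δy≈s = begin
      ℕφ δ * (ℕφ (suc t) * x - comb b w)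
        ≈⟨ solve 4 (λ d t x w → d :* (t :* x :- w) := t :* (d :* x) :+ con -1ℤ :* (d :* w)) ≈-refl (ℕφ δ) (ℕφ (suc t)) x (comb b w) ⟩
      ℕφ (suc t) * (ℕφ δ * x) + φ -1ℤ * (ℕφ δ * comb b w)
        ≈⟨ +-cong (*-congˡ δx≈m) (*-congˡ (≈-sym (comb-* b (+ δ) w))) ⟩
      ℕφ (suc t) * comb b m + φ -1ℤ * comb b (λ i → + δ ℤ.* w i)
        ≈⟨ +-cong (≈-sym (comb-* b (+ suc t) m)) (≈-sym (comb-* b -1ℤ (λ i → + δ ℤ.* w i))) ⟩
      comb b (λ i → + suc t ℤ.* m i) + comb b (λ i → -1ℤ ℤ.* (+ δ ℤ.* w i))
        ≈⟨ ≈-sym (comb-+ b (λ i → + suc t ℤ.* m i) (λ i → -1ℤ ℤ.* (+ δ ℤ.* w i))) ⟩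
      comb b (λ i → + suc t ℤ.* m i ℤ.+ -1ℤ ℤ.* (+ δ ℤ.* w i))
        ≈⟨ comb-cong b remainder ⟩
      comb b s ∎
      where
      remainder : ∀ i → + suc t ℤ.* m i ℤ.+ -1ℤ ℤ.* (+ δ ℤ.* w i) ≡ s i
      remainder i = ≡.trans (cong (λ z → z ℤ.* m i ℤ.+ -1ℤ ℤ.* (+ δ ℤ.* w i)) step)
        (≡.trans (expand (+ j₂) (+ j₁) (m i) (+ δ) (q j₂ i) (q j₁ i))
        (≡.trans (cong₂ (λ u v → (u ℤ.- q j₂ i ℤ.* + δ) ℤ.- (v ℤ.- q j₁ i ℤ.* + δ))
                   (ℤ.a≡a%ℕn+[a/ℕn]*n (+ j₂ ℤ.* m i) δ) (ℤ.a≡a%ℕn+[a/ℕn]*n (+ j₁ ℤ.* m i) δ))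
                 (cancel (+ r j₂ i) (+ r j₁ i) (q j₂ i ℤ.* + δ) (q j₁ i ℤ.* + δ))))
        where
        expand : ∀ a b m d p q → (a ℤ.- b) ℤ.* m ℤ.+ -1ℤ ℤ.* (d ℤ.* (p ℤ.- q)) ≡
                 (a ℤ.* m ℤ.- p ℤ.* d) ℤ.- (b ℤ.* m ℤ.- q ℤ.* d)
        expand = ℤ-ring
        cancel : ∀ r s p q → ((r ℤ.+ p) ℤ.- p) ℤ.- ((s ℤ.+ q) ℤ.- q) ≡ r ℤ.- s
        cancel = ℤ-ring
        shift : ∀ t j → t ≡ (t ℤ.+ j) ℤ.- j
        shift = ℤ-ring
        step : + suc t ≡ + j₂ ℤ.- + j₁
        step = ≡.trans (shift (+ suc t) (+ j₁))
          (cong (ℤ._- (+ j₁)) (cong +_ (≡.trans (cong suc (ℕ.+-comm t j₁)) j₂≡)))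

    y≈0 : ℕφ (suc t) * x - comb b w ≈ 0#
    y≈0 = discrete δ s δy≈s (ℕ.*-cancelˡ-< E (C ℕ.* norm s) δ (ℕ.≤-<-trans
      (ℕ.≤-trans (ℕ.≤-reflexive (swap E C (norm s))) (ℕ.≤-trans (ℕ.*-monoʳ-≤ C scaled) (ℕ.≤-reflexive (≡.sym (ℕ.*-assoc C n δ)))))
      (ℕ.*-monoˡ-< δ (ℕ.n<1+n (C ℕ.* n)))))
      where
      swap : ∀ a b c → a ℕ.* (b ℕ.* c) ≡ b ℕ.* (a ℕ.* c)
      swap = ℕ-ring
      scaled : E ℕ.* norm s ℕ.≤ n ℕ.* δ
      scaled = ℕ.≤-trans (ℕ.≤-reflexive (≡.sym (norm-* (+ E) s)))
        (norm-≤ (λ i → + E ℤ.* s i) δ λ i → same-quotient⇒close E δ (r j₂ i) (r j₁ i) (same-cell i))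

  common-denominator : Σ[ d ∈ ℕ ] (∀ x → Den (suc d) x)
  common-denominator = ℕ.pred ((E ℕ.^ n) !) , λ x →
    subst (λ d → Den d x) (≡.sym (ℕ.suc-pred ((E ℕ.^ n) !) {{ℕ._!≢0 (E ℕ.^ n)}})) (uniform-denominator x)

coordinates : ExcludedMiddle (lsuc 0ℓ) → ∀ N → Coordinates N
coordinates em N =
  let d , den = UniformDenominator.common-denominator em N (Lattice.basis em N)
  in from-basis (Lattice.basis em N) d den
  where
  open Arithmetic em N
  open Lattice em N
  from-basis : (B : Basis) (d : ℕ) → (∀ x → HasDenominator N (Basis.b B) (suc d) x) → Coordinates N
  from-basis B d den = record
    { n = n
    ; d = d
    ; span = comb b
    ; κ = κ
    ; κ-cong = λ e → unique (*-congˡ e)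
    ; κ-injective = λ {x} {y} e → *-cancelˡ (φ≉0 λ ()) (begin
        D * x ≈⟨ spec x ⟩
        comb b (κ x) ≈⟨ comb-cong b e ⟩
        comb b (κ y) ≈⟨ ≈-sym (spec y) ⟩
        D * y ∎)
    ; κ-+ = λ x y → comb-injective independent (begin
        comb b (κ (x + y)) ≈⟨ ≈-sym (spec (x + y)) ⟩
        D * (x + y) ≈⟨ distribˡ D x y ⟩
        D * x + D * y ≈⟨ +-cong (spec x) (spec y) ⟩
        comb b (κ x) + comb b (κ y) ≈⟨ ≈-sym (comb-+ b (κ x) (κ y)) ⟩
        comb b (λ i → κ x i ℤ.+ κ y i) ∎)
    ; κ-scale = λ z x → comb-injective independent (begin
        comb b (κ (φ z * x)) ≈⟨ ≈-sym (spec (φ z * x)) ⟩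
        D * (φ z * x) ≈⟨ solve 3 (λ d z x → d :* (z :* x) := z :* (d :* x)) ≈-refl D (φ z) x ⟩
        φ z * (D * x) ≈⟨ *-congˡ (spec x) ⟩
        φ z * comb b (κ x) ≈⟨ ≈-sym (comb-* b z (κ x)) ⟩
        comb b (λ i → z ℤ.* κ x i) ∎)
    ; κ-span = λ w → comb-injective independent (begin
        comb b (κ (comb b w)) ≈⟨ ≈-sym (spec (comb b w)) ⟩
        D * comb b w ≈⟨ ≈-sym (comb-* b (+ suc d) w) ⟩
        comb b (λ i → + suc d ℤ.* w i) ∎)
    ; C = C
    ; κ-* = λ x y → let μ , e , l = product-bounded (κ x) (κ y) in
        ℕ.≤-trans (ℕ.m≤n*m _ (suc d)) (ℕ.≤-trans (ℕ.≤-reflexive (≡.trans (≡.sym (norm-* (+ suc d) (κ (x * y))))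
          (norm-cong (comb-injective independent (begin
            comb b (λ i → + suc d ℤ.* κ (x * y) i) ≈⟨ comb-* b (+ suc d) (κ (x * y)) ⟩
            D * comb b (κ (x * y)) ≈⟨ *-congˡ (≈-sym (spec (x * y))) ⟩
            D * (D * (x * y)) ≈⟨ solve 3 (λ d x y → d :* (d :* (x :* y)) := (d :* x) :* (d :* y)) ≈-refl D x y ⟩
            (D * x) * (D * y) ≈⟨ *-cong (spec x) (spec y) ⟩
            comb b (κ x) * comb b (κ y) ≈⟨ e ⟩
            comb b μ ∎))))) l)
    }
    where
    open Basis B
    open Discreteness em N B using (C; product-bounded)
    D = ℕφ (suc d)
    κ = λ x → proj₁ (den x)
    spec : ∀ x → D * x ≈ comb b (κ x)
    spec x = proj₂ (den x)
    unique : ∀ {x y} → D * x ≈ D * y → ∀ i → κ x i ≡ κ y i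
    unique {x} {y} e = comb-injective independent (≈-trans (≈-sym (spec x)) (≈-trans e (spec y)))

finToFun-injective : ∀ {m n} {a b : Fin (m ℕ.^ n)} →
                     (∀ i → Fin.finToFun {m} {n} a i ≡ Fin.finToFun b i) → a ≡ b
finToFun-injective {m} {n} {a} {b} h = ≡.trans (≡.sym (Fin.funToFin-finToFin {n} {m} a))
  (≡.trans (funToFin-cong h) (Fin.funToFin-finToFin {n} {m} b))
  where
  funToFin-cong : ∀ {m n} {f g : Fin m → Fin n} → (∀ i → f i ≡ g i) → Fin.funToFin f ≡ Fin.funToFin g
  funToFin-cong {zero}  h = refl
  funToFin-cong {suc m} h = cong₂ Fin.combine (h zero) (funToFin-cong (h ∘ suc))

private
  ∣+m-+n∣<⇒≡ : ∀ {q} m n → m ℕ.< q → n ℕ.< q → q ∣ ℤ.∣ + m ℤ.- + n ∣ → m ≡ n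
  ∣+m-+n∣<⇒≡ {q} m n m<q n<q d = ℤ.+-injective (ℤ.i-j≡0⇒i≡j (+ m) (+ n) (ℤ.∣i∣≡0⇒i≡0 (zero-multiple _ d small)))
    where
    small : ℤ.∣ + m ℤ.- + n ∣ ℕ.< q
    small = ℕ.≤-<-trans (ℕ.≤-trans (ℕ.≤-reflexive (cong ℤ.∣_∣ (ℤ.[+m]-[+n]≡m⊖n m n))) (ℤ.∣m⊝n∣≤m⊔n m n)) (ℕ.⊔-pres-<m m<q n<q)
    zero-multiple : ∀ k → q ∣ k → k ℕ.< q → k ≡ 0
    zero-multiple zero    _ _   = refl
    zero-multiple (suc k) d k<q = contradiction (∣.∣⇒≤ d) (ℕ.<⇒≱ k<q)

  shift-nonnegative : ∀ U z → ℤ.∣ z ∣ ℕ.≤ U → Σ[ c ∈ ℕ ] c ℕ.< suc (U ℕ.+ U) × z ℤ.+ + U ≡ + c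
  shift-nonnegative U (+ a)     h = a ℕ.+ U , s≤s (ℕ.+-monoˡ-≤ U h) , refl
  shift-nonnegative U -[1+ a ]  h = U ℕ.∸ suc a , s≤s (ℕ.≤-trans (ℕ.m∸n≤m U (suc a)) (ℕ.m≤m+n U U)) , ℤ.⊖-≥ h

  box-side : ∀ X B S {U} → 1 ℕ.≤ B → U ℕ.≤ (1 ℕ.+ X ℕ.* B) ℕ.* suc S → suc (U ℕ.+ U) ℕ.≤ (2 ℕ.* X ℕ.+ 3) ℕ.* B ℕ.* suc S
  box-side X B S {U} 1≤B U≤ = begin
    suc (U ℕ.+ U)
      ≤⟨ s≤s (ℕ.+-mono-≤ U≤ U≤) ⟩
    1 ℕ.+ (W ℕ.+ W)
      ≤⟨ ℕ.+-monoˡ-≤ (W ℕ.+ W) (s≤s (z≤n {S})) ⟩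
    suc S ℕ.+ (W ℕ.+ W)
      ≡⟨ collect X B (suc S) ⟩
    (2 ℕ.* X ℕ.* B ℕ.+ 3 ℕ.* 1) ℕ.* suc S
      ≤⟨ ℕ.*-monoˡ-≤ (suc S) (ℕ.+-monoʳ-≤ (2 ℕ.* X ℕ.* B) (ℕ.*-monoʳ-≤ 3 1≤B)) ⟩
    (2 ℕ.* X ℕ.* B ℕ.+ 3 ℕ.* B) ℕ.* suc S
      ≡⟨ cong (ℕ._* suc S) (≡.sym (ℕ.*-distribʳ-+ B (2 ℕ.* X) 3)) ⟩
    (2 ℕ.* X ℕ.+ 3) ℕ.* B ℕ.* suc S ∎
    where
    open ℕ.≤-Reasoning
    W = (1 ℕ.+ X ℕ.* B) ℕ.* suc S
    collect : ∀ x b t → t ℕ.+ ((1 ℕ.+ x ℕ.* b) ℕ.* t ℕ.+ (1 ℕ.+ x ℕ.* b) ℕ.* t) ≡ (2 ℕ.* x ℕ.* b ℕ.+ 3 ℕ.* 1) ℕ.* t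
    collect = ℕ-ring

module Geometry (em : ExcludedMiddle (lsuc 0ℓ)) (N : NumberRing) (L : Coordinates N) where
  open Arithmetic em N
  open Coordinates L

  size : Carrier → ℕ
  size x = norm (κ x)

  κ-neg : ∀ x i → κ (- x) i ≡ ℤ.- κ x i
  κ-neg x i = ≡.trans (κ-cong (solve 1 (λ x → :- x := con -1ℤ :* x) ≈-refl x) i)
    (≡.trans (κ-scale -1ℤ x i) (ℤ.-1*i≡-i (κ x i)))

  κ-sub : ∀ x y i → κ (x - y) i ≡ κ x i ℤ.- κ y i
  κ-sub x y i = ≡.trans (κ-+ x (- y) i) (cong (ℤ._+_ (κ x i)) (κ-neg y i))

  κ-0 : ∀ i → κ 0# i ≡ 0ℤ
  κ-0 i = ≡.trans (κ-cong (≈-sym (zeroʳ (φ 0ℤ))) i) (κ-scale 0ℤ 0# i)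

  size≡0⇒≈0 : ∀ {x} → size x ≡ 0 → x ≈ 0#
  size≡0⇒≈0 {x} e = κ-injective λ i → ≡.trans (norm≡0⇒≡0 (κ x) e i) (≡.sym (κ-0 i))

  size-cong : ∀ {x y} → x ≈ y → size x ≡ size y
  size-cong e = norm-cong (κ-cong e)

  size-+ : ∀ x y → size (x + y) ℕ.≤ size x ℕ.+ size y
  size-+ x y = ℕ.≤-trans (ℕ.≤-reflexive (norm-cong (κ-+ x y))) (norm-+ (κ x) (κ y))

  size-φ* : ∀ z x → size (φ z * x) ≡ ℤ.∣ z ∣ ℕ.* size x
  size-φ* z x = ≡.trans (norm-cong (κ-scale z x)) (norm-* z (κ x))

  size-span : ∀ w → size (span w) ≡ suc d ℕ.* norm w
  size-span w = ≡.trans (norm-cong (κ-span w)) (norm-* (+ suc d) w)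

  span-injective : ∀ {w w′} → span w ≈ span w′ → ∀ i → w i ≡ w′ i
  span-injective {w} {w′} e i = ℤ.*-cancelˡ-≡ (+ suc d) (w i) (w′ i)
    (≡.trans (≡.sym (κ-span w i)) (≡.trans (κ-cong e i) (κ-span w′ i)))

  span-sub : ∀ w w′ → span w - span w′ ≈ span (λ i → w i ℤ.- w′ i)
  span-sub w w′ = κ-injective λ i → ≡.trans (κ-sub (span w) (span w′) i)
    (≡.trans (cong₂ ℤ._-_ (κ-span w i) (κ-span w′ i))
    (≡.trans (factor (+ suc d) (w i) (w′ i)) (≡.sym (κ-span _ i))))
    where
    factor : ∀ d a b → d ℤ.* a ℤ.- d ℤ.* b ≡ d ℤ.* (a ℤ.- b)
    factor = ℤ-ring

  Incongruent : ∀ {R} → Carrier → (Fin R → Carrier) → Set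
  Incongruent α c = ∀ i j u → c i - c j ≈ α * u → i ≡ j

  K : ℕ
  K = 2 ℕ.* (C ℕ.* (suc d ℕ.* n)) ℕ.+ 3

  -- |O/αO| is at most a constant times the n-th power of the size of α: the
  -- translates of α·[0,T)ⁿ by incongruent elements are disjoint, and lie in a
  -- box of side O(size α · T) once T is large.
  packing : ∀ {α B R} → ¬ α ≈ 0# → size α ℕ.≤ B → 1 ℕ.≤ B →
            (c : Fin R → Carrier) → Incongruent α c → R ℕ.≤ (K ℕ.* B) ℕ.^ n
  packing {α} {B} {R} α≉0 small 1≤B c incongruent =
    ℕ.*-cancelʳ-≤ R ((K ℕ.* B) ℕ.^ n) (T ℕ.^ n) {{ℕ.m^n≢0 T n}}
      (ℕ.≤-trans (Fin.injective⇒≤ {f = encode} encode-injective)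
      (ℕ.≤-trans (ℕ.^-monoˡ-≤ n (box-side X B S 1≤B U≤)) (ℕ.≤-reflexive (^-distribʳ-* n (K ℕ.* B) T))))
    where
    S = ℕΣ.sum (λ i → size (c i))
    T = suc S
    U = S ℕ.+ C ℕ.* (B ℕ.* (suc d ℕ.* (n ℕ.* T)))
    X = C ℕ.* (suc d ℕ.* n)
    U≤ : U ℕ.≤ (1 ℕ.+ X ℕ.* B) ℕ.* T
    U≤ = ℕ.+-mono-≤ (ℕ.n≤1+n S) (ℕ.≤-reflexive (regroup C B (suc d) n T))
      where
      regroup : ∀ c b d n t → c ℕ.* (b ℕ.* (d ℕ.* (n ℕ.* t))) ≡ c ℕ.* (d ℕ.* n) ℕ.* b ℕ.* t
      regroup = ℕ-ring

    box : (Fin n → Fin T) → Fin n → ℤ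
    box w i = + Fin.toℕ (w i)

    point : Fin R → (Fin n → Fin T) → Carrier
    point i w = c i + α * span (box w)

    point-bounded : ∀ i w k → ℤ.∣ κ (point i w) k ∣ ℕ.≤ U
    point-bounded i w k = ℕ.≤-trans (∣i∣≤norm (κ (point i w)) k) (ℕ.≤-trans (size-+ (c i) (α * span (box w)))
      (ℕ.+-mono-≤ (f≤sum (λ i → size (c i)) i) (ℕ.≤-trans (κ-* α (span (box w)))
        (ℕ.*-monoʳ-≤ C (ℕ.*-mono-≤ small (ℕ.≤-trans (ℕ.≤-reflexive (size-span (box w)))
          (ℕ.*-monoʳ-≤ (suc d) (norm-≤ (box w) T λ j → ℕ.<⇒≤ (Fin.toℕ<n (w j))))))))))

    shifted : ∀ i w k → _
    shifted i w k = shift-nonnegative U (κ (point i w) k) (point-bounded i w k)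

    code : Fin R → (Fin n → Fin T) → Fin n → Fin (suc (U ℕ.+ U))
    code i w k = Fin.fromℕ< (proj₁ (proj₂ (shifted i w k)))

    code-injective : ∀ {i w i′ w′} → (∀ k → code i w k ≡ code i′ w′ k) → i ≡ i′ × (∀ k → w k ≡ w′ k)
    code-injective {i} {w} {i′} {w′} e = i≡i′ , λ k → Fin.toℕ-injective (ℤ.+-injective (span-injective same-span k))
      where
      same-point : point i w ≈ point i′ w′
      same-point = κ-injective λ k → Algebra.Properties.Ring.+-cancelʳ ℤ.+-*-ring (+ U) _ _ (≡.trans (proj₂ (proj₂ (shifted i w k)))
        (≡.trans (cong +_ (≡.trans (≡.sym (Fin.toℕ-fromℕ< (proj₁ (proj₂ (shifted i w k)))))
          (≡.trans (cong Fin.toℕ (e k)) (Fin.toℕ-fromℕ< (proj₁ (proj₂ (shifted i′ w′ k)))))))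
        (≡.sym (proj₂ (proj₂ (shifted i′ w′ k))))))
      i≡i′ : i ≡ i′
      i≡i′ = incongruent i i′ (span (box w′) - span (box w)) (begin
        c i - c i′ ≈⟨ solve 5 (λ a a′ α s s′ → a :- a′ := ((a :+ α :* s) :- (a′ :+ α :* s′)) :+ α :* (s′ :- s)) ≈-refl
                         (c i) (c i′) α (span (box w)) (span (box w′)) ⟩
        (point i w - point i′ w′) + α * (span (box w′) - span (box w))
                    ≈⟨ +-congʳ (≈-trans (+-congʳ same-point) (-‿inverseʳ _)) ⟩
        0# + α * (span (box w′) - span (box w)) ≈⟨ +-identityˡ _ ⟩
        α * (span (box w′) - span (box w)) ∎)
      same-span : span (box w) ≈ span (box w′)
      same-span = *-cancelˡ α≉0 (begin
        α * span (box w) ≈⟨ solve 2 (λ a t → t := (a :+ t) :- a) ≈-refl (c i) _ ⟩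
        point i w - c i ≈⟨ +-congʳ same-point ⟩
        point i′ w′ - c i ≡⟨ cong (λ j → point i′ w′ - c j) i≡i′ ⟩
        point i′ w′ - c i′ ≈⟨ solve 2 (λ a t → (a :+ t) :- a := t) ≈-refl (c i′) _ ⟩
        α * span (box w′) ∎)

    split : Fin (R ℕ.* T ℕ.^ n) → Fin R × Fin (T ℕ.^ n)
    split = Fin.remQuot (T ℕ.^ n)

    encode : Fin (R ℕ.* T ℕ.^ n) → Fin (suc (U ℕ.+ U) ℕ.^ n)
    encode k = Fin.funToFin (code (proj₁ (split k)) (Fin.finToFun (proj₂ (split k))))

    encode-injective : ∀ {k l} → encode k ≡ encode l → k ≡ l
    encode-injective {k} {l} e =
      ≡.trans (≡.sym (Fin.combine-remQuot {R} (T ℕ.^ n) k))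
      (≡.trans (cong₂ Fin.combine (proj₁ same) (finToFun-injective {n = n} (proj₂ same)))
      (Fin.combine-remQuot {R} (T ℕ.^ n) l))
      where
      same = code-injective λ i → ≡.trans (≡.sym (Fin.finToFun-funToFin _ i))
        (≡.trans (cong (λ c → Fin.finToFun c i) e) (Fin.finToFun-funToFin _ i))

  module _ {𝔭 : Pred Carrier 0ℓ} (is𝔭 : IsPrimeIdeal 𝔭) {q : ℕ} (Q : Prime q) (q∈ : ℕφ q ∈ 𝔭) where
    open PrimeIdeal is𝔭

    private
      0<j<q⇒∤ : ∀ {j} → 0 ℕ.< j → j ℕ.< q → ¬ q ∣ j
      0<j<q⇒∤ {suc j} _ j<q d = ℕ.<⇒≱ j<q (∣.∣⇒≤ d)

    -- Locally at 𝔭 an element of 𝔭² cannot generate 𝔭.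
    non-multiple : ∀ {α} → ¬ α ≈ 0# → α ∈ 𝔭 · 𝔭 →
      Σ[ t ∈ Carrier ] t ∈ 𝔭 × (∀ j → 0 ℕ.< j → j ℕ.< q → ∀ u → ¬ ℕφ j * t ≈ α * u)
    non-multiple {α} α≉0 α∈ = decidable-stable (decide em _) λ none →
      let divisible : ∀ t → t ∈ 𝔭 → Σ[ j ∈ ℕ ] 0 ℕ.< j × j ℕ.< q × (Σ[ u ∈ Carrier ] ℕφ j * t ≈ α * u)
          divisible t t∈ = decidable-stable (decide em _) λ h →
            none (t , t∈ , λ j 0<j j<q u e → h (j , 0<j , j<q , u , e))
          J , q∤J , v , v∈ , e = multiple divisible α∈
      in ∤⇒∉ {z = + J} Q q∈ q∤J (resp (*-cancelˡ α≉0 (≈-trans (≈-sym e) (*-comm _ _))) v∈)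
      where
      multiple : (∀ t → t ∈ 𝔭 → Σ[ j ∈ ℕ ] 0 ℕ.< j × j ℕ.< q × (Σ[ u ∈ Carrier ] ℕφ j * t ≈ α * u)) →
        ∀ {x} → x ∈ 𝔭 · 𝔭 → Σ[ J ∈ ℕ ] (¬ q ∣ J) × (Σ[ v ∈ Carrier ] v ∈ 𝔭 × ℕφ J * x ≈ α * v)
      multiple h (nil x≈0) = 1 , 0<j<q⇒∤ (s≤s z≤n) (ℕ.nonTrivial⇒n>1 q {{prime⇒nonTrivial Q}}) , 0# , 0∈ ,
        ≈-trans (*-congˡ x≈0) (≈-trans (zeroʳ _) (≈-sym (zeroʳ α)))
      multiple h (cons {a} {b} {x} {y} a∈ b∈ x∈ y≈) =
        let j , 0<j , j<q , u , e = h a a∈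
            J , q∤J , v , v∈ , k  = multiple h x∈
        in j ℕ.* J ,
           (λ d → [ 0<j<q⇒∤ 0<j j<q , q∤J ]′ (euclidsLemma j J Q d)) ,
           ℕφ J * (u * b) + ℕφ j * v ,
           +-closed (*-closed (ℕφ J) (*-closed u b∈)) (*-closed (ℕφ j) v∈) ,
           (begin
             ℕφ (j ℕ.* J) * y
               ≈⟨ *-cong (ℕφ-* j J) y≈ ⟩
             (ℕφ j * ℕφ J) * (a * b + x)
               ≈⟨ solve 5 (λ j J a b x → (j :* J) :* (a :* b :+ x) := J :* (j :* a) :* b :+ j :* (J :* x)) ≈-refl (ℕφ j) (ℕφ J) a b x ⟩
             ℕφ J * (ℕφ j * a) * b + ℕφ j * (ℕφ J * x)
               ≈⟨ +-cong (*-congʳ (*-congˡ e)) (*-congˡ k) ⟩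
             ℕφ J * (α * u) * b + ℕφ j * (α * v)
               ≈⟨ solve 6 (λ j J α u b v → J :* (α :* u) :* b :+ j :* (α :* v) := α :* (J :* (u :* b) :+ j :* v)) ≈-refl (ℕφ j) (ℕφ J) α u b v ⟩
             α * (ℕφ J * (u * b) + ℕφ j * v) ∎)

    multiples-incongruent : ∀ {α t} → α ∈ 𝔭 → t ∈ 𝔭 → (∀ j → 0 ℕ.< j → j ℕ.< q → ∀ u → ¬ ℕφ j * t ≈ α * u) →
                            Σ[ c ∈ (Fin (q ℕ.* q) → Carrier) ] Incongruent α c
    multiples-incongruent {α} {t} α∈ t∈ indivisible = (λ k → element (split k)) , λ k l u e →
      ≡.trans (≡.sym (Fin.combine-remQuot {q} q k))
        (≡.trans (cong (λ (i , j) → Fin.combine i j) (distinct (split k) (split l) u e)) (Fin.combine-remQuot {q} q l))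
      where
      split : Fin (q ℕ.* q) → Fin q × Fin q
      split = Fin.remQuot q
      element : Fin q × Fin q → Carrier
      element (i , j) = ℕφ (Fin.toℕ i) + ℕφ (Fin.toℕ j) * t

      no-gap : ∀ {a b} → a ℕ.< b → b ℕ.< q → ∀ u → ¬ φ (+ b ℤ.- + a) * t ≈ α * u
      no-gap {a} {b} a<b b<q u e = indivisible (b ℕ.∸ a) (ℕ.m<n⇒0<n∸m a<b) (ℕ.≤-<-trans (ℕ.m∸n≤m b a) b<q) u
        (≈-trans (*-congʳ (φ-cong (≡.trans (≡.sym (ℤ.⊖-≥ (ℕ.<⇒≤ a<b))) (≡.sym (ℤ.[+m]-[+n]≡m⊖n b a))))) e)

      distinct : ∀ k l u → element k - element l ≈ α * u → k ≡ l
      distinct (i , j) (i′ , j′) u e = cong₂ _,_ i≡i′ (Fin.toℕ-injective j≡j′)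
        where
        a = Fin.toℕ i
        a′ = Fin.toℕ i′
        c = Fin.toℕ j
        c′ = Fin.toℕ j′
        i-i′∈ : φ (+ a ℤ.- + a′) ∈ 𝔭
        i-i′∈ = resp (begin
          α * u - (ℕφ c - ℕφ c′) * t
            ≈⟨ +-congʳ (≈-sym e) ⟩
          ((ℕφ a + ℕφ c * t) - (ℕφ a′ + ℕφ c′ * t)) - (ℕφ c - ℕφ c′) * t
            ≈⟨ solve 5 (λ a a′ c c′ t → ((a :+ c :* t) :- (a′ :+ c′ :* t)) :- (c :- c′) :* t := a :- a′) ≈-refl (ℕφ a) (ℕφ a′) (ℕφ c) (ℕφ c′) t ⟩
          ℕφ a - ℕφ a′
            ≈⟨ ≈-sym (≈-trans (φ-+ (+ a) (ℤ.- + a′)) (+-congˡ (φ-neg (+ a′)))) ⟩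
          φ (+ a ℤ.- + a′) ∎)
          (sub-closed (*-closedʳ u α∈) (*-closed _ t∈))
        a≡a′ : a ≡ a′
        a≡a′ = ∣+m-+n∣<⇒≡ a a′ (Fin.toℕ<n i) (Fin.toℕ<n i′) (∈⇒∣ {z = + a ℤ.- + a′} Q q∈ i-i′∈)
        i≡i′ : i ≡ i′
        i≡i′ = Fin.toℕ-injective a≡a′
        gap : φ (+ c ℤ.- + c′) * t ≈ α * u
        gap = begin
          φ (+ c ℤ.- + c′) * t ≈⟨ *-congʳ (≈-trans (φ-+ (+ c) (ℤ.- + c′)) (+-congˡ (φ-neg (+ c′)))) ⟩
          (ℕφ c - ℕφ c′) * t ≈⟨ solve 4 (λ a c c′ t → (c :- c′) :* t := (a :+ c :* t) :- (a :+ c′ :* t)) ≈-refl (ℕφ a) (ℕφ c) (ℕφ c′) t ⟩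
          (ℕφ a + ℕφ c * t) - (ℕφ a + ℕφ c′ * t) ≡⟨ cong (λ b → (ℕφ a + ℕφ c * t) - (ℕφ b + ℕφ c′ * t)) a≡a′ ⟩
          (ℕφ a + ℕφ c * t) - (ℕφ a′ + ℕφ c′ * t) ≈⟨ e ⟩
          α * u ∎
        gap′ : φ (+ c′ ℤ.- + c) * t ≈ α * - u
        gap′ = begin
          φ (+ c′ ℤ.- + c) * t ≈⟨ *-congʳ (φ-cong (negate (+ c) (+ c′))) ⟩
          φ (ℤ.- (+ c ℤ.- + c′)) * t ≈⟨ *-congʳ (φ-neg (+ c ℤ.- + c′)) ⟩
          - φ (+ c ℤ.- + c′) * t ≈⟨ solve 2 (λ z t → :- z :* t := :- (z :* t)) ≈-refl (φ (+ c ℤ.- + c′)) t ⟩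
          - (φ (+ c ℤ.- + c′) * t) ≈⟨ -‿cong gap ⟩
          - (α * u) ≈⟨ -‿distribʳ-* α u ⟩
          α * - u ∎
          where
          negate : ∀ a b → b ℤ.- a ≡ ℤ.- (a ℤ.- b)
          negate = ℤ-ring
        j≡j′ : c ≡ c′
        j≡j′ with ℕ.<-cmp c c′
        ... | tri< c<c′ _ _ = contradiction gap′ (no-gap c<c′ (Fin.toℕ<n j′) (- u))
        ... | tri≈ _ c≡c′ _ = c≡c′
        ... | tri> _ _ c′<c = contradiction gap (no-gap c′<c (Fin.toℕ<n j) u)

    square-bounded : ∀ {α B} → ¬ α ≈ 0# → α ∈ 𝔭 · 𝔭 → size α ℕ.≤ B → 1 ℕ.≤ B → q ℕ.* q ℕ.≤ (K ℕ.* B) ℕ.^ n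
    square-bounded α≉0 α∈ small 1≤B =
      let t , t∈ , indivisible = non-multiple α≉0 α∈
          c , incongruent = multiples-incongruent (·⊆ˡ isIdeal α∈) t∈ indivisible
      in packing α≉0 small 1≤B c incongruent

-- The counting behind the sieve

private
  filter-partition : ∀ {A : Set} {P : Pred A 0ℓ} (P? : ∀ x → Dec (P x)) xs →
    length xs ≡ length (List.filter P? xs) ℕ.+ length (List.filter (λ x → ¬? (P? x)) xs)
  filter-partition P? [] = refl
  filter-partition P? (x ∷ xs) with P? x
  ... | yes _ = cong suc (filter-partition P? xs)
  ... | no  _ = ≡.trans (cong suc (filter-partition P? xs)) (≡.sym (ℕ.+-suc _ _))

crowded-fibre : ∀ {A : Set} (f : A → ℕ) S k (xs : List A) → Unique xs → All (λ x → f x ℕ.< S) xs →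
  S ℕ.* k ℕ.< length xs →
  Σ[ v ∈ ℕ ] Σ[ ys ∈ List A ] Unique ys × All (λ y → f y ≡ v) ys × k ℕ.< length ys
crowded-fibre f zero    k (x ∷ xs) _ (() ∷ _) _
crowded-fibre f (suc S) k xs u below large with k ℕ.<? length (List.filter (λ x → f x ℕ.≟ S) xs)
... | yes crowd = S , List.filter (λ x → f x ℕ.≟ S) xs , filter⁺ (λ x → f x ℕ.≟ S) u , all-filter (λ x → f x ℕ.≟ S) xs , crowd
... | no  ¬crowd = crowded-fibre f S k rest (filter⁺ (λ x → ¬? (f x ℕ.≟ S)) u) below′ large′
  where
  rest = List.filter (λ x → ¬? (f x ℕ.≟ S)) xs
  below′ : All (λ x → f x ℕ.< S) rest
  below′ = All.map (λ (fx<1+S , fx≢S) → ℕ.≤∧≢⇒< (ℕ.≤-pred fx<1+S) fx≢S)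
    (All.zip (All-filter⁺ (λ x → ¬? (f x ℕ.≟ S)) below , all-filter (λ x → ¬? (f x ℕ.≟ S)) xs))
  large′ : S ℕ.* k ℕ.< length rest
  large′ = ℕ.+-cancelˡ-< k _ _ (ℕ.<-≤-trans large (ℕ.≤-trans (ℕ.≤-reflexive (filter-partition (λ x → f x ℕ.≟ S) xs))
    (ℕ.+-monoˡ-≤ (length rest) (ℕ.≮⇒≥ ¬crowd))))

partial-sum : (ℕ → ℕ) → ℕ → ℕ
partial-sum a zero    = 0
partial-sum a (suc i) = partial-sum a i ℕ.+ a i

partial-sum-mono : ∀ a {i j} → i ℕ.≤ j → partial-sum a i ℕ.≤ partial-sum a j
partial-sum-mono a {i} {zero}  z≤n = z≤n
partial-sum-mono a {i} {suc j} i≤ with ℕ.m≤n⇒m<n∨m≡n i≤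
... | inj₁ i<  = ℕ.≤-trans (partial-sum-mono a (ℕ.≤-pred i<)) (ℕ.m≤m+n _ _)
... | inj₂ refl = ℕ.≤-refl

partial-sum-code-injective : ∀ a {i j v w} → v ℕ.< a i → w ℕ.< a j →
  partial-sum a i ℕ.+ v ≡ partial-sum a j ℕ.+ w → i ≡ j × v ≡ w
partial-sum-code-injective a {i} {j} {v} {w} v< w< e with ℕ.<-cmp i j
... | tri≈ _ refl _ = refl , ℕ.+-cancelˡ-≡ (partial-sum a i) _ _ e
... | tri< i<j _ _ = contradiction e (ℕ.<⇒≢ (ℕ.<-≤-trans (ℕ.+-monoʳ-< (partial-sum a i) v<)
  (ℕ.≤-trans (partial-sum-mono a i<j) (ℕ.m≤m+n _ w))))
... | tri> _ _ j<i = contradiction (≡.sym e) (ℕ.<⇒≢ (ℕ.<-≤-trans (ℕ.+-monoʳ-< (partial-sum a j) w<)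
  (ℕ.≤-trans (partial-sum-mono a j<i) (ℕ.m≤m+n _ v))))

-- Σ 1/q² over q > Y is at most 1/Y, by comparison with Σ (1/(q-1) − 1/q).
inverse-square-sum : ∀ Y E (c : ℕ → ℕ) → 1 ℕ.≤ Y →
  (∀ i → c i ℕ.* (suc (Y ℕ.+ i) ℕ.* suc (Y ℕ.+ i)) ℕ.≤ E) →
  ∀ m → Y ℕ.* partial-sum (suc ∘ c) m ℕ.≤ E ℕ.+ Y ℕ.* (Y ℕ.+ m)
inverse-square-sum Y@(suc _) E c _ h m = ℕ.*-cancelˡ-≤ (Y ℕ.+ m) (ℕ.≤-trans (ℕ.m≤m+n _ (E ℕ.* Y)) (telescope m))
  where
  open ℕ.≤-Reasoning
  telescope : ∀ m → let X = Y ℕ.+ m in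
    X ℕ.* (Y ℕ.* partial-sum (suc ∘ c) m) ℕ.+ E ℕ.* Y ℕ.≤ X ℕ.* (E ℕ.+ Y ℕ.* X)
  telescope zero = begin
    (Y ℕ.+ 0) ℕ.* (Y ℕ.* 0) ℕ.+ E ℕ.* Y ≡⟨ initial Y E ⟩
    (Y ℕ.+ 0) ℕ.* E ≤⟨ ℕ.*-monoʳ-≤ (Y ℕ.+ 0) (ℕ.m≤m+n E _) ⟩
    (Y ℕ.+ 0) ℕ.* (E ℕ.+ Y ℕ.* (Y ℕ.+ 0)) ∎
    where
    initial : ∀ y e → (y ℕ.+ 0) ℕ.* (y ℕ.* 0) ℕ.+ e ℕ.* y ≡ (y ℕ.+ 0) ℕ.* e
    initial = ℕ-ring
  telescope (suc m) = subst
    (λ X′ → X′ ℕ.* (Y ℕ.* (S ℕ.+ suc (c m))) ℕ.+ E ℕ.* Y ℕ.≤ X′ ℕ.* (E ℕ.+ Y ℕ.* X′))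
    (≡.sym (ℕ.+-suc Y m)) (ℕ.*-cancelˡ-≤ X (begin
      X ℕ.* (suc X ℕ.* (Y ℕ.* (S ℕ.+ suc (c m))) ℕ.+ E ℕ.* Y)
        ≡⟨ expand X Y S (c m) E ⟩
      suc X ℕ.* (X ℕ.* (Y ℕ.* S)) ℕ.+ suc X ℕ.* X ℕ.* Y ℕ.+ (Y ℕ.* (c m ℕ.* (X ℕ.* suc X)) ℕ.+ X ℕ.* E ℕ.* Y)
        ≤⟨ ℕ.+-monoʳ-≤ (suc X ℕ.* (X ℕ.* (Y ℕ.* S)) ℕ.+ suc X ℕ.* X ℕ.* Y) (ℕ.+-monoˡ-≤ (X ℕ.* E ℕ.* Y) (ℕ.*-monoʳ-≤ Y c≤)) ⟩
      suc X ℕ.* (X ℕ.* (Y ℕ.* S)) ℕ.+ suc X ℕ.* X ℕ.* Y ℕ.+ (Y ℕ.* E ℕ.+ X ℕ.* E ℕ.* Y)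
        ≡⟨ collect X Y S E ⟩
      suc X ℕ.* (X ℕ.* (Y ℕ.* S) ℕ.+ E ℕ.* Y) ℕ.+ suc X ℕ.* X ℕ.* Y
        ≤⟨ ℕ.+-monoˡ-≤ (suc X ℕ.* X ℕ.* Y) (ℕ.*-monoʳ-≤ (suc X) (telescope m)) ⟩
      suc X ℕ.* (X ℕ.* (E ℕ.+ Y ℕ.* X)) ℕ.+ suc X ℕ.* X ℕ.* Y
        ≡⟨ finish X Y E ⟩
      X ℕ.* (suc X ℕ.* (E ℕ.+ Y ℕ.* suc X)) ∎))
    where
    X = Y ℕ.+ m
    S = partial-sum (suc ∘ c) m
    c≤ : c m ℕ.* (X ℕ.* suc X) ℕ.≤ E
    c≤ = ℕ.≤-trans (ℕ.*-monoʳ-≤ (c m) (ℕ.*-monoˡ-≤ (suc X) (ℕ.n≤1+n X))) (h m)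
    expand : ∀ x y s c e → x ℕ.* (suc x ℕ.* (y ℕ.* (s ℕ.+ suc c)) ℕ.+ e ℕ.* y) ≡
      suc x ℕ.* (x ℕ.* (y ℕ.* s)) ℕ.+ suc x ℕ.* x ℕ.* y ℕ.+ (y ℕ.* (c ℕ.* (x ℕ.* suc x)) ℕ.+ x ℕ.* e ℕ.* y)
    expand = ℕ-ring
    collect : ∀ x y s e →
      suc x ℕ.* (x ℕ.* (y ℕ.* s)) ℕ.+ suc x ℕ.* x ℕ.* y ℕ.+ (y ℕ.* e ℕ.+ x ℕ.* e ℕ.* y) ≡
      suc x ℕ.* (x ℕ.* (y ℕ.* s) ℕ.+ e ℕ.* y) ℕ.+ suc x ℕ.* x ℕ.* y
    collect = ℕ-ring
    finish : ∀ x y e → suc x ℕ.* (x ℕ.* (e ℕ.+ y ℕ.* x)) ℕ.+ suc x ℕ.* x ℕ.* y ≡ x ℕ.* (suc x ℕ.* (e ℕ.+ y ℕ.* suc x))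
    finish = ℕ-ring

-- A cell of side s in [0,M)ⁿ, with gⁿ = suc count cells in total.
record Cells (G n M q : ℕ) : Set where
  field
    s       : ℕ
    0<s     : 0 ℕ.< s
    g count : ℕ
    small   : (G ℕ.* s) ℕ.^ n ℕ.< q ℕ.* q
    index<  : ∀ {w} → w ℕ.< M → (w / s) {{ℕ.>-nonZero 0<s}} ℕ.< g
    count≡  : g ℕ.^ n ≡ suc count
    few     : count ℕ.* (q ℕ.* q) ℕ.≤ (4 ℕ.* G ℕ.* M) ℕ.^ n

private
  last-before-failure : ∀ {P : Pred ℕ 0ℓ} → (∀ s → Dec (P s)) → ∀ M → P 1 →
    Σ[ s ∈ ℕ ] P (suc s) × suc s ℕ.≤ suc M × (s ≡ M ⊎ ¬ P (suc (suc s)))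
  last-before-failure P? zero    p = 0 , p , ℕ.≤-refl , inj₁ refl
  last-before-failure P? (suc M) p with P? (suc (suc M))
  ... | yes p′ = suc M , p′ , ℕ.≤-refl , inj₁ refl
  ... | no ¬p with last-before-failure P? M p
  ...   | s , ps , s≤ , inj₁ refl = s , ps , ℕ.m≤n⇒m≤1+n s≤ , inj₂ ¬p
  ...   | s , ps , s≤ , inj₂ ¬ps = s , ps , ℕ.m≤n⇒m≤1+n s≤ , inj₂ ¬ps

cells : ∀ G n M q → (G ℕ.* 1) ℕ.^ n ℕ.< q ℕ.* q → Cells G n (suc M) q
cells G n M q start with last-before-failure (λ s → (G ℕ.* s) ℕ.^ n ℕ.<? q ℕ.* q) M start
... | s , small , _ , inj₁ refl = record
  { s = suc M ; 0<s = s≤s z≤n ; g = 1 ; count = 0 ; small = small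
  ; index< = λ w< → s≤s (ℕ.≤-reflexive (m<n⇒m/n≡0 w<)) ; count≡ = ℕ.^-zeroˡ n ; few = z≤n }
... | s′ , small , s≤ , inj₂ large = record
  { s = s ; 0<s = s≤s z≤n ; g = g ; count = ℕ.pred (g ℕ.^ n) ; small = small
  ; index< = λ w< → s≤s (/-monoˡ-≤ s (ℕ.<⇒≤ w<))
  ; count≡ = ≡.sym (ℕ.suc-pred (g ℕ.^ n) {{ℕ.m^n≢0 g n}})
  ; few = begin
      ℕ.pred (g ℕ.^ n) ℕ.* (q ℕ.* q) ≤⟨ ℕ.*-mono-≤ (ℕ.pred[n]≤n {g ℕ.^ n}) (ℕ.≮⇒≥ large) ⟩
      g ℕ.^ n ℕ.* (G ℕ.* suc s) ℕ.^ n ≡⟨ ≡.sym (^-distribʳ-* n g (G ℕ.* suc s)) ⟩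
      (g ℕ.* (G ℕ.* suc s)) ℕ.^ n ≤⟨ ℕ.^-monoˡ-≤ n side ⟩
      (4 ℕ.* G ℕ.* suc M) ℕ.^ n ∎
  }
  where
  open ℕ.≤-Reasoning
  s = suc s′
  g = suc (suc M / s)
  side : g ℕ.* (G ℕ.* suc s) ℕ.≤ 4 ℕ.* G ℕ.* suc M
  side = begin
    g ℕ.* (G ℕ.* suc s) ≤⟨ ℕ.*-monoʳ-≤ g (ℕ.*-monoʳ-≤ G (ℕ.+-monoˡ-≤ s (s≤s (z≤n {s′})))) ⟩
    g ℕ.* (G ℕ.* (s ℕ.+ s)) ≡⟨ regroup g G s ⟩
    2 ℕ.* G ℕ.* (g ℕ.* s) ≤⟨ ℕ.*-monoʳ-≤ (2 ℕ.* G) (ℕ.+-mono-≤ s≤ (m/n*n≤m (suc M) s)) ⟩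
    2 ℕ.* G ℕ.* (suc M ℕ.+ suc M) ≡⟨ double G (suc M) ⟩
    4 ℕ.* G ℕ.* suc M ∎
    where
    regroup : ∀ g G s → g ℕ.* (G ℕ.* (s ℕ.+ s)) ≡ 2 ℕ.* G ℕ.* (g ℕ.* s)
    regroup = ℕ-ring
    double : ∀ G M → 2 ℕ.* G ℕ.* (M ℕ.+ M) ≡ 4 ℕ.* G ℕ.* M
    double = ℕ-ring

same-cell⇒close : ∀ s {a b} .{{_ : ℕ.NonZero s}} → a / s ≡ b / s → ℤ.∣ + a ℤ.- + b ∣ ℕ.≤ s
same-cell⇒close s {a} {b} e = ℕ.≤-trans (ℕ.≤-reflexive (cong ℤ.∣_∣ (≡.sym (ℤ.*-identityˡ (+ a ℤ.- + b)))))
  (same-quotient⇒close 1 s a b (≡.trans (cong (_/ s) (ℕ.*-identityʳ a)) (≡.trans e (cong (_/ s) (≡.sym (ℕ.*-identityʳ b))))))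

unique-lookup-injective : ∀ {A : Set} {xs : List A} → Unique xs → ∀ i j → List.lookup xs i ≡ List.lookup xs j → i ≡ j
unique-lookup-injective (_ ∷ _) zero    zero    _ = refl
unique-lookup-injective (h ∷ _) zero    (suc j) e = contradiction e (All.lookup h (∈-lookup j))
unique-lookup-injective (h ∷ _) (suc i) zero    e = contradiction (≡.sym e) (All.lookup h (∈-lookup i))
unique-lookup-injective (_ ∷ u) (suc i) (suc j) e = cong suc (unique-lookup-injective u i j e)

module FewPrimes (em : ExcludedMiddle (lsuc 0ℓ)) (N : NumberRing) where
  open Arithmetic em N
  open Lattice em N using (comb; comb-cong; comb-*)

  primitive-relation : ∀ {q m} → Prime q → (v : Fin m → Carrier) → ∀ bound c i → c i ≢ 0ℤ → ℤ.∣ c i ∣ ℕ.≤ bound →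
    comb v c ≈ 0# → Σ[ c′ ∈ (Fin m → ℤ) ] (∃[ j ] ¬ q ∣ ℤ.∣ c′ j ∣) × comb v c′ ≈ 0#
  primitive-relation {q} Q v zero c i cᵢ≢0 small rel = contradiction (ℤ.∣i∣≡0⇒i≡0 (ℕ.n≤0⇒n≡0 small)) cᵢ≢0
  primitive-relation {q} Q v (suc bound) c i cᵢ≢0 small rel with Fin.any? (λ j → ¬? (q ∣? ℤ.∣ c j ∣))
  ... | yes (j , q∤) = c , (j , q∤) , rel
  ... | no  ¬any     = primitive-relation Q v bound c′ i c′ᵢ≢0 (ℕ.≤-pred (ℕ.<-≤-trans smaller small))
      (no-zero-divisor (φ≉0 q≢0) (begin
        ℕφ q * comb v c′ ≈⟨ ≈-sym (comb-* v (+ q) c′) ⟩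
        comb v (λ j → + q ℤ.* c′ j) ≈⟨ comb-cong v (λ j → ≡.sym (c≡ j)) ⟩
        comb v c ≈⟨ rel ⟩
        0# ∎))
    where
    quotient′ : ∀ j → Σ[ k ∈ ℤ ] c j ≡ + q ℤ.* k
    quotient′ j with ∣ᵤ⇒∣ {+ q} {c j} (decidable-stable (q ∣? ℤ.∣ c j ∣) (λ h → ¬any (j , h)))
    ... | divides k e = k , ≡.trans e (ℤ.*-comm k (+ q))
    c′ = λ j → proj₁ (quotient′ j)
    c≡ = λ j → proj₂ (quotient′ j)
    q>1 = ℕ.nonTrivial⇒n>1 q {{prime⇒nonTrivial Q}}
    q≢0 : + q ≢ 0ℤ
    q≢0 e = ℕ.<⇒≱ q>1 (ℕ.≤-trans (ℕ.≤-reflexive (ℤ.+-injective e)) z≤n)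
    c′ᵢ≢0 : c′ i ≢ 0ℤ
    c′ᵢ≢0 e = cᵢ≢0 (≡.trans (c≡ i) (≡.trans (cong (+ q ℤ.*_) e) (ℤ.*-zeroʳ (+ q))))
    smaller : ℤ.∣ c′ i ∣ ℕ.< ℤ.∣ c i ∣
    smaller = ℕ.<-≤-trans
      (ℕ.m<m*n ℤ.∣ c′ i ∣ q {{ℕ.≢-nonZero (λ e → c′ᵢ≢0 (ℤ.∣i∣≡0⇒i≡0 e))}} q>1)
      (ℕ.≤-reflexive (≡.sym (≡.trans (cong ℤ.∣_∣ (c≡ i)) (≡.trans (ℤ.abs-* (+ q) (c′ i)) (ℕ.*-comm q ℤ.∣ c′ i ∣)))))

  prod : ∀ {m} → (Fin m → Carrier) → Carrier
  prod {zero}  f = 1#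
  prod {suc m} f = f zero * prod (f ∘ suc)

  prod-∉ : ∀ {𝔭} → IsPrimeIdeal 𝔭 → ∀ {m} (f : Fin m → Carrier) → (∀ i → f i ∉ 𝔭) → prod f ∉ 𝔭
  prod-∉ is𝔭 {zero}  f h = IsPrimeIdeal.proper is𝔭
  prod-∉ is𝔭 {suc m} f h = [ h zero , prod-∉ is𝔭 (f ∘ suc) (h ∘ suc) ]′ ∘ IsPrimeIdeal.prime is𝔭

  prod-∈ : ∀ {I} → IsIdeal I → ∀ {m} (f : Fin m → Carrier) i → f i ∈ I → prod f ∈ I
  prod-∈ isI f zero    h = Ideal.*-closedʳ isI _ h
  prod-∈ isI f (suc i) h = Ideal.*-closed isI _ (prod-∈ isI (f ∘ suc) i h)

  summand-∈ : ∀ {I} → IsIdeal I → ∀ {m} (f : Fin m → Carrier) i → sum f ∈ I → (∀ j → j ≢ i → f j ∈ I) → f i ∈ I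
  summand-∈ isI f zero    s h = Ideal.resp isI (solve 2 (λ a b → (a :+ b) :- b := a) ≈-refl (f zero) (sum (f ∘ suc)))
    (Ideal.sub-closed isI s (Ideal.sum-closed isI (f ∘ suc) (λ j → h (suc j) λ ())))
  summand-∈ isI f (suc i) s h = summand-∈ isI (f ∘ suc) i
    (Ideal.resp isI (solve 2 (λ a b → (a :+ b) :- a := b) ≈-refl (f zero) (sum (f ∘ suc))) (Ideal.sub-closed isI s (h zero λ ())))
    (λ j j≢i → h (suc j) (j≢i ∘ Fin.suc-injective))

  few-primes : ∀ {q} → Prime q → (𝔭 : Fin (suc rank) → Pred Carrier 0ℓ) → (∀ i → IsPrimeIdeal (𝔭 i)) →
    (∀ i → ℕφ q ∈ 𝔭 i) → ¬ (∀ i j → i ≢ j → Σ[ a ∈ Carrier ] a ∈ 𝔭 i × a ∉ 𝔭 j)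
  few-primes {q} Q 𝔭 is𝔭 q∈ separate =
    let c , (i , cᵢ≢0) , rel = dependent e
        c′ , (j , q∤) , rel′ = primitive-relation Q e ℤ.∣ c i ∣ c i cᵢ≢0 ℕ.≤-refl rel
    in [ PrimeIdeal.∤⇒∉ (is𝔭 j) {z = c′ j} Q (q∈ j) q∤ , e∉ j ]′ (IsPrimeIdeal.prime (is𝔭 j)
         (summand-∈ (ideal j) (λ i → φ (c′ i) * e i) j
           (Ideal.resp (ideal j) (≈-sym rel′) (Ideal.0∈ (ideal j)))
           (λ i i≢j → Ideal.*-closed (ideal j) (φ (c′ i)) (e∈ i j i≢j))))
    where
    ideal = λ i → IsPrimeIdeal.isIdeal (is𝔭 i)
    factor : ∀ i j → Σ[ a ∈ Carrier ] (i ≢ j → a ∈ 𝔭 i) × a ∉ 𝔭 j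
    factor i j with i Fin.≟ j
    ... | yes refl = 1# , (λ i≢i → contradiction refl i≢i) , IsPrimeIdeal.proper (is𝔭 i)
    ... | no  i≢j  = let a , a∈ , a∉ = separate i j i≢j in a , (λ _ → a∈) , a∉
    e = λ j → prod (λ i → proj₁ (factor i j))
    e∉ : ∀ j → e j ∉ 𝔭 j
    e∉ j = prod-∉ (is𝔭 j) _ (λ i → proj₂ (proj₂ (factor i j)))
    e∈ : ∀ i j → i ≢ j → e i ∈ 𝔭 j
    e∈ i j i≢j = prod-∈ (ideal j) (λ k → proj₁ (factor k i)) j (proj₁ (proj₂ (factor j i)) (i≢j ∘ ≡.sym))

module Sieve (em : ExcludedMiddle (lsuc 0ℓ)) (N : NumberRing) (L : Coordinates N) where
  open Arithmetic em N
  open Coordinates L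
  open Geometry em N L
  open FewPrimes em N

  n-positive : 0 ℕ.< n
  n-positive = ℕ.n≢0⇒n>0 λ n≡0 → 1≉0 (size≡0⇒≈0 (empty (κ 1#) n≡0))
    where
    empty : ∀ {n} (m : Fin n → ℤ) → n ≡ 0 → norm m ≡ 0
    empty m refl = refl

  ·-mono₂ : ∀ {I J : Pred Carrier 0ℓ} → (∀ {x} → x ∈ I → x ∈ J) → ∀ {x} → x ∈ I · I → x ∈ J · J
  ·-mono₂ I⊆J (nil h)        = nil h
  ·-mono₂ I⊆J (cons a b x h) = cons (I⊆J a) (I⊆J b) (·-mono₂ I⊆J x) h

  cancel-coprime : ∀ {𝔭 q Q α} → IsPrimeIdeal 𝔭 → Prime q → ℕφ q ∈ 𝔭 → ¬ q ∣ Q → ℕφ Q * α ∈ 𝔭 · 𝔭 → α ∈ 𝔭 · 𝔭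
  cancel-coprime {𝔭} {q} {Q} {α} is𝔭 P q∈ q∤Q Qα∈ =
    let u , v , e = bézout (prime∤⇒coprime P q∤Q)
    in Ideal.resp isSquare (begin
         ℕφ q * (φ u * α) + φ v * (ℕφ Q * α)
           ≈⟨ solve 5 (λ q u α v Q → q :* (u :* α) :+ v :* (Q :* α) := (u :* q :+ v :* Q) :* α) ≈-refl (ℕφ q) (φ u) α (φ v) (ℕφ Q) ⟩
         (φ u * ℕφ q + φ v * ℕφ Q) * α
           ≈⟨ *-congʳ (≈-trans (+-cong (≈-sym (φ-* u (+ q))) (≈-sym (φ-* v (+ Q)))) (≈-sym (φ-+ _ _))) ⟩
         φ (u ℤ.* + q ℤ.+ v ℤ.* + Q) * α
           ≈⟨ *-congʳ (≈-trans (φ-cong e) φ-1) ⟩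
         1# * α
           ≈⟨ *-identityˡ α ⟩
         α ∎)
         (Ideal.+-closed isSquare (·-∈ q∈ (*-closed (φ u) α∈) ≈-refl) (Ideal.*-closed isSquare (φ v) Qα∈))
    where
    open PrimeIdeal is𝔭
    isSquare = ·-isIdeal isIdeal isIdeal
    α∈ : α ∈ 𝔭
    α∈ = [ (λ Q∈ → contradiction Q∈ (∤⇒∉ {z = + Q} P q∈ q∤Q)) , (λ h → h) ]′ (prime (·⊆ˡ isIdeal Qα∈))

  G : ℕ
  G = K ℕ.* (suc d ℕ.* n)

  module _ (z : (Fin n → ℤ) → Carrier) {Q : ℕ} (z-affine : ∀ w w′ → z w - z w′ ≈ ℕφ Q * (span w - span w′)) where

    record Bad (w : Fin n → ℤ) (q : ℕ) : Set₁ where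
      field
        is-prime : Prime q
        coprime  : ¬ q ∣ Q
        𝔭        : Pred Carrier 0ℓ
        is𝔭      : IsPrimeIdeal 𝔭
        q∈       : ℕφ q ∈ 𝔭
        z∈       : z w ∈ 𝔭 · 𝔭

    -- Two bad points of a small cell cannot belong to comparable primes, as
    -- their difference would be too small an element of 𝔭².
    sparse : ∀ {q s} → 0 ℕ.< s → (G ℕ.* s) ℕ.^ n ℕ.< q ℕ.* q → (w : Fin (suc rank) → Fin n → ℤ) →
      (∀ i j → (∀ k → w i k ≡ w j k) → i ≡ j) → (∀ i j k → ℤ.∣ w i k ℤ.- w j k ∣ ℕ.≤ s) →
      ¬ (∀ i → Bad (w i) q)
    sparse {q} {s} 0<s small w distinct close bad =
      few-primes (is-prime zero) 𝔭 is𝔭 q∈ λ i j i≢j → decidable-stable (decide em _) λ none →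
        included i j i≢j λ {a} a∈ → decidable-stable (decide em _) λ a∉ → none (a , a∈ , a∉)
      where
      open module B i = Bad (bad i)
      included : ∀ i j → i ≢ j → ¬ (∀ {a} → a ∈ 𝔭 i → a ∈ 𝔭 j)
      included i j i≢j sub = ℕ.<⇒≱ small (ℕ.≤-trans
        (square-bounded (is𝔭 j) (is-prime j) (q∈ j) α≉0 α∈ α-small (ℕ.*-mono-≤ {1} {suc d} (s≤s z≤n) (ℕ.*-mono-≤ {1} n-positive 0<s)))
        (ℕ.≤-reflexive (cong (ℕ._^ n) (regroup K (suc d) n s))))
        where
        regroup : ∀ k d n s → k ℕ.* (d ℕ.* (n ℕ.* s)) ≡ k ℕ.* (d ℕ.* n) ℕ.* s
        regroup = ℕ-ring
        isSquare = ·-isIdeal (IsPrimeIdeal.isIdeal (is𝔭 j)) (IsPrimeIdeal.isIdeal (is𝔭 j))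
        δ = λ k → w i k ℤ.- w j k
        α∈ : span δ ∈ 𝔭 j · 𝔭 j
        α∈ = cancel-coprime (is𝔭 j) (is-prime j) (q∈ j) (coprime j)
          (Ideal.resp isSquare (≈-trans (z-affine (w i) (w j)) (*-congˡ (span-sub (w i) (w j))))
            (Ideal.sub-closed isSquare (·-mono₂ sub (z∈ i)) (z∈ j)))
        α≉0 : ¬ span δ ≈ 0#
        α≉0 h = i≢j (distinct i j (span-injective (x-y≈0⇒x≈y _ _ (≈-trans (span-sub (w i) (w j)) h))))
        α-small : size (span δ) ℕ.≤ suc d ℕ.* (n ℕ.* s)
        α-small = ℕ.≤-trans (ℕ.≤-reflexive (size-span δ)) (ℕ.*-monoʳ-≤ (suc d) (norm-≤ δ s (close i j)))

    module _ (M Y : ℕ) (start : ∀ i → (G ℕ.* 1) ℕ.^ n ℕ.< suc (Y ℕ.+ i) ℕ.* suc (Y ℕ.+ i)) where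
      open module C i = Cells (cells G n M (suc (Y ℕ.+ i)) (start i))

      point : Fin (suc M ℕ.^ n) → Fin n → ℤ
      point u k = + Fin.toℕ (Fin.finToFun {suc M} {n} u k)

      box-sieve : ∀ m → partial-sum (suc ∘ count) m ℕ.* rank ℕ.< suc M ℕ.^ n →
        ¬ (∀ u → Σ[ i ∈ ℕ ] i ℕ.< m × Bad (point u) (suc (Y ℕ.+ i)))
      box-sieve m few-cells bad =
        let v , ys , unique , same , crowd = crowded-fibre code (partial-sum (suc ∘ count) m) rank
              (List.allFin (suc M ℕ.^ n)) (allFin⁺ _) (All.tabulate λ {u} _ → code< u)
              (ℕ.<-≤-trans few-cells (ℕ.≤-reflexive (≡.sym (length-tabulate {n = suc M ℕ.^ n} (λ i → i)))))
        in crowd-impossible v ys unique same crowd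
        where
        level : ∀ u → ℕ
        level u = proj₁ (bad u)

        coordinate : ∀ i u → Fin n → Fin (g i)
        coordinate i u k = Fin.fromℕ< (index< i (Fin.toℕ<n (Fin.finToFun {suc M} {n} u k)))

        cell : ∀ i u → ℕ
        cell i u = Fin.toℕ (Fin.funToFin (coordinate i u))

        cell< : ∀ i u → cell i u ℕ.< suc (count i)
        cell< i u = ℕ.<-≤-trans (Fin.toℕ<n (Fin.funToFin (coordinate i u))) (ℕ.≤-reflexive (count≡ i))

        code : Fin (suc M ℕ.^ n) → ℕ
        code u = partial-sum (suc ∘ count) (level u) ℕ.+ cell (level u) u

        code< : ∀ u → code u ℕ.< partial-sum (suc ∘ count) m
        code< u = ℕ.<-≤-trans (ℕ.+-monoʳ-< (partial-sum (suc ∘ count) (level u)) (cell< (level u) u))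
          (partial-sum-mono (suc ∘ count) (proj₁ (proj₂ (bad u))))

        same-cell : ∀ i u u′ → cell i u ≡ cell i u′ → ∀ k → ℤ.∣ point u k ℤ.- point u′ k ∣ ℕ.≤ s i
        same-cell i u u′ e k = same-cell⇒close (s i) {{ℕ.>-nonZero (0<s i)}} (≡.trans (≡.sym (quotient≡ u))
          (≡.trans (cong Fin.toℕ coordinate≡) (quotient≡ u′)))
          where
          quotient≡ : ∀ u → Fin.toℕ (coordinate i u k) ≡ _
          quotient≡ u = Fin.toℕ-fromℕ< (index< i (Fin.toℕ<n (Fin.finToFun {suc M} {n} u k)))
          coordinate≡ : coordinate i u k ≡ coordinate i u′ k
          coordinate≡ = ≡.trans (≡.sym (Fin.finToFun-funToFin (coordinate i u) k))
            (≡.trans (cong (λ c → Fin.finToFun c k) (Fin.toℕ-injective e)) (Fin.finToFun-funToFin (coordinate i u′) k))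

        crowd-impossible : ∀ v ys → Unique ys → All (λ u → code u ≡ v) ys → ¬ rank ℕ.< length ys
        crowd-impossible v ys unique same crowd =
          sparse (0<s i₀) (small i₀) (point ∘ u)
            (λ i j e → Fin.inject≤-injective crowd crowd i j (unique-lookup-injective unique _ _
              (finToFun-injective {n = n} (λ k → Fin.toℕ-injective (ℤ.+-injective (e k))))))
            (λ i j → same-cell i₀ (u i) (u j) (≡.trans (at-cell i) (≡.sym (at-cell j))))
            (λ i → subst (λ l → Bad (point (u i)) (suc (Y ℕ.+ l))) (proj₁ (located i)) (proj₂ (proj₂ (bad (u i)))))
          where
          u : Fin (suc rank) → Fin (suc M ℕ.^ n)
          u i = List.lookup ys (Fin.inject≤ i crowd)
          i₀ = level (u zero)
          located : ∀ i → level (u i) ≡ i₀ × cell (level (u i)) (u i) ≡ cell i₀ (u zero)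
          located i = partial-sum-code-injective (suc ∘ count) (cell< _ (u i)) (cell< i₀ (u zero))
            (≡.trans (All.lookup same (∈-lookup (Fin.inject≤ i crowd))) (≡.sym (All.lookup same (∈-lookup (Fin.inject≤ zero crowd)))))
          at-cell : ∀ i → cell i₀ (u i) ≡ cell i₀ (u zero)
          at-cell i = ≡.trans (cong (λ l → cell l (u i)) (≡.sym (proj₁ (located i)))) (proj₂ (located i))

private
  count-bound : ∀ n r G C Y S → 0 ℕ.< n → 0 ℕ.< r → 0 ℕ.< Y → Y ≡ 2 ℕ.* r ℕ.* (4 ℕ.* G) ℕ.^ n →
    let t = suc (2 ℕ.* r ℕ.* C) in
    Y ℕ.* S ℕ.≤ (4 ℕ.* G ℕ.* (t ℕ.* t)) ℕ.^ n ℕ.+ Y ℕ.* (C ℕ.* t) ℕ.^ n → S ℕ.* r ℕ.< (t ℕ.* t) ℕ.^ n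
  count-bound n r G C Y S 0<n 0<r 0<Y Y≡ h = ℕ.*-cancelˡ-< 2 (S ℕ.* r) T (begin-strict
    2 ℕ.* (S ℕ.* r) ≤⟨ ℕ.*-cancelˡ-≤ Y {{ℕ.>-nonZero 0<Y}} scaled ⟩
    T ℕ.+ 2 ℕ.* r ℕ.* X <⟨ ℕ.+-monoʳ-< T X-small ⟩
    T ℕ.+ T ≡⟨ cong (ℕ._+_ T) (≡.sym (ℕ.+-identityʳ T)) ⟩
    2 ℕ.* T ∎)
    where
    open ℕ.≤-Reasoning
    t = suc (2 ℕ.* r ℕ.* C)
    T = (t ℕ.* t) ℕ.^ n
    X = (C ℕ.* t) ℕ.^ n
    scaled : Y ℕ.* (2 ℕ.* (S ℕ.* r)) ℕ.≤ Y ℕ.* (T ℕ.+ 2 ℕ.* r ℕ.* X)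
    scaled = begin
      Y ℕ.* (2 ℕ.* (S ℕ.* r)) ≡⟨ pull Y S r ⟩
      2 ℕ.* r ℕ.* (Y ℕ.* S) ≤⟨ ℕ.*-monoʳ-≤ (2 ℕ.* r) h ⟩
      2 ℕ.* r ℕ.* ((4 ℕ.* G ℕ.* (t ℕ.* t)) ℕ.^ n ℕ.+ Y ℕ.* X) ≡⟨ cong (λ E → 2 ℕ.* r ℕ.* (E ℕ.+ Y ℕ.* X)) (^-distribʳ-* n (4 ℕ.* G) (t ℕ.* t)) ⟩
      2 ℕ.* r ℕ.* ((4 ℕ.* G) ℕ.^ n ℕ.* T ℕ.+ Y ℕ.* X) ≡⟨ spread (2 ℕ.* r) ((4 ℕ.* G) ℕ.^ n) T Y X ⟩
      2 ℕ.* r ℕ.* (4 ℕ.* G) ℕ.^ n ℕ.* T ℕ.+ Y ℕ.* (2 ℕ.* r ℕ.* X) ≡⟨ cong (λ y → y ℕ.* T ℕ.+ Y ℕ.* (2 ℕ.* r ℕ.* X)) (≡.sym Y≡) ⟩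
      Y ℕ.* T ℕ.+ Y ℕ.* (2 ℕ.* r ℕ.* X) ≡⟨ ≡.sym (ℕ.*-distribˡ-+ Y T (2 ℕ.* r ℕ.* X)) ⟩
      Y ℕ.* (T ℕ.+ 2 ℕ.* r ℕ.* X) ∎
      where
      pull : ∀ y s r → y ℕ.* (2 ℕ.* (s ℕ.* r)) ≡ 2 ℕ.* r ℕ.* (y ℕ.* s)
      pull = ℕ-ring
      spread : ∀ r g t y x → r ℕ.* (g ℕ.* t ℕ.+ y ℕ.* x) ≡ r ℕ.* g ℕ.* t ℕ.+ y ℕ.* (r ℕ.* x)
      spread = ℕ-ring
    2rCⁿ<tⁿ : 2 ℕ.* r ℕ.* C ℕ.^ n ℕ.< t ℕ.^ n
    2rCⁿ<tⁿ = ℕ.≤-<-trans (absorb n 0<n) (ℕ.^-monoˡ-< n {{ℕ.>-nonZero 0<n}} (ℕ.n<1+n (2 ℕ.* r ℕ.* C)))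
      where
      absorb : ∀ n → 0 ℕ.< n → 2 ℕ.* r ℕ.* C ℕ.^ n ℕ.≤ (2 ℕ.* r ℕ.* C) ℕ.^ n
      absorb (suc n) _ = begin
        2 ℕ.* r ℕ.* (C ℕ.* C ℕ.^ n) ≡⟨ ≡.sym (ℕ.*-assoc (2 ℕ.* r) C (C ℕ.^ n)) ⟩
        2 ℕ.* r ℕ.* C ℕ.* C ℕ.^ n ≤⟨ ℕ.*-monoʳ-≤ (2 ℕ.* r ℕ.* C) (ℕ.^-monoˡ-≤ n (ℕ.m≤n*m C (2 ℕ.* r) {{ℕ.>-nonZero (ℕ.*-mono-≤ {1} {2} (s≤s z≤n) 0<r)}})) ⟩
        2 ℕ.* r ℕ.* C ℕ.* (2 ℕ.* r ℕ.* C) ℕ.^ n ∎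
    X-small : 2 ℕ.* r ℕ.* X ℕ.< T
    X-small = begin-strict
      2 ℕ.* r ℕ.* X ≡⟨ cong (2 ℕ.* r ℕ.*_) (^-distribʳ-* n C t) ⟩
      2 ℕ.* r ℕ.* (C ℕ.^ n ℕ.* t ℕ.^ n) ≡⟨ ≡.sym (ℕ.*-assoc (2 ℕ.* r) (C ℕ.^ n) (t ℕ.^ n)) ⟩
      2 ℕ.* r ℕ.* C ℕ.^ n ℕ.* t ℕ.^ n <⟨ ℕ.*-monoˡ-< (t ℕ.^ n) {{ℕ.m^n≢0 t n}} 2rCⁿ<tⁿ ⟩
      t ℕ.^ n ℕ.* t ℕ.^ n ≡⟨ ≡.sym (^-distribʳ-* n t t) ⟩
      T ∎

  square-root-bound : ∀ n C t {q} → 0 ℕ.< C → q ℕ.* q ℕ.≤ (C ℕ.* (t ℕ.* t)) ℕ.^ n → q ℕ.≤ (C ℕ.* t) ℕ.^ n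
  square-root-bound n C t {q} 0<C h = ℕ.≮⇒≥ λ X<q → ℕ.<⇒≱ (ℕ.*-mono-< X<q X<q) (ℕ.≤-trans h
    (ℕ.≤-trans (ℕ.^-monoˡ-≤ n (ℕ.≤-trans (ℕ.m≤n*m (C ℕ.* (t ℕ.* t)) C {{ℕ.>-nonZero 0<C}}) (ℕ.≤-reflexive (regroup C t))))
      (ℕ.≤-reflexive (^-distribʳ-* n (C ℕ.* t) (C ℕ.* t)))))
    where
    regroup : ∀ c t → c ℕ.* (c ℕ.* (t ℕ.* t)) ≡ c ℕ.* t ℕ.* (c ℕ.* t)
    regroup = ℕ-ring

coprime-^ : ∀ {p R} e → Prime p → ¬ p ∣ R → Coprime (p ℕ.^ e) R
coprime-^ zero    P p∤R (d∣1 , _) = ∣.∣1⇒≡1 d∣1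
coprime-^ {p} {R} (suc e) P p∤R {c} (c∣p^ , c∣R) = coprime-^ e P p∤R
  (coprime-divisor (λ (b∣c , b∣p) → prime∤⇒coprime P p∤R (b∣p , ∣.∣-trans b∣c c∣R)) c∣p^ , c∣R)

coprime-multiple : ∀ {p} → Prime p → ∀ Y → Σ[ R ∈ ℕ ] ¬ p ∣ R × (∀ q → q ℕ.≤ Y → Prime q → q ≢ p → q ∣ R)
coprime-multiple {p} P zero = 1 ,
  (λ d → ℕ.<⇒≱ (ℕ.nonTrivial⇒n>1 p {{prime⇒nonTrivial P}}) (∣.∣⇒≤ d)) ,
  λ q q≤0 Q _ → contradiction Q (subst (¬_ ∘ Prime) (≡.sym (ℕ.n≤0⇒n≡0 q≤0)) ¬prime[0])
coprime-multiple {p} P (suc Y) with coprime-multiple P Y | prime? (suc Y) | suc Y ℕ.≟ p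
... | R , p∤R , mult | yes Q | no Y≢p = suc Y ℕ.* R ,
  (λ d → [ p∤Y , p∤R ]′ (euclidsLemma (suc Y) R P d)) ,
  λ q q≤ Q q≢p → [ (λ q< → ∣.∣-trans (mult q (ℕ.≤-pred q<) Q q≢p) (∣.n∣m*n (suc Y))) , (λ { refl → ∣.m∣m*n R }) ]′ (ℕ.m≤n⇒m<n∨m≡n q≤)
  where
  p∤Y : ¬ p ∣ suc Y
  p∤Y d with prime⇒irreducible Q d
  ... | inj₁ refl = contradiction P ¬prime[1]
  ... | inj₂ e    = Y≢p (≡.sym e)
... | R , p∤R , mult | no ¬Q | _ = R , p∤R ,
  λ q q≤ Q q≢p → [ (λ q< → mult q (ℕ.≤-pred q<) Q q≢p) , (λ { refl → contradiction Q ¬Q }) ]′ (ℕ.m≤n⇒m<n∨m≡n q≤)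
... | R , p∤R , mult | yes _ | yes e = R , p∤R ,
  λ q q≤ Q q≢p → [ (λ q< → mult q (ℕ.≤-pred q<) Q q≢p) , (λ { refl → contradiction e q≢p }) ]′ (ℕ.m≤n⇒m<n∨m≡n q≤)

module PowerFree (em : ExcludedMiddle (lsuc 0ℓ)) (N : NumberRing) (L : Coordinates N) where
  open Arithmetic em N
  open Coordinates L
  open Geometry em N L
  open Sieve em N L

  private
    Y : ℕ
    Y = 2 ℕ.* suc rank ℕ.* (4 ℕ.* G) ℕ.^ n

    0<G : 0 ℕ.< G
    0<G = ℕ.*-mono-≤ {1} {K} (ℕ.≤-trans (s≤s z≤n) (ℕ.m≤n+m 3 (2 ℕ.* (C ℕ.* (suc d ℕ.* n))))) (ℕ.*-mono-≤ {1} {suc d} (s≤s z≤n) n-positive)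

    0<4Gⁿ : 0 ℕ.< (4 ℕ.* G) ℕ.^ n
    0<4Gⁿ = ℕ.m^n>0 (4 ℕ.* G) {{ℕ.>-nonZero (ℕ.*-mono-≤ {1} {4} (s≤s z≤n) 0<G)}} n

    4Gⁿ≤Y : (4 ℕ.* G) ℕ.^ n ℕ.≤ Y
    4Gⁿ≤Y = ℕ.m≤n*m ((4 ℕ.* G) ℕ.^ n) (2 ℕ.* suc rank)

    0<Y : 0 ℕ.< Y
    0<Y = ℕ.≤-trans 0<4Gⁿ 4Gⁿ≤Y

    box-start : ∀ i → (G ℕ.* 1) ℕ.^ n ℕ.< suc (Y ℕ.+ i) ℕ.* suc (Y ℕ.+ i)
    box-start i = ℕ.≤-trans (s≤s (ℕ.≤-trans (ℕ.^-monoˡ-≤ n (ℕ.≤-trans (ℕ.≤-reflexive (ℕ.*-identityʳ G)) (ℕ.m≤n*m G 4)))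
      (ℕ.≤-trans 4Gⁿ≤Y (ℕ.m≤m+n Y i)))) (ℕ.m≤n*m (suc (Y ℕ.+ i)) (suc (Y ℕ.+ i)))

  module Class {p k e : ℕ} (P : Prime p) (2≤k : 2 ℕ.≤ k) (k≤e : k ℕ.≤ e) (x : Carrier)
    (x-free : ∀ 𝔭 → IsPrimeIdeal 𝔭 → NonzeroIdeal 𝔭 → ℕφ p ∈ 𝔭 → x ∉ 𝔭 ^ᴵ k)
    (R : ℕ) (R-multiple : ∀ q → q ℕ.≤ Y → Prime q → q ≢ p → q ∣ R) (size1<R : size 1# ℕ.< R)
    (u v : ℤ) (bezout : u ℤ.* + (p ℕ.^ e) ℤ.+ v ℤ.* + R ≡ 1ℤ)
    where

    Q = p ℕ.^ e ℕ.* R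
    z₀ = x + ℕφ (p ℕ.^ e) * (φ u * (1# - x))

    translate z : (Fin n → ℤ) → Carrier
    translate w = φ u * (1# - x) + ℕφ R * span w
    z w = z₀ + ℕφ Q * span w

    z≡translate : ∀ w → x + ℕφ (p ℕ.^ e) * translate w ≈ z w
    z≡translate w = ≈-trans
      (solve 6 (λ x a u y r s → x :+ a :* (u :* y :+ r :* s) := (x :+ a :* (u :* y)) :+ (a :* r) :* s)
        ≈-refl x (ℕφ (p ℕ.^ e)) (φ u) (1# - x) (ℕφ R) (span w))
      (+-congˡ (*-congʳ (≈-sym (ℕφ-* (p ℕ.^ e) R))))

    z-affine : ∀ w w′ → z w - z w′ ≈ ℕφ Q * (span w - span w′)
    z-affine w w′ = solve 4 (λ a q s s′ → (a :+ q :* s) :- (a :+ q :* s′) := q :* (s :- s′)) ≈-refl z₀ (ℕφ Q) (span w) (span w′)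

    z≡1 : ∀ w → z w ≈ 1# + ℕφ R * (ℕφ (p ℕ.^ e) * span w - φ v * (1# - x))
    z≡1 w = begin
      z w
        ≈⟨ +-congˡ (*-congʳ (ℕφ-* (p ℕ.^ e) R)) ⟩
      (x + a * (φ u * y)) + (a * r) * s
        ≈⟨ solve 7 (λ x a u r s v y → (x :+ a :* (u :* y)) :+ (a :* r) :* s := (x :+ (u :* a :+ v :* r) :* y) :+ r :* (a :* s :- v :* y)) ≈-refl x a (φ u) r s (φ v) y ⟩
      (x + (φ u * a + φ v * r) * y) + r * (a * s - φ v * y)
        ≈⟨ +-congʳ (+-congˡ (≈-trans (*-congʳ unit) (*-identityˡ y))) ⟩
      (x + (1# - x)) + r * (a * s - φ v * y)
        ≈⟨ +-congʳ (solve 2 (λ x o → x :+ (o :- x) := o) ≈-refl x 1#) ⟩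
      1# + r * (a * s - φ v * y) ∎
      where
      a = ℕφ (p ℕ.^ e)
      r = ℕφ R
      s = span w
      y = 1# - x
      unit : φ u * a + φ v * r ≈ 1#
      unit = ≈-trans (+-cong (≈-sym (φ-* u _)) (≈-sym (φ-* v _))) (≈-trans (≈-sym (φ-+ _ _)) (≈-trans (φ-cong bezout) φ-1))

    z≉0 : ∀ w → ¬ z w ≈ 0#
    z≉0 w h = ℕ.<⇒≱ size1<R (ℕ.≤-trans (ℕ.m≤m*n R (size y) {{ℕ.≢-nonZero y≢0}}) (ℕ.≤-reflexive (≡.sym size1≡)))
      where
      y = - (ℕφ (p ℕ.^ e) * span w - φ v * (1# - x))
      size1≡ : size 1# ≡ R ℕ.* size y
      size1≡ = ≡.trans (size-cong (begin
        1# ≈⟨ solve 3 (λ o r t → o := (o :+ r :* t) :+ r :* (:- t)) ≈-refl 1# (ℕφ R) _ ⟩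
        (1# + ℕφ R * (ℕφ (p ℕ.^ e) * span w - φ v * (1# - x))) + ℕφ R * y ≈⟨ +-congʳ (≈-trans (≈-sym (z≡1 w)) h) ⟩
        0# + ℕφ R * y ≈⟨ +-identityˡ _ ⟩
        ℕφ R * y ∎)) (size-φ* (+ R) y)
      y≢0 : size y ≢ 0
      y≢0 e = 1≉0 (size≡0⇒≈0 (≡.trans size1≡ (≡.trans (cong (R ℕ.*_) e) (ℕ.*-zeroʳ R))))

    B₀ C₃ t X m W : ℕ
    B₀ = suc (size z₀ ℕ.+ Q ℕ.* (suc d ℕ.* n))
    C₃ = K ℕ.* B₀ ℕ.+ Y
    t  = suc (2 ℕ.* suc rank ℕ.* C₃)
    X  = (C₃ ℕ.* t) ℕ.^ n
    m  = X ℕ.∸ Y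
    W  = 2 ℕ.* suc rank ℕ.* C₃ ℕ.+ 2 ℕ.* suc rank ℕ.* C₃ ℕ.* t

    size-z : ∀ w → (∀ i → ℤ.∣ w i ∣ ℕ.≤ suc W) → size (z w) ℕ.≤ B₀ ℕ.* suc W
    size-z w h = ℕ.≤-trans (size-+ z₀ (ℕφ Q * span w)) (ℕ.≤-trans
        (ℕ.+-mono-≤ (ℕ.m≤m*n (size z₀) (suc W))
          (ℕ.≤-trans (ℕ.≤-reflexive (≡.trans (size-φ* (+ Q) (span w)) (cong (Q ℕ.*_) (size-span w))))
            (ℕ.*-monoʳ-≤ Q (ℕ.*-monoʳ-≤ (suc d) (norm-≤ w (suc W) h)))))
        (ℕ.≤-trans (ℕ.≤-reflexive (collect (size z₀) Q (suc d) n (suc W))) (ℕ.*-monoˡ-≤ (suc W) (ℕ.n≤1+n (size z₀ ℕ.+ Q ℕ.* (suc d ℕ.* n))))))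
        where
        collect : ∀ s q d n m → s ℕ.* m ℕ.+ q ℕ.* (d ℕ.* (n ℕ.* m)) ≡ (s ℕ.+ q ℕ.* (d ℕ.* n)) ℕ.* m
        collect = ℕ-ring

    bad-prime : ∀ w → (∀ i → ℤ.∣ w i ∣ ℕ.≤ suc W) → ∀ 𝔭 → IsPrimeIdeal 𝔭 → NonzeroIdeal 𝔭 → z w ∈ 𝔭 ^ᴵ k →
      Σ[ i ∈ ℕ ] i ℕ.< m × Bad z z-affine w (suc (Y ℕ.+ i))
    bad-prime w bounded 𝔭 is𝔭 nonzero z∈ =
      let q , Qp , q∈ = rational-prime nonzero
          q≢p : q ≢ p
          q≢p = λ { refl → x-free 𝔭 is𝔭 nonzero q∈ (Ideal.≡-∈ {𝔭 ^ᴵ k} isPower {x} {z w} (x-z∈ q∈) z∈) }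
          q∤R : ¬ q ∣ R
          q∤R = λ d → proper (resp (solve 2 (λ o t → (o :+ t) :- t := o) ≈-refl 1# _)
            (sub-closed (resp (z≡1 w) (^⊆ isIdeal 1≤k z∈)) (*-closedʳ _ (∣⇒∈ {z = + R} q∈ d))))
          Y<q : Y ℕ.< q
          Y<q = ℕ.≰⇒> λ q≤Y → q∤R (R-multiple q q≤Y Qp q≢p)
          q≤X : q ℕ.≤ X
          q≤X = square-root-bound n C₃ t (ℕ.≤-trans 0<Y (ℕ.m≤n+m Y (K ℕ.* B₀))) (ℕ.≤-trans
            (square-bounded is𝔭 Qp q∈ (z≉0 w) (^⊆square isIdeal 2≤k z∈) (size-z w bounded) (s≤s z≤n))
            (ℕ.^-monoˡ-≤ n (ℕ.≤-trans (ℕ.≤-reflexive (≡.sym (ℕ.*-assoc K B₀ (suc W)))) (ℕ.*-monoˡ-≤ (suc W) (ℕ.m≤m+n (K ℕ.* B₀) Y)))))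
          q≡ : suc (Y ℕ.+ (q ℕ.∸ suc Y)) ≡ q
          q≡ = ℕ.m+[n∸m]≡n Y<q
          q∤Q : ¬ q ∣ Q
          q∤Q = λ d → [ (λ d^ → q≢p (prime-power Qp e d^)) , q∤R ]′ (euclidsLemma (p ℕ.^ e) R Qp d)
      in q ℕ.∸ suc Y , ℕ.+-cancelˡ-< Y _ _ (ℕ.≤-trans (ℕ.≤-reflexive q≡) (ℕ.≤-trans q≤X (ℕ.m≤n+m∸n X Y))) ,
         subst (λ q → Bad z z-affine w q) (≡.sym q≡) (record
           { is-prime = Qp ; coprime = q∤Q ; 𝔭 = 𝔭 ; is𝔭 = is𝔭 ; q∈ = q∈ ; z∈ = ^⊆square isIdeal 2≤k z∈ })
      where
      open PrimeIdeal is𝔭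
      isPower = ^ᴵ-isIdeal isIdeal k
      1≤k = ℕ.≤-trans (ℕ.n≤1+n 1) 2≤k
      prime-power : ∀ {q} → Prime q → ∀ e → q ∣ p ℕ.^ e → q ≡ p
      prime-power Qp zero    d = contradiction (∣.∣1⇒≡1 d) λ { refl → ¬prime[1] Qp }
      prime-power Qp (suc e) d with euclidsLemma p (p ℕ.^ e) Qp d
      ... | inj₂ d^ = prime-power Qp e d^
      ... | inj₁ d₁ with prime⇒irreducible P d₁
      ...   | inj₁ refl = contradiction Qp ¬prime[1]
      ...   | inj₂ q≡p  = q≡p
      x-z∈ : ℕφ p ∈ 𝔭 → x - z w ∈ 𝔭 ^ᴵ k
      x-z∈ p∈ = IsIdeal.resp isPower (begin
        ℕφ (p ℕ.^ e) * - translate w ≈⟨ solve 3 (λ x a t → a :* (:- t) := x :- (x :+ a :* t)) ≈-refl x (ℕφ (p ℕ.^ e)) (translate w) ⟩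
        x - (x + ℕφ (p ℕ.^ e) * translate w) ≈⟨ +-congˡ (-‿cong (z≡translate w)) ⟩
        x - z w ∎)
        (Ideal.*-closedʳ isPower (- translate w) (subst (λ e → ℕφ (p ℕ.^ e) ∈ 𝔭 ^ᴵ k) (ℕ.m+[n∸m]≡n k≤e)
          (IsIdeal.resp isPower (≈-trans (≈-sym (ℕφ-* (p ℕ.^ k) (p ℕ.^ (e ℕ.∸ k)))) (φ-cong (cong +_ (≡.sym (ℕ.^-distribˡ-+-* p k (e ℕ.∸ k))))))
            (Ideal.*-closedʳ isPower _ (ℕφ^∈ p p∈ k)))))

    few-cells : partial-sum (λ i → suc (Cells.count (cells G n W (suc (Y ℕ.+ i)) (box-start i)))) m ℕ.* rank ℕ.< suc W ℕ.^ n
    few-cells = ℕ.≤-<-trans (ℕ.*-monoʳ-≤ S (ℕ.n≤1+n rank)) (count-bound n (suc rank) G C₃ Y S n-positive (s≤s z≤n) 0<Y refl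
      (subst (λ X → Y ℕ.* S ℕ.≤ (4 ℕ.* G ℕ.* suc W) ℕ.^ n ℕ.+ Y ℕ.* X) (ℕ.m+[n∸m]≡n Y≤X)
        (inverse-square-sum Y ((4 ℕ.* G ℕ.* suc W) ℕ.^ n) _ 0<Y (λ i → Cells.few (cells G n W (suc (Y ℕ.+ i)) (box-start i))) m)))
      where
      S = partial-sum (λ i → suc (Cells.count (cells G n W (suc (Y ℕ.+ i)) (box-start i)))) m
      Y≤C₃t : Y ℕ.≤ C₃ ℕ.* t
      Y≤C₃t = ℕ.≤-trans (ℕ.m≤n+m Y (K ℕ.* B₀)) (ℕ.m≤m*n C₃ t)
      Y≤X : Y ℕ.≤ X
      Y≤X = ℕ.≤-trans Y≤C₃t (ℕ.≤-trans (ℕ.≤-reflexive (≡.sym (ℕ.^-identityʳ (C₃ ℕ.* t))))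
        (ℕ.^-monoʳ-≤ (C₃ ℕ.* t) {{ℕ.>-nonZero (ℕ.≤-trans 0<Y Y≤C₃t)}} n-positive))

    not-all-bad : ¬ (∀ w → Σ[ 𝔭 ∈ Pred Carrier 0ℓ ] IsPrimeIdeal 𝔭 × NonzeroIdeal 𝔭 × z w ∈ 𝔭 ^ᴵ k)
    not-all-bad bad = box-sieve z z-affine W Y box-start m few-cells λ u →
      let w = point z z-affine W Y box-start u
          𝔭 , is𝔭 , nonzero , z∈ = bad w
      in bad-prime w (λ i → ℕ.<⇒≤ (Fin.toℕ<n (Fin.finToFun {suc W} {n} u i))) 𝔭 is𝔭 nonzero z∈

  power-free-in-class : ∀ {p} → Prime p → ∀ {k e} → 2 ℕ.≤ k → k ℕ.≤ e → ∀ x →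
    (∀ 𝔭 → IsPrimeIdeal 𝔭 → NonzeroIdeal 𝔭 → ℕφ p ∈ 𝔭 → x ∉ 𝔭 ^ᴵ k) →
    Σ[ w ∈ Carrier ] (∀ 𝔭 → IsPrimeIdeal 𝔭 → NonzeroIdeal 𝔭 → x + ℕφ (p ℕ.^ e) * w ∉ 𝔭 ^ᴵ k)
  power-free-in-class {p} P {k} {e} 2≤k k≤e x x-free = decidable-stable em λ none →
    not-all-bad λ w → decidable-stable em λ good →
      none (translate w , λ 𝔭 is𝔭 nonzero z∈ → good (𝔭 , is𝔭 , nonzero ,
        IsIdeal.resp (^ᴵ-isIdeal (IsPrimeIdeal.isIdeal is𝔭) k) (z≡translate w) z∈))
    where
    R₀ = coprime-multiple P Y
    R = proj₁ R₀ ℕ.* suc (p ℕ.* size 1#)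
    R₀≢0 : proj₁ R₀ ≢ 0
    R₀≢0 h = proj₁ (proj₂ R₀) (subst (p ∣_) (≡.sym h) (p ∣.∣0))
    p∤R : ¬ p ∣ R
    p∤R d = [ proj₁ (proj₂ R₀) , (λ d′ → contradiction (∣.∣1⇒≡1 (∣.∣m+n∣m⇒∣n (subst (p ∣_) (ℕ.+-comm 1 (p ℕ.* size 1#)) d′) (∣.m∣m*n (size 1#))))
      λ { refl → ¬prime[1] P }) ]′ (euclidsLemma (proj₁ R₀) (suc (p ℕ.* size 1#)) P d)
    size1<R : size 1# ℕ.< R
    size1<R = ℕ.<-≤-trans (s≤s (ℕ.m≤n*m (size 1#) p {{ℕ.≢-nonZero λ { refl → ¬prime[0] P }}}))
      (ℕ.m≤n*m (suc (p ℕ.* size 1#)) (proj₁ R₀) {{ℕ.≢-nonZero R₀≢0}})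
    open Class P 2≤k k≤e x x-free R
      (λ q q≤Y Q q≢p → ∣.∣-trans (proj₂ (proj₂ R₀) q q≤Y Q q≢p) (∣.m∣m*n (suc (p ℕ.* size 1#)))) size1<R
      (proj₁ (bézout (coprime-^ e P p∤R))) (proj₁ (proj₂ (bézout (coprime-^ e P p∤R)))) (proj₂ (proj₂ (bézout (coprime-^ e P p∤R))))

-- Integer polynomials: divided differences

diffℤ : ∀ {n} → Vec ℤ n → ℤ → ℤ → ℤ
diffℤ []      r s = 0ℤ
diffℤ (a ∷ p) r s = eval p r ℤ.+ s ℤ.* diffℤ p r s

eval-diff : ∀ {n} (p : Vec ℤ n) r s → eval p r ≡ eval p s ℤ.+ (r ℤ.- s) ℤ.* diffℤ p r s
eval-diff []      r s = ≡.sym (vanish r s)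
  where
  vanish : ∀ r s → 0ℤ ℤ.+ (r ℤ.- s) ℤ.* 0ℤ ≡ 0ℤ
  vanish = ℤ-ring
eval-diff (a ∷ p) r s = ≡.trans
  (split a r s (eval p r)) (≡.trans (cong (λ y → a ℤ.+ (r ℤ.- s) ℤ.* eval p r ℤ.+ s ℤ.* y) (eval-diff p r s))
    (merge a r s (eval p r) (eval p s) (diffℤ p r s)))
  where
  split : ∀ a r s y → a ℤ.+ r ℤ.* y ≡ a ℤ.+ (r ℤ.- s) ℤ.* y ℤ.+ s ℤ.* y
  split = ℤ-ring
  merge : ∀ a r s y z q → a ℤ.+ (r ℤ.- s) ℤ.* y ℤ.+ s ℤ.* (z ℤ.+ (r ℤ.- s) ℤ.* q) ≡
                          a ℤ.+ s ℤ.* z ℤ.+ (r ℤ.- s) ℤ.* (y ℤ.+ s ℤ.* q)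
  merge = ℤ-ring

diffℤ-diagonal : ∀ {n} (p : Vec ℤ n) r s → Σ[ j ∈ ℤ ] diffℤ p r s ≡ diffℤ p s s ℤ.+ (r ℤ.- s) ℤ.* j
diffℤ-diagonal []      r s = 0ℤ , ≡.sym (vanish r s)
  where
  vanish : ∀ r s → 0ℤ ℤ.+ (r ℤ.- s) ℤ.* 0ℤ ≡ 0ℤ
  vanish = ℤ-ring
diffℤ-diagonal (a ∷ p) r s =
  let j , e = diffℤ-diagonal p r s
  in diffℤ p r s ℤ.+ s ℤ.* j , ≡.trans (cong₂ (λ y q → y ℤ.+ s ℤ.* q) (eval-diff p r s) e)
       (merge (eval p s) (r ℤ.- s) (diffℤ p r s) s (diffℤ p s s) j)
  where
  merge : ∀ z t q s d j → (z ℤ.+ t ℤ.* q) ℤ.+ s ℤ.* (d ℤ.+ t ℤ.* j) ≡ (z ℤ.+ s ℤ.* d) ℤ.+ t ℤ.* (q ℤ.+ s ℤ.* j)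
  merge = ℤ-ring

bézoutℤ : ∀ {p} → Prime p → ∀ D → ¬ p ∣ ℤ.∣ D ∣ → Σ[ u ∈ ℤ ] Σ[ v ∈ ℤ ] u ℤ.* D ℤ.+ v ℤ.* + p ≡ 1ℤ
bézoutℤ {p} P D p∤D with bézout (prime∤⇒coprime P p∤D)
... | v , u , e with ℤ.+∣i∣≡i⊎+∣i∣≡-i D
...   | inj₁ h = u , v , ≡.trans (≡.trans (cong (λ D → u ℤ.* D ℤ.+ v ℤ.* + p) (≡.sym h)) (ℤ.+-comm (u ℤ.* + ℤ.∣ D ∣) (v ℤ.* + p))) e
...   | inj₂ h = ℤ.- u , v , ≡.trans (≡.trans (flip-sign u D (v ℤ.* + p)) (cong (λ D → v ℤ.* + p ℤ.+ u ℤ.* D) (≡.sym h))) e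
  where
  flip-sign : ∀ u D x → ℤ.- u ℤ.* D ℤ.+ x ≡ x ℤ.+ u ℤ.* (ℤ.- D)
  flip-sign = ℤ-ring

-- Newton's step, with t = − k / D modulo p.
hensel-step : ∀ {n} (g : Vec ℤ n) {p l} → Prime p → ∀ r k → eval g r ≡ + (p ℕ.^ suc l) ℤ.* k →
  ¬ p ∣ ℤ.∣ diffℤ g r r ∣ →
  Σ[ t ∈ ℤ ] Σ[ k′ ∈ ℤ ] eval g (r ℤ.+ + (p ℕ.^ suc l) ℤ.* t) ≡ + (p ℕ.^ suc (suc l)) ℤ.* k′
hensel-step g {p} {l} P r k e p∤D =
  let u , v , bez = bézoutℤ P (diffℤ g r r) p∤D
      t  = ℤ.- k ℤ.* u
      r′ = r ℤ.+ + q ℤ.* t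
      j , diag = diffℤ-diagonal g r′ r
  in t , k ℤ.* v ℤ.+ + (p ℕ.^ l) ℤ.* t ℤ.* t ℤ.* j , (begin
       eval g r′
         ≡⟨ eval-diff g r′ r ⟩
       eval g r ℤ.+ (r′ ℤ.- r) ℤ.* diffℤ g r′ r
         ≡⟨ cong₂ (λ E D → E ℤ.+ (r′ ℤ.- r) ℤ.* D) e diag ⟩
       + q ℤ.* k ℤ.+ (r′ ℤ.- r) ℤ.* (diffℤ g r r ℤ.+ (r′ ℤ.- r) ℤ.* j)
         ≡⟨ newton (+ q) k r (diffℤ g r r) u v (+ p) j ⟩
       + q ℤ.* (k ℤ.* (1ℤ ℤ.- (u ℤ.* diffℤ g r r ℤ.+ v ℤ.* + p)) ℤ.+ k ℤ.* v ℤ.* + p ℤ.+ + q ℤ.* t ℤ.* t ℤ.* j)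
         ≡⟨ cong (λ o → + q ℤ.* (k ℤ.* (1ℤ ℤ.- o) ℤ.+ k ℤ.* v ℤ.* + p ℤ.+ + q ℤ.* t ℤ.* t ℤ.* j)) bez ⟩
       + q ℤ.* (k ℤ.* 0ℤ ℤ.+ k ℤ.* v ℤ.* + p ℤ.+ + q ℤ.* t ℤ.* t ℤ.* j)
         ≡⟨ cong (λ q′ → + q ℤ.* (k ℤ.* 0ℤ ℤ.+ k ℤ.* v ℤ.* + p ℤ.+ q′ ℤ.* t ℤ.* t ℤ.* j)) (ℤ.pos-* p (p ℕ.^ l)) ⟩
       + q ℤ.* (k ℤ.* 0ℤ ℤ.+ k ℤ.* v ℤ.* + p ℤ.+ + p ℤ.* + (p ℕ.^ l) ℤ.* t ℤ.* t ℤ.* j)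
         ≡⟨ extract (+ q) k v (+ p) (+ (p ℕ.^ l)) t j ⟩
       + p ℤ.* + q ℤ.* (k ℤ.* v ℤ.+ + (p ℕ.^ l) ℤ.* t ℤ.* t ℤ.* j)
         ≡⟨ cong (ℤ._* (k ℤ.* v ℤ.+ + (p ℕ.^ l) ℤ.* t ℤ.* t ℤ.* j)) (≡.sym (ℤ.pos-* p q)) ⟩
       + (p ℕ.* q) ℤ.* (k ℤ.* v ℤ.+ + (p ℕ.^ l) ℤ.* t ℤ.* t ℤ.* j) ∎)
  where
  open ≡.≡-Reasoning
  q = p ℕ.^ suc l
  newton : ∀ q k r D u v p j → let t = ℤ.- k ℤ.* u ; r′ = r ℤ.+ q ℤ.* t in
    q ℤ.* k ℤ.+ (r′ ℤ.- r) ℤ.* (D ℤ.+ (r′ ℤ.- r) ℤ.* j) ≡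
    q ℤ.* (k ℤ.* (1ℤ ℤ.- (u ℤ.* D ℤ.+ v ℤ.* p)) ℤ.+ k ℤ.* v ℤ.* p ℤ.+ q ℤ.* t ℤ.* t ℤ.* j)
  newton = ℤ-ring
  extract : ∀ q k v p s t j → q ℤ.* (k ℤ.* 0ℤ ℤ.+ k ℤ.* v ℤ.* p ℤ.+ p ℤ.* s ℤ.* t ℤ.* t ℤ.* j) ≡
                              p ℤ.* q ℤ.* (k ℤ.* v ℤ.+ s ℤ.* t ℤ.* t ℤ.* j)
  extract = ℤ-ring

weight : ∀ {n} → ℕ → Vec ℤ n → Vec ℤ n
weight k []      = []
weight k (b ∷ p) = + k ℤ.* b ∷ weight (suc k) p

lookup-weight : ∀ {n} k (p : Vec ℤ n) i → Vec.lookup p i ≢ 0ℤ → Vec.lookup (weight (suc k) p) i ≢ 0ℤ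
lookup-weight k (b ∷ p) zero    h e = [ (λ ()) , h ]′ (ℤ.i*j≡0⇒i≡0∨j≡0 (+ suc k) e)
lookup-weight k (b ∷ p) (suc i) h   = lookup-weight (suc k) p i h

module Separable (em : ExcludedMiddle (lsuc 0ℓ)) (N : NumberRing) where
  open Arithmetic em N

  diff : ∀ {n} → Vec ℤ n → Carrier → Carrier → Carrier
  diff []      x y = 0#
  diff (a ∷ p) x y = ⟦ p ⟧ x + y * diff p x y

  ⟦⟧-diff : ∀ {n} (p : Vec ℤ n) x y → ⟦ p ⟧ x - ⟦ p ⟧ y ≈ (x - y) * diff p x y
  ⟦⟧-diff []      x y = ≈-trans (-‿inverseʳ 0#) (≈-sym (zeroʳ _))
  ⟦⟧-diff (a ∷ p) x y = begin
    (φ a + x * ⟦ p ⟧ x) - (φ a + y * ⟦ p ⟧ y)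
      ≈⟨ solve 5 (λ a x y u v → (a :+ x :* u) :- (a :+ y :* v) := (x :- y) :* u :+ y :* (u :- v)) ≈-refl (φ a) x y (⟦ p ⟧ x) (⟦ p ⟧ y) ⟩
    (x - y) * ⟦ p ⟧ x + y * (⟦ p ⟧ x - ⟦ p ⟧ y)
      ≈⟨ +-congˡ (*-congˡ (⟦⟧-diff p x y)) ⟩
    (x - y) * ⟦ p ⟧ x + y * ((x - y) * diff p x y)
      ≈⟨ solve 4 (λ t u y q → t :* u :+ y :* (t :* q) := t :* (u :+ y :* q)) ≈-refl (x - y) (⟦ p ⟧ x) y (diff p x y) ⟩
    (x - y) * (⟦ p ⟧ x + y * diff p x y) ∎

  diff-φ : ∀ {n} (p : Vec ℤ n) r s → diff p (φ r) (φ s) ≈ φ (diffℤ p r s)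
  diff-φ []      r s = ≈-sym φ-0
  diff-φ (a ∷ p) r s = ≈-trans (+-cong (⟦⟧-φ p r) (*-congˡ (diff-φ p r s)))
    (≈-trans (+-congˡ (≈-sym (φ-* s (diffℤ p r s)))) (≈-sym (φ-+ _ _)))

  diff-≡ : ∀ {I} (isI : IsIdeal I) {n} (p : Vec ℤ n) {x x′ y y′} → x - x′ ∈ I → y - y′ ∈ I → diff p x y - diff p x′ y′ ∈ I
  diff-≡ isI []      _ _ = IsIdeal.resp isI (≈-sym (-‿inverseʳ 0#)) (IsIdeal.0∈ isI)
  diff-≡ isI (a ∷ p) {x} {x′} {y} {y′} dx dy = IsIdeal.resp isI
    (solve 6 (λ u u′ y y′ q q′ → (u :- u′) :+ ((y :- y′) :* q :+ y′ :* (q :- q′)) := (u :+ y :* q) :- (u′ :+ y′ :* q′)) ≈-refl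
      (⟦ p ⟧ x) (⟦ p ⟧ x′) y y′ (diff p x y) (diff p x′ y′))
    (+-closed (⟦⟧-≡ p dx) (+-closed (*-closedʳ _ dy) (*-closed y′ (diff-≡ isI p dx dy))))
    where open Ideal isI

  ⟦⟧-weight : ∀ {n} k (p : Vec ℤ n) x → ⟦ weight k p ⟧ x ≈ ℕφ k * ⟦ p ⟧ x + x * diff p x x
  ⟦⟧-weight k []      x = ≈-sym (≈-trans (+-cong (zeroʳ _) (zeroʳ _)) (+-identityˡ 0#))
  ⟦⟧-weight k (b ∷ p) x = begin
    φ (+ k ℤ.* b) + x * ⟦ weight (suc k) p ⟧ x
      ≈⟨ +-cong (φ-* (+ k) b) (*-congˡ (⟦⟧-weight (suc k) p x)) ⟩
    ℕφ k * φ b + x * (ℕφ (suc k) * ⟦ p ⟧ x + x * diff p x x)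
      ≈⟨ +-congˡ (*-congˡ (+-congʳ (*-congʳ (φ-+ 1ℤ (+ k))))) ⟩
    ℕφ k * φ b + x * ((φ 1ℤ + ℕφ k) * ⟦ p ⟧ x + x * diff p x x)
      ≈⟨ solve 5 (λ k b x u q → k :* b :+ x :* ((con 1ℤ :+ k) :* u :+ x :* q) := k :* (b :+ x :* u) :+ x :* (u :+ x :* q)) ≈-refl
           (ℕφ k) (φ b) x (⟦ p ⟧ x) (diff p x x) ⟩
    ℕφ k * (φ b + x * ⟦ p ⟧ x) + x * (⟦ p ⟧ x + x * diff p x x) ∎

  ⟦⟧-zeros : ∀ {n} (p : Vec ℤ n) x → (∀ i → Vec.lookup p i ≡ 0ℤ) → ⟦ p ⟧ x ≈ 0#
  ⟦⟧-zeros []      x h = ≈-refl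
  ⟦⟧-zeros (a ∷ p) x h = ≈-trans (+-cong (≈-trans (φ-cong (h zero)) φ-0) (≈-trans (*-congˡ (⟦⟧-zeros p x (h ∘ suc))) (zeroʳ x))) (+-identityˡ 0#)

  simple-root : ∀ {n} (p : Vec ℤ n) x → (∃[ i ] Vec.lookup p i ≢ 0ℤ) → ⟦ p ⟧ x ≈ 0# →
                Σ[ m ∈ ℕ ] Σ[ q ∈ Vec ℤ m ] ⟦ q ⟧ x ≈ 0# × ¬ diff q x x ≈ 0#
  simple-root []      x (() , _) root
  simple-root (a ∷ p) x (i , pᵢ≢0) root with decide em (diff (a ∷ p) x x ≈ 0#)
  ... | no  simple = _ , a ∷ p , root , simple
  ... | yes double with Fin.any? (λ i → ¬? (Vec.lookup p i ℤ.≟ 0ℤ))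
  ...   | yes (j , pⱼ≢0) = simple-root (weight 1 p) x (j , lookup-weight 0 p j pⱼ≢0)
            (≈-trans (⟦⟧-weight 1 p x) (≈-trans (+-congʳ (≈-trans (*-congʳ φ-1) (*-identityˡ _))) double))
  ...   | no  none = contradiction (constant i) pᵢ≢0
    where
    zeros : ∀ i → Vec.lookup p i ≡ 0ℤ
    zeros i = decidable-stable (Vec.lookup p i ℤ.≟ 0ℤ) (λ h → none (i , h))
    constant : ∀ i → Vec.lookup (a ∷ p) i ≡ 0ℤ
    constant (suc i) = zeros i
    constant zero    = φ-injective (begin
      φ a ≈⟨ ≈-sym (+-identityʳ _) ⟩
      φ a + 0# ≈⟨ +-congˡ (≈-sym (≈-trans (*-congˡ (⟦⟧-zeros p x zeros)) (zeroʳ x))) ⟩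
      φ a + x * ⟦ p ⟧ x ≈⟨ root ⟩
      0# ∎)

module MaximalIdeals (em : ExcludedMiddle (lsuc 0ℓ)) (N : NumberRing) (L : Coordinates N) where
  open Arithmetic em N
  open Coordinates L
  open Geometry em N L using (κ-sub)

  private
    modulus : ℕ → ℕ
    modulus c = suc c ℕ.* suc d

    residue : ∀ c → Carrier → Fin (modulus c ℕ.^ n)
    residue c x = Fin.funToFin λ i → Fin.fromℕ< (ℤ.n%ℕd<d (κ x i) (modulus c))

    same-residue : ∀ c x y → residue c x ≡ residue c y → Σ[ w ∈ Carrier ] x - y ≈ ℕφ (suc c) * w
    same-residue c x y e = span w , κ-injective difference
      where
      m = modulus c
      w = λ i → κ x i ℤ./ℕ m ℤ.- κ y i ℤ./ℕ m
      remainders : ∀ i → κ x i ℤ.%ℕ m ≡ κ y i ℤ.%ℕ m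
      remainders i = ≡.trans (≡.sym (Fin.toℕ-fromℕ< (ℤ.n%ℕd<d (κ x i) m)))
        (≡.trans (cong Fin.toℕ (≡.trans (≡.sym (Fin.finToFun-funToFin (λ i → Fin.fromℕ< (ℤ.n%ℕd<d (κ x i) m)) i))
          (≡.trans (cong (λ v → Fin.finToFun v i) e) (Fin.finToFun-funToFin (λ i → Fin.fromℕ< (ℤ.n%ℕd<d (κ y i) m)) i))))
          (Fin.toℕ-fromℕ< (ℤ.n%ℕd<d (κ y i) m)))
      cancel : ∀ r p q c d → (r ℤ.+ p ℤ.* (c ℤ.* d)) ℤ.- (r ℤ.+ q ℤ.* (c ℤ.* d)) ≡ c ℤ.* (d ℤ.* (p ℤ.- q))
      cancel = ℤ-ring
      difference : ∀ i → κ (x - y) i ≡ κ (ℕφ (suc c) * span w) i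
      difference i = ≡.trans (κ-sub x y i) (≡.trans (cong₂ ℤ._-_ (ℤ.a≡a%ℕn+[a/ℕn]*n (κ x i) m) (ℤ.a≡a%ℕn+[a/ℕn]*n (κ y i) m))
        (≡.trans (cong (λ r → (+ (κ x i ℤ.%ℕ m) ℤ.+ (κ x i ℤ./ℕ m) ℤ.* + m) ℤ.- (+ r ℤ.+ (κ y i ℤ./ℕ m) ℤ.* + m)) (≡.sym (remainders i)))
        (≡.trans (cong (λ m′ → (+ (κ x i ℤ.%ℕ m) ℤ.+ (κ x i ℤ./ℕ m) ℤ.* m′) ℤ.- (+ (κ x i ℤ.%ℕ m) ℤ.+ (κ y i ℤ./ℕ m) ℤ.* m′)) (ℤ.pos-* (suc c) (suc d)))
        (≡.trans (cancel (+ (κ x i ℤ.%ℕ m)) (κ x i ℤ./ℕ m) (κ y i ℤ./ℕ m) (+ suc c) (+ suc d))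
        (≡.sym (≡.trans (κ-scale (+ suc c) (span w) i) (cong (ℤ._*_ (+ suc c)) (κ-span w i))))))))

    representatives-of : ∀ c (vs : List (Fin (modulus c ℕ.^ n))) →
      Σ[ xs ∈ List Carrier ] (∀ x → residue c x ∈ˡ vs → Σ[ x′ ∈ Carrier ] x′ ∈ˡ xs × residue c x ≡ residue c x′)
    representatives-of c []       = [] , λ _ ()
    representatives-of c (v ∷ vs) with representatives-of c vs | decide em (Σ[ x ∈ Carrier ] residue c x ≡ v)
    ... | xs , h | yes (x′ , e) = x′ ∷ xs , λ where
      x (here e′)  → x′ , here refl , ≡.trans e′ (≡.sym e)
      x (there i)  → let x″ , i″ , e″ = h x i in x″ , there i″ , e″
    ... | xs , h | no none = xs , λ where
      x (here e)   → contradiction (x , e) none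
      x (there i)  → h x i

  representatives : ∀ c → Σ[ xs ∈ List Carrier ]
    (∀ x → Σ[ x′ ∈ Carrier ] x′ ∈ˡ xs × (Σ[ w ∈ Carrier ] x - x′ ≈ ℕφ (suc c) * w))
  representatives c = let xs , h = representatives-of c (List.allFin _) in xs , λ x →
    let x′ , i , e = h x (∈-allFin _) in x′ , i , same-residue c x x′ e

  private
    enlarge : ∀ {I} → IsIdeal I → 1# ∉ I → ∀ xs →
      Σ[ J ∈ Pred Carrier 0ℓ ] IsIdeal J × (∀ {x} → x ∈ I → x ∈ J) × 1# ∉ J ×
        (∀ {x} → x ∈ˡ xs → x ∈ J ⊎ (Σ[ r ∈ Carrier ] 1# - r * x ∈ J))
    enlarge {I} isI 1∉I []       = I , isI , (λ h → h) , 1∉I , λ ()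
    enlarge {I} isI 1∉I (x ∷ xs) with decide em (Σ[ r ∈ Carrier ] 1# - r * x ∈ I)
    ... | yes (r , h) =
      let J , isJ , I⊆J , 1∉J , max = enlarge isI 1∉I xs
      in J , isJ , I⊆J , 1∉J , λ { (here refl) → inj₂ (r , I⊆J h) ; (there i) → max i }
    ... | no coprime =
      let J , isJ , I′⊆J , 1∉J , max = enlarge isI′ coprime xs
      in J , isJ , (λ {y} y∈ → I′⊆J (0# , resp (solve 2 (λ x y → y := y :- con 0ℤ :* x) ≈-refl x y ⟨≈⟩ +-congˡ (-‿cong (*-congʳ φ-0))) y∈)) , 1∉J ,
         λ { (here refl) → inj₁ (I′⊆J (1# , resp (≈-trans (≈-sym (-‿inverseʳ x)) (+-congˡ (-‿cong (≈-sym (*-identityˡ x))))) 0∈)) ; (there i) → max i }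
      where
      open Ideal isI
      _⟨≈⟩_ = ≈-trans
      I′ : Pred Carrier 0ℓ
      I′ y = Σ[ r ∈ Carrier ] y - r * x ∈ I
      isI′ : IsIdeal I′
      isI′ = record
        { resp     = λ e (r , h) → r , resp (+-congʳ e) h
        ; 0∈       = 0# , resp (≈-trans (≈-sym (-‿inverseʳ 0#)) (+-congˡ (-‿cong (≈-sym (zeroˡ x))))) 0∈
        ; +-closed = λ {y} {z} (r , h) (s , k) → r + s , resp
            (solve 5 (λ y z r s x → (y :- r :* x) :+ (z :- s :* x) := (y :+ z) :- (r :+ s) :* x) ≈-refl y z r s x) (+-closed h k)
        ; *-closed = λ a {y} (r , h) → a * r , resp
            (solve 4 (λ a y r x → a :* (y :- r :* x) := a :* y :- (a :* r) :* x) ≈-refl a y r x) (*-closed a h)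
        }

  module _ {J : Pred Carrier 0ℓ} (isJ : IsIdeal J) (1∉J : 1# ∉ J) {c : ℕ} (c∈ : ℕφ (suc c) ∈ J) (xs : List Carrier)
    (represented : ∀ x → Σ[ x′ ∈ Carrier ] x′ ∈ˡ xs × (Σ[ w ∈ Carrier ] x - x′ ≈ ℕφ (suc c) * w))
    (dichotomy : ∀ {x} → x ∈ˡ xs → x ∈ J ⊎ (Σ[ r ∈ Carrier ] 1# - r * x ∈ J)) where
    open Ideal isJ

    comaximal : ∀ {x} → x ∉ J → Σ[ r ∈ Carrier ] 1# - r * x ∈ J
    comaximal {x} x∉ =
      let x′ , i , w , x-x′≈ = represented x
          difference∈ = resp (≈-sym x-x′≈) (*-closedʳ w c∈)
      in [ (λ x′∈ → contradiction (≡-∈ difference∈ x′∈) x∉)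
         , (λ (r , h) → r , resp (solve 4 (λ o r x x′ → (o :- r :* x′) :- r :* (x :- x′) := o :- r :* x) ≈-refl 1# r x x′)
                              (sub-closed h (*-closed r difference∈))) ]′ (dichotomy i)

    comaximal⇒prime : IsPrimeIdeal J
    comaximal⇒prime = record { isIdeal = isJ ; proper = 1∉J ; prime = prime }
      where
      prime : ∀ {x y} → x * y ∈ J → x ∈ J ⊎ y ∈ J
      prime {x} {y} xy∈ with decide em (x ∈ J)
      ... | yes x∈ = inj₁ x∈
      ... | no  x∉ = let r , h = comaximal x∉ in inj₂ (resp
        (≈-trans (solve 4 (λ o r x y → (o :- r :* x) :* y :+ r :* (x :* y) := o :* y) ≈-refl 1# r x y) (*-identityˡ y))
        (+-closed (*-closedʳ y h) (*-closed r xy∈)))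

  maximal-ideal : ∀ ω → ¬ ω ≈ 0# → (∀ y → ¬ ω * y ≈ 1#) →
    Σ[ 𝔮 ∈ Pred Carrier 0ℓ ] IsPrimeIdeal 𝔮 × ω ∈ 𝔮 × (∀ {x} → x ∉ 𝔮 → Σ[ r ∈ Carrier ] 1# - r * x ∈ 𝔮)
  maximal-ideal ω ω≉0 nonunit =
    let e , c , ωe≈c = cofactor ω≉0
        xs , represented = representatives c
        J , isJ , ⊆J , 1∉J , dichotomy = enlarge isMultiples (λ (y , h) → nonunit y (≈-sym h)) xs
        ω∈ = ⊆J (1# , ≈-sym (*-identityʳ ω))
        c∈ = Ideal.resp isJ ωe≈c (Ideal.*-closedʳ isJ e ω∈)
    in J , comaximal⇒prime isJ 1∉J c∈ xs represented dichotomy , ω∈ , comaximal isJ 1∉J c∈ xs represented dichotomy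
    where
    multiples : Pred Carrier 0ℓ
    multiples x = Σ[ y ∈ Carrier ] x ≈ ω * y
    isMultiples : IsIdeal multiples
    isMultiples = record
      { resp     = λ x≈y (u , h) → u , ≈-trans (≈-sym x≈y) h
      ; 0∈       = 0# , ≈-sym (zeroʳ ω)
      ; +-closed = λ (u , h) (v , k) → u + v , ≈-trans (+-cong h k) (≈-sym (distribˡ ω u v))
      ; *-closed = λ r (u , h) → r * u , ≈-trans (*-congˡ h) (solve 3 (λ r o u → r :* (o :* u) := o :* (r :* u)) ≈-refl r ω u)
      }

module LinearPrimes (em : ExcludedMiddle (lsuc 0ℓ)) (N : NumberRing) (L : Coordinates N) where
  open Arithmetic em N
  open Coordinates L
  open Geometry em N L
  open MaximalIdeals em N L
  open Separable em N

  -- An inverse of 1 + h s has size O(1/s), so it does not exist for large s.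
  nonunit : ∀ {h} → ¬ h ≈ 0# → Σ[ s₀ ∈ ℕ ] (∀ s → s₀ ℕ.< s → ¬ 1# + h * ℕφ s ≈ 0# × (∀ v → ¬ (1# + h * ℕφ s) * v ≈ 1#))
  nonunit {h} h≉0 = suc C ℕ.* size e , λ s s₀<s → nonzero s s₀<s , no-inverse s s₀<s
    where
    e = proj₁ (cofactor h≉0)
    c = proj₁ (proj₂ (cofactor h≉0))
    he≈c : h * e ≈ ℕφ (suc c)
    he≈c = proj₂ (proj₂ (cofactor h≉0))

    identity : ∀ s v → φ (+ s ℤ.* + suc c) * v ≈ e * ((1# + h * ℕφ s) * v) + φ -1ℤ * (e * v)
    identity s v = begin
      φ (+ s ℤ.* + suc c) * v ≈⟨ *-congʳ (≈-trans (φ-* (+ s) (+ suc c)) (*-congˡ (≈-sym he≈c))) ⟩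
      (ℕφ s * (h * e)) * v ≈⟨ solve 4 (λ s h e v → (s :* (h :* e)) :* v := e :* ((con 1ℤ :+ h :* s) :* v) :+ con -1ℤ :* (e :* v)) ≈-refl (ℕφ s) h e v ⟩
      e * ((φ 1ℤ + h * ℕφ s) * v) + φ -1ℤ * (e * v) ≈⟨ +-congʳ (*-congˡ (*-congʳ (+-congʳ φ-1))) ⟩
      e * ((1# + h * ℕφ s) * v) + φ -1ℤ * (e * v) ∎

    s≤ : ∀ s v → s ℕ.* size v ℕ.≤ size (e * ((1# + h * ℕφ s) * v)) ℕ.+ C ℕ.* (size e ℕ.* size v)
    s≤ s v = ℕ.≤-trans (ℕ.*-monoˡ-≤ (size v) (ℕ.≤-trans (ℕ.m≤m*n s (suc c)) (ℕ.≤-reflexive (≡.sym (ℤ.abs-* (+ s) (+ suc c))))))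
      (ℕ.≤-trans (ℕ.≤-reflexive (≡.trans (≡.sym (size-φ* (+ s ℤ.* + suc c) v)) (size-cong (identity s v))))
      (ℕ.≤-trans (size-+ _ (φ -1ℤ * (e * v)))
        (ℕ.+-monoʳ-≤ _ (ℕ.≤-trans (ℕ.≤-reflexive (≡.trans (size-φ* -1ℤ (e * v)) (ℕ.*-identityˡ _))) (κ-* e v)))))

    absurd : ∀ s v → suc C ℕ.* size e ℕ.< s → size (e * ((1# + h * ℕφ s) * v)) ℕ.≤ size e → size v ≡ 0
    absurd s v s₀<s small = [ (λ z → z) , (λ { (k , size≡) → contradiction (bound k size≡) (ℕ.<⇒≱ s₀<s) }) ]′ (zero-or-suc (size v))
      where
      zero-or-suc : ∀ k → k ≡ 0 ⊎ (Σ[ j ∈ ℕ ] k ≡ suc j)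
      zero-or-suc zero    = inj₁ refl
      zero-or-suc (suc j) = inj₂ (j , refl)
      factor : ∀ c e k → e ℕ.* k ℕ.+ c ℕ.* (e ℕ.* k) ≡ suc c ℕ.* e ℕ.* k
      factor = ℕ-ring
      bound : ∀ k → size v ≡ suc k → s ℕ.≤ suc C ℕ.* size e
      bound k size≡ = ℕ.*-cancelʳ-≤ s (suc C ℕ.* size e) (suc k) (subst (λ m → s ℕ.* m ℕ.≤ suc C ℕ.* size e ℕ.* m) size≡
        (ℕ.≤-trans (s≤ s v) (ℕ.≤-trans (ℕ.+-monoˡ-≤ (C ℕ.* (size e ℕ.* size v))
          (ℕ.≤-trans small (ℕ.m≤m*n (size e) (size v) {{ℕ.≢-nonZero λ z → contradiction (≡.trans (≡.sym size≡) z) λ ()}})))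
          (ℕ.≤-reflexive (factor C (size e) (size v))))))

    no-inverse : ∀ s → suc C ℕ.* size e ℕ.< s → ∀ v → ¬ (1# + h * ℕφ s) * v ≈ 1#
    no-inverse s s₀<s v inverse = 1≉0 (≈-trans (≈-sym inverse) (≈-trans (*-congˡ (size≡0⇒≈0 (absurd s v s₀<s
      (ℕ.≤-reflexive (size-cong (≈-trans (*-congˡ inverse) (*-identityʳ e))))))) (zeroʳ _)))

    nonzero : ∀ s → suc C ℕ.* size e ℕ.< s → ¬ 1# + h * ℕφ s ≈ 0#
    nonzero s s₀<s vanishes = 1≉0 (size≡0⇒≈0 (absurd s 1# s₀<s (ℕ.≤-trans
      (ℕ.≤-reflexive (size-cong (≈-trans (*-congˡ (≈-trans (*-congʳ vanishes) (zeroˡ 1#))) (zeroʳ e))))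
      (ℕ.≤-trans (ℕ.≤-reflexive (≡.trans (norm-cong κ-0) (norm-0 n))) z≤n))))

  ^-antitone : ∀ {I} → IsIdeal I → ∀ j → ∀ {x} → x ∈ I ^ᴵ suc j → x ∈ I ^ᴵ j
  ^-antitone {I} isI j = go
    where
    isJ = ^ᴵ-isIdeal isI j
    go : ∀ {x} → x ∈ I · (I ^ᴵ j) → x ∈ I ^ᴵ j
    go (nil h)              = IsIdeal.resp isJ (≈-sym h) (IsIdeal.0∈ isJ)
    go (cons {a} _ b∈ x h)  = IsIdeal.resp isJ (≈-sym h) (IsIdeal.+-closed isJ (IsIdeal.*-closed isJ a b∈) (go x))

  cancel-unit : ∀ {I} → IsIdeal I → ∀ {a b r} → 1# - r * b ∈ I → ∀ j → a * b ∈ I ^ᴵ j → a ∈ I ^ᴵ j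
  cancel-unit isI         unit zero    _   = _
  cancel-unit isI {a} {b} {r} unit (suc j) ab∈ = IsIdeal.resp isJ
    (≈-trans (solve 4 (λ o r a b → (o :- r :* b) :* a :+ r :* (a :* b) := o :* a) ≈-refl 1# r a b) (*-identityˡ a))
    (IsIdeal.+-closed isJ (·-∈ unit (cancel-unit isI {r = r} unit j (^-antitone isI j ab∈)) ≈-refl) (IsIdeal.*-closed isJ r ab∈))
    where isJ = ^ᴵ-isIdeal isI (suc j)

  record LinearPrime (η : Carrier) (l B : ℕ) : Set₁ where
    field
      p        : ℕ
      is-prime : Prime p
      B<p      : B ℕ.< p
      r        : ℤ
      𝔮        : Pred Carrier 0ℓ
      is𝔮      : IsPrimeIdeal 𝔮
      p∈       : ℕφ p ∈ 𝔮
      η≡r      : η - φ r ∈ 𝔮 ^ᴵ l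

  module _ {𝔮 : Pred Carrier 0ℓ} (is𝔮 : IsPrimeIdeal 𝔮) {p} (P : Prime p) (p∈ : ℕφ p ∈ 𝔮)
    {m} (g : Vec ℤ m) {η} (root : ⟦ g ⟧ η ≈ 0#) (simple : diff g η η ∉ 𝔮) where
    open PrimeIdeal is𝔮

    hensel : ∀ r → η - φ r ∈ 𝔮 → ∀ l → Σ[ r ∈ ℤ ] η - φ r ∈ 𝔮 × (Σ[ k ∈ ℤ ] eval g r ≡ + (p ℕ.^ suc l) ℤ.* k)
    hensel r η≡r zero with ∣ᵤ⇒∣ {+ p} {eval g r} (∈⇒∣ {z = eval g r} P p∈ (resp (⟦⟧-φ g r)
        (≡-∈′ (⟦⟧-≡ g η≡r) (resp (≈-sym root) 0∈))))
    ... | divides k e = r , η≡r , k , ≡.trans e (≡.trans (ℤ.*-comm k (+ p)) (cong (λ q → + q ℤ.* k) (≡.sym (ℕ.*-identityʳ p))))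
    hensel r η≡r (suc l) =
      let r , η≡r , k , e = hensel r η≡r l
          q = p ℕ.^ suc l
          p∤D : ¬ p ∣ ℤ.∣ diffℤ g r r ∣
          p∤D = λ d → simple (≡-∈ (diff-≡ isIdeal g η≡r η≡r) (resp (≈-sym (diff-φ g r r)) (∣⇒∈ {z = diffℤ g r r} p∈ d)))
          t , k′ , e′ = hensel-step g {l = l} P r k e p∤D
      in r ℤ.+ + q ℤ.* t ,
         resp (begin
           (η - φ r) - ℕφ q * φ t ≈⟨ solve 4 (λ y r q t → (y :- r) :- q :* t := y :- (r :+ q :* t)) ≈-refl η (φ r) (ℕφ q) (φ t) ⟩
           η - (φ r + ℕφ q * φ t) ≈⟨ +-congˡ (-‿cong (≈-trans (+-congˡ (≈-sym (φ-* (+ q) t))) (≈-sym (φ-+ r (+ q ℤ.* t))))) ⟩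
           η - φ (r ℤ.+ + q ℤ.* t) ∎)
           (sub-closed η≡r (*-closedʳ (φ t) (∣⇒∈ {z = + q} p∈ (∣.m∣m*n (p ℕ.^ l))))) ,
         k′ , e′

    linear-mod-power : (∀ {x} → x ∉ 𝔮 → Σ[ r ∈ Carrier ] 1# - r * x ∈ 𝔮) → ∀ r → η - φ r ∈ 𝔮 → ∀ l → Σ[ r ∈ ℤ ] η - φ r ∈ 𝔮 ^ᴵ suc l
    linear-mod-power comaximal r₀ η≡r₀ l =
      let r , η≡r , k , e = hensel r₀ η≡r₀ l
          isPower = ^ᴵ-isIdeal isIdeal (suc l)
          diff∉ : diff g η (φ r) ∉ 𝔮
          diff∉ = λ h → simple (≡-∈ (diff-≡ isIdeal g (resp (≈-sym (-‿inverseʳ η)) 0∈) η≡r) h)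
          s , unit = comaximal diff∉
      in r , cancel-unit isIdeal {r = s} unit (suc l) (IsIdeal.resp isPower (begin
           - (ℕφ (p ℕ.^ suc l) * φ k) ≈⟨ -‿cong (≈-trans (≈-sym (φ-* (+ (p ℕ.^ suc l)) k)) (φ-cong (≡.sym e))) ⟩
           - φ (eval g r) ≈⟨ ≈-sym (+-identityˡ _) ⟩
           0# - φ (eval g r) ≈⟨ +-cong (≈-sym root) (-‿cong (≈-sym (⟦⟧-φ g r))) ⟩
           ⟦ g ⟧ η - ⟦ g ⟧ (φ r) ≈⟨ ⟦⟧-diff g η (φ r) ⟩
           (η - φ r) * diff g η (φ r) ∎)
           (Ideal.neg-closed isPower (Ideal.*-closedʳ isPower (φ k) (ℕφ^∈ p p∈ (suc l)))))

  -- η h = c₀ turns η − r into η (1 + h t) for r = − c₀ t, and a prime factor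
  -- of 1 + h t avoids all primes dividing t.
  linear-prime-of-factor : ∀ {η h c₀} → η * h ≈ ℕφ (suc c₀) →
    ∀ {m} (g : Vec ℤ m) → ⟦ g ⟧ η ≈ 0# → ∀ {e c} → diff g η η * e ≈ ℕφ (suc c) →
    ∀ B t → (B ℕ.+ suc c) ! ∣ t → ¬ 1# + h * ℕφ t ≈ 0# →
    ∀ {𝔮} → IsPrimeIdeal 𝔮 → 1# + h * ℕφ t ∈ 𝔮 → (∀ {x} → x ∉ 𝔮 → Σ[ r ∈ Carrier ] 1# - r * x ∈ 𝔮) →
    ∀ l → LinearPrime η (suc l) B
  linear-prime-of-factor {η} {h} {c₀} ηh≈c₀ g root {e} {c} δe≈c B t T∣t ω≉0 {𝔮} is𝔮 ω∈ comaximal l =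
    let p , P , p∈ = rational-prime (1# + h * ℕφ t , ω∈ , ω≉0)
        p∤T : ¬ p ∣ (B ℕ.+ suc c) !
        p∤T = λ d → proper (resp (solve 2 (λ o x → (o :+ x) :- x := o) ≈-refl 1# (h * ℕφ t))
                (sub-closed ω∈ (*-closed h (∣⇒∈ {z = + t} p∈ (∣.∣-trans d T∣t)))))
        large-p : B ℕ.+ suc c ℕ.< p
        large-p = ℕ.≰⇒> λ p≤ → p∤T (factorial-divisible P p≤)
        p∤c : ¬ p ∣ suc c
        p∤c = λ d → ℕ.<⇒≱ large-p (ℕ.≤-trans (∣.∣⇒≤ d) (ℕ.m≤n+m (suc c) B))
        simple∉ : diff g η η ∉ 𝔮
        simple∉ = λ δ∈ → ∤⇒∉ {z = + suc c} P p∈ p∤c (resp δe≈c (*-closedʳ e δ∈))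
        r , η≡r = linear-mod-power is𝔮 P p∈ g root simple∉ comaximal r₀ η≡r₀ l
    in record { p = p ; is-prime = P ; B<p = ℕ.≤-<-trans (ℕ.m≤m+n B (suc c)) large-p ; r = r ; 𝔮 = 𝔮 ; is𝔮 = is𝔮 ; p∈ = p∈ ; η≡r = η≡r }
    where
    open PrimeIdeal is𝔮
    factorial-divisible : ∀ {p n} → Prime p → p ℕ.≤ n → p ∣ n !
    factorial-divisible {zero}  P _  = contradiction P ¬prime[0]
    factorial-divisible {suc p} P p≤ = m≤n⇒m∣n! p≤
    r₀ = ℤ.- (+ suc c₀ ℤ.* + t)
    η≡r₀ : η - φ r₀ ∈ 𝔮
    η≡r₀ = resp (begin
      η * (1# + h * ℕφ t) ≈⟨ solve 4 (λ y o h t → y :* (o :+ h :* t) := y :* o :- :- ((y :* h) :* t)) ≈-refl η 1# h (ℕφ t) ⟩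
      η * 1# - - ((η * h) * ℕφ t) ≈⟨ +-cong (*-identityʳ η) (-‿cong (-‿cong (≈-trans (*-congʳ ηh≈c₀) (≈-sym (φ-* (+ suc c₀) (+ t)))))) ⟩
      η - - φ (+ suc c₀ ℤ.* + t) ≈⟨ +-congˡ (-‿cong (≈-sym (φ-neg (+ suc c₀ ℤ.* + t)))) ⟩
      η - φ r₀ ∎) (*-closed η ω∈)

  linear-prime-nonzero : ∀ {η} → ¬ η ≈ 0# → ∀ l B → LinearPrime η (suc l) B
  linear-prime-nonzero {η} η≉0 l B =
    let h , c₀ , ηh≈c₀ = cofactor η≉0
        f , f≢0 , f-root = annihilating-polynomial η
        m , g , root , simple = simple-root f η f≢0 f-root
        e , c , δe≈c = cofactor simple
        s₀ , large = nonunit {h} λ h≈0 → φ≉0 {+ suc c₀} (λ ()) (≈-trans (≈-sym ηh≈c₀) (≈-trans (*-congˡ h≈0) (zeroʳ η)))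
        t = suc s₀ ℕ.* (B ℕ.+ suc c) !
        ω≉0 , nonunit-ω = large t (ℕ.m≤m*n (suc s₀) ((B ℕ.+ suc c) !) {{ℕ._!≢0 (B ℕ.+ suc c)}})
        𝔮 , is𝔮 , ω∈ , comaximal = maximal-ideal (1# + h * ℕφ t) ω≉0 nonunit-ω
    in linear-prime-of-factor ηh≈c₀ g root {e} {c} δe≈c B t (∣.n∣m*n (suc s₀)) ω≉0 is𝔮 ω∈ comaximal l

  linear-prime : ∀ η l B → LinearPrime η (suc l) B
  linear-prime η l B with decide em (η ≈ 0#)
  ... | no  η≉0 = linear-prime-nonzero η≉0 l B
  ... | yes η≈0 = record
    { LinearPrime prime₁
    ; r = 0ℤ
    ; η≡r = IsIdeal.resp isPower (≈-trans (≈-sym (-‿inverseʳ 0#)) (+-cong (≈-sym η≈0) (-‿cong (≈-sym φ-0)))) (IsIdeal.0∈ isPower)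
    }
    where
    prime₁ = linear-prime-nonzero 1≉0 l B
    isPower = ^ᴵ-isIdeal (IsPrimeIdeal.isIdeal (LinearPrime.is𝔮 prime₁)) (suc l)

module Roots (em : ExcludedMiddle (lsuc 0ℓ)) (N : NumberRing) where
  open Arithmetic em N

  ev : ∀ {n} → Vec Carrier n → Carrier → Carrier
  ev []      x = 0#
  ev (a ∷ p) x = a + x * ev p x

  ev-map-φ : ∀ {n} (p : Vec ℤ n) x → ev (Vec.map φ p) x ≈ ⟦ p ⟧ x
  ev-map-φ []      x = ≈-refl
  ev-map-φ (a ∷ p) x = +-congˡ (*-congˡ (ev-map-φ p x))

  ev-zeros : ∀ {n} (p : Vec Carrier n) x → (∀ i → Vec.lookup p i ≈ 0#) → ev p x ≈ 0#
  ev-zeros []      x h = ≈-refl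
  ev-zeros (a ∷ p) x h = ≈-trans (+-cong (h zero) (≈-trans (*-congˡ (ev-zeros p x (h ∘ suc))) (zeroʳ x))) (+-identityˡ 0#)

  quot : ∀ {n} → Carrier → Vec Carrier (suc n) → Vec Carrier n
  quot ρ (a ∷ [])        = []
  quot ρ (a ∷ p@(_ ∷ _)) = ev p ρ ∷ quot ρ p

  ev-quot : ∀ {n} ρ (p : Vec Carrier (suc n)) x → ev p x - ev p ρ ≈ (x - ρ) * ev (quot ρ p) x
  ev-quot ρ (a ∷ [])        x = ≈-trans (+-cong (+-congˡ (zeroʳ x)) (-‿cong (+-congˡ (zeroʳ ρ))))
    (≈-trans (-‿inverseʳ _) (≈-sym (zeroʳ _)))
  ev-quot ρ (a ∷ p@(_ ∷ _)) x = begin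
    (a + x * ev p x) - (a + ρ * ev p ρ)
      ≈⟨ solve 5 (λ a x ρ u v → (a :+ x :* u) :- (a :+ ρ :* v) := (x :- ρ) :* v :+ x :* (u :- v)) ≈-refl a x ρ (ev p x) (ev p ρ) ⟩
    (x - ρ) * ev p ρ + x * (ev p x - ev p ρ)
      ≈⟨ +-congˡ (*-congˡ (ev-quot ρ p x)) ⟩
    (x - ρ) * ev p ρ + x * ((x - ρ) * ev (quot ρ p) x)
      ≈⟨ solve 4 (λ t v x q → t :* v :+ x :* (t :* q) := t :* (v :+ x :* q)) ≈-refl (x - ρ) (ev p ρ) x (ev (quot ρ p) x) ⟩
    (x - ρ) * (ev p ρ + x * ev (quot ρ p) x) ∎

  quot-zeros : ∀ {n} ρ (p : Vec Carrier (suc n)) → (∀ i → Vec.lookup (quot ρ p) i ≈ 0#) → ∀ i → Vec.lookup p (suc i) ≈ 0#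
  quot-zeros ρ (a ∷ b ∷ p) h (suc i) = quot-zeros ρ (b ∷ p) (h ∘ suc) i
  quot-zeros ρ (a ∷ b ∷ p) h zero    = begin
    b ≈⟨ ≈-sym (≈-trans (+-congˡ (≈-trans (*-congˡ (ev-zeros p ρ (quot-zeros ρ (b ∷ p) (h ∘ suc)))) (zeroʳ ρ))) (+-identityʳ b)) ⟩
    b + ρ * ev p ρ ≈⟨ h zero ⟩
    0# ∎

  too-many-roots : ∀ {n} (p : Vec Carrier n) (ρ : Fin n → Carrier) → (∀ i → ev p (ρ i) ≈ 0#) →
                   (∀ i j → i ≢ j → ¬ ρ i ≈ ρ j) → ∀ i → Vec.lookup p i ≈ 0#
  too-many-roots (a ∷ p) ρ root distinct = coefficient
    where
    quot-root : ∀ i → ev (quot (ρ zero) (a ∷ p)) (ρ (suc i)) ≈ 0#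
    quot-root i = no-zero-divisor (λ h → distinct (suc i) zero (λ ()) (x-y≈0⇒x≈y _ _ h)) (begin
      (ρ (suc i) - ρ zero) * ev (quot (ρ zero) (a ∷ p)) (ρ (suc i)) ≈⟨ ≈-sym (ev-quot (ρ zero) (a ∷ p) (ρ (suc i))) ⟩
      ev (a ∷ p) (ρ (suc i)) - ev (a ∷ p) (ρ zero) ≈⟨ +-cong (root (suc i)) (-‿cong (root zero)) ⟩
      0# - 0# ≈⟨ -‿inverseʳ 0# ⟩
      0# ∎)
    tail-zeros : ∀ i → Vec.lookup p i ≈ 0#
    tail-zeros = quot-zeros (ρ zero) (a ∷ p)
      (too-many-roots (quot (ρ zero) (a ∷ p)) (ρ ∘ suc) quot-root (λ i j i≢j → distinct (suc i) (suc j) (i≢j ∘ Fin.suc-injective)))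
    coefficient : ∀ i → Vec.lookup (a ∷ p) i ≈ 0#
    coefficient (suc i) = tail-zeros i
    coefficient zero    = ≈-trans (≈-sym (≈-trans (+-congˡ (≈-trans (*-congˡ (ev-zeros p (ρ zero) tail-zeros)) (zeroʳ _))) (+-identityʳ a))) (root zero)

  repeated-root : ∀ {n} (p : Vec ℤ n) → (∃[ i ] Vec.lookup p i ≢ 0ℤ) → (ρ : Fin n → Carrier) → (∀ i → ⟦ p ⟧ (ρ i) ≈ 0#) →
                  Σ[ i ∈ Fin n ] Σ[ j ∈ Fin n ] i ≢ j × ρ i ≈ ρ j
  repeated-root p (i , pᵢ≢0) ρ root = decidable-stable (decide em _) λ none →
    φ≉0 pᵢ≢0 (≈-trans (reflexive (≡.sym (lookup-map i φ p)))
      (too-many-roots (Vec.map φ p) ρ (λ j → ≈-trans (ev-map-φ p (ρ j)) (root j)) (λ i j i≢j e → none (i , j , i≢j , e)) i))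

module Preserver (em : ExcludedMiddle (lsuc 0ℓ)) (N₁ N₂ : NumberRing) (L₁ : Coordinates N₁) (L₂ : Coordinates N₂) where
  private
    module K where
      open Arithmetic em N₁ public
      open PowerFree em N₁ L₁ public using (power-free-in-class)
    module L where
      open Arithmetic em N₂ public
      open LinearPrimes em N₂ L₂ public
      open Roots em N₂ public

  PowerFree₁ : ℕ → Pred K.Carrier (lsuc 0ℓ)
  PowerFree₁ k x = ∀ 𝔭 → K.IsPrimeIdeal 𝔭 → K.NonzeroIdeal 𝔭 → x ∉ 𝔭 K.^ᴵ k

  PowerFree₂ : ℕ → Pred L.Carrier (lsuc 0ℓ)
  PowerFree₂ l y = ∀ 𝔮 → L.IsPrimeIdeal 𝔮 → L.NonzeroIdeal 𝔮 → y ∉ 𝔮 L.^ᴵ l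

  LocallyPowerFree₁ : ℕ → ℕ → Pred K.Carrier (lsuc 0ℓ)
  LocallyPowerFree₁ k p x = ∀ 𝔭 → K.IsPrimeIdeal 𝔭 → K.NonzeroIdeal 𝔭 → K.ℕφ p ∈ 𝔭 → x ∉ 𝔭 K.^ᴵ k

  LocallyPowerFree₂ : ℕ → ℕ → Pred L.Carrier (lsuc 0ℓ)
  LocallyPowerFree₂ l p y = ∀ 𝔮 → L.IsPrimeIdeal 𝔮 → L.NonzeroIdeal 𝔮 → L.ℕφ p ∈ 𝔮 → y ∉ 𝔮 L.^ᴵ l

  local⇒global : ∀ {k l} (A : K.Carrier → L.Carrier) →
    (∀ p → Prime p → ∀ x → x ∈ LocallyPowerFree₁ k p → A x ∈ LocallyPowerFree₂ l p) →
    ∀ x → x ∈ PowerFree₁ k → A x ∈ PowerFree₂ l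
  local⇒global A local x free 𝔮 is𝔮 nonzero =
    let q , Q , q∈ = L.PrimeIdeal.rational-prime is𝔮 nonzero
    in local q Q x (λ 𝔭 is𝔭 nonzero _ → free 𝔭 is𝔭 nonzero) 𝔮 is𝔮 nonzero q∈

  module _ (A : K.Carrier → L.Carrier)
    (A-cong : ∀ {x y} → x K.≈ y → A x L.≈ A y)
    (A-+ : ∀ x y → A (x K.+ y) L.≈ A x L.+ A y)
    (A-multiple : ∀ z {x y} → y K.≈ K.φ z K.* x → A y L.≈ L.φ z L.* A x)
    where

    global⇒local : ∀ {k l} → 2 ℕ.≤ k → (∀ x → x ∈ PowerFree₁ k → A x ∈ PowerFree₂ l) →
      ∀ p → Prime p → ∀ x → x ∈ LocallyPowerFree₁ k p → A x ∈ LocallyPowerFree₂ l p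
    global⇒local {k} {l} 2≤k global p P x free 𝔮 is𝔮 nonzero p∈ Ax∈ =
      let w , free′ = K.power-free-in-class P 2≤k (ℕ.m≤m+n k l) x free
      in global (x K.+ K.ℕφ (p ℕ.^ (k ℕ.+ l)) K.* w) free′ 𝔮 is𝔮 nonzero (L.IsIdeal.resp isPower (L.≈-sym (expand w))
           (L.IsIdeal.+-closed isPower Ax∈ (L.Ideal.*-closedʳ isPower (A (K.ℕφ (p ℕ.^ k) K.* w)) (L.ℕφ^∈ p p∈ l))))
      where
      isPower = L.^ᴵ-isIdeal (L.IsPrimeIdeal.isIdeal is𝔮) l
      expand : ∀ w → A (x K.+ K.ℕφ (p ℕ.^ (k ℕ.+ l)) K.* w) L.≈ A x L.+ L.ℕφ (p ℕ.^ l) L.* A (K.ℕφ (p ℕ.^ k) K.* w)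
      expand w = L.≈-trans (A-+ x _) (L.+-congˡ (L.≈-trans (A-cong (K.≈-trans
        (K.*-congʳ (K.≈-trans (K.φ-cong (cong +_ (≡.trans (ℕ.^-distribˡ-+-* p k l) (ℕ.*-comm (p ℕ.^ k) (p ℕ.^ l))))) (K.ℕφ-* (p ℕ.^ l) (p ℕ.^ k))))
        (K.*-assoc _ _ w))) (A-multiple (+ (p ℕ.^ l)) K.≈-refl)))

    module _ (k l : ℕ) (1≤k : 1 ℕ.≤ k)
      (local : ∀ p → Prime p → ∀ x → x ∈ LocallyPowerFree₁ k p → A x ∈ LocallyPowerFree₂ (suc l) p) where

      A-φ : ∀ z x → A (K.φ z K.* x) L.≈ L.φ z L.* A x
      A-φ z x = A-multiple z K.≈-refl

      A-sub : ∀ x y → A (x K.- y) L.≈ A x L.- A y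
      A-sub x y = begin
        A (x K.- y) ≈⟨ A-cong (K.solve 2 (λ x y → x K.:- y K.:= x K.:+ K.con -1ℤ K.:* y) K.≈-refl x y) ⟩
        A (x K.+ K.φ -1ℤ K.* y) ≈⟨ L.≈-trans (A-+ x _) (L.+-congˡ (A-φ -1ℤ y)) ⟩
        A x L.+ L.φ -1ℤ L.* A y ≈⟨ L.solve 2 (λ x y → x L.:+ L.con -1ℤ L.:* y L.:= x L.:- y) L.≈-refl (A x) (A y) ⟩
        A x L.- A y ∎
        where open import Relation.Binary.Reasoning.Setoid L.setoid

      A-0 : A K.0# L.≈ L.0#
      A-0 = L.≈-trans (A-cong (K.≈-sym (K.-‿inverseʳ K.0#))) (L.≈-trans (A-sub K.0# K.0#) (L.-‿inverseʳ _))

      preimage-prime : ∀ {p 𝔮} → Prime p → L.IsPrimeIdeal 𝔮 → L.ℕφ p ∈ 𝔮 → ∀ y → A y ∈ 𝔮 L.^ᴵ suc l →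
        Σ[ 𝔭 ∈ Pred K.Carrier 0ℓ ] K.IsPrimeIdeal 𝔭 × K.ℕφ p ∈ 𝔭 × y ∈ 𝔭
      preimage-prime {p} {𝔮} P is𝔮 p∈ y Ay∈ = decidable-stable em λ none →
        local p P y (λ 𝔭 is𝔭 _ p∈𝔭 y∈ → none (𝔭 , is𝔭 , p∈𝔭 , K.^⊆ (K.IsPrimeIdeal.isIdeal is𝔭) 1≤k y∈))
          𝔮 is𝔮 (L.prime-nonzero p P p∈) p∈ Ay∈

      A-injective : ∀ {y} → ¬ y K.≈ K.0# → ¬ A y L.≈ L.0#
      A-injective {y} y≉0 Ay≈0 =
        let e , c , ye≈c = K.cofactor y≉0
            open L.LinearPrime (L.linear-prime L.1# l (suc c))
            isPower = L.^ᴵ-isIdeal (L.IsPrimeIdeal.isIdeal is𝔮) (suc l)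
            𝔭 , is𝔭 , p∈𝔭 , y∈ = preimage-prime is-prime is𝔮 p∈ y (L.IsIdeal.resp isPower (L.≈-sym Ay≈0) (L.IsIdeal.0∈ isPower))
            open K.PrimeIdeal is𝔭
        in ∤⇒∉ {z = + suc c} is-prime p∈𝔭 (λ d → ℕ.<⇒≱ B<p (∣.∣⇒≤ d)) (resp ye≈c (*-closedʳ e y∈))

      root-transfer : ∀ {x y η m} (f : Vec ℤ m) → ¬ y K.≈ K.0# → A (x K.* y) L.≈ η L.* A y → K.⟦ f ⟧ x K.≈ K.0# → L.⟦ f ⟧ η L.≈ L.0#
      root-transfer {x} {y} {η} f y≉0 eigen root = decidable-stable (decide em _) λ δ≉0 →
        let e , c , ye≈c = K.cofactor y≉0
            e′ , c′ , δe≈c = L.cofactor δ≉0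
            open L.LinearPrime (L.linear-prime η l (suc c ℕ.+ suc c′))
            isPower = L.^ᴵ-isIdeal (L.IsPrimeIdeal.isIdeal is𝔮) (suc l)
            module 𝔮 = L.PrimeIdeal is𝔮
            𝔭 , is𝔭 , p∈𝔭 , xy∈ = preimage-prime is-prime is𝔮 p∈ ((x K.- K.φ r) K.* y)
              (L.IsIdeal.resp isPower (L.≈-sym (translated r)) (L.Ideal.*-closedʳ isPower (A y) η≡r))
            module 𝔭 = K.PrimeIdeal is𝔭
            y∉ : y ∉ 𝔭
            y∉ = λ y∈ → 𝔭.∤⇒∉ {z = + suc c} is-prime p∈𝔭 (λ d → ℕ.<⇒≱ B<p (ℕ.≤-trans (∣.∣⇒≤ d) (ℕ.m≤m+n (suc c) (suc c′))))
                    (𝔭.resp ye≈c (𝔭.*-closedʳ e y∈))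
            x≡r : x K.- K.φ r ∈ 𝔭
            x≡r = [ (λ h → h) , (λ y∈ → contradiction y∈ y∉) ]′ (𝔭.prime xy∈)
            p∣f : p ∣ ℤ.∣ eval f r ∣
            p∣f = 𝔭.∈⇒∣ {z = eval f r} is-prime p∈𝔭 (𝔭.resp (K.⟦⟧-φ f r)
                    (𝔭.≡-∈′ (𝔭.⟦⟧-≡ f x≡r) (𝔭.resp (K.≈-sym root) 𝔭.0∈)))
            δ∈ : L.⟦ f ⟧ η ∈ 𝔮
            δ∈ = 𝔮.≡-∈ (𝔮.⟦⟧-≡ f (L.^⊆ 𝔮.isIdeal {suc l} (s≤s z≤n) η≡r)) (𝔮.resp (L.≈-sym (L.⟦⟧-φ f r)) (𝔮.∣⇒∈ {z = eval f r} p∈ p∣f))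
        in 𝔮.∤⇒∉ {z = + suc c′} is-prime p∈ (λ d → ℕ.<⇒≱ B<p (ℕ.≤-trans (∣.∣⇒≤ d) (ℕ.m≤n+m (suc c′) (suc c))))
             (𝔮.resp δe≈c (𝔮.*-closedʳ e′ δ∈))
        where
        translated : ∀ r → A ((x K.- K.φ r) K.* y) L.≈ (η L.- L.φ r) L.* A y
        translated r = begin
          A ((x K.- K.φ r) K.* y) ≈⟨ A-cong (K.solve 3 (λ x r y → (x K.:- r) K.:* y K.:= x K.:* y K.:- r K.:* y) K.≈-refl x (K.φ r) y) ⟩
          A (x K.* y K.- K.φ r K.* y) ≈⟨ A-sub _ _ ⟩
          A (x K.* y) L.- A (K.φ r K.* y) ≈⟨ L.+-cong eigen (L.-‿cong (A-φ r y)) ⟩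
          η L.* A y L.- L.φ r L.* A y ≈⟨ L.solve 3 (λ e r a → e L.:* a L.:- r L.:* a L.:= (e L.:- r) L.:* a) L.≈-refl η (L.φ r) (A y) ⟩
          (η L.- L.φ r) L.* A y ∎
          where open import Relation.Binary.Reasoning.Setoid L.setoid

      -- d · A(x y) / A(y) is an algebraic integer η; y° is a nonzero witness of
      -- this, so that η makes sense for y = 0 as well.
      Eigenvalue : K.Carrier → K.Carrier → ℕ → Set
      Eigenvalue x y d = Σ[ η ∈ L.Carrier ] (L.ℕφ d L.* A (x K.* y) L.≈ η L.* A y) ×
        (Σ[ y° ∈ K.Carrier ] ¬ y° K.≈ K.0# × L.ℕφ d L.* A (x K.* y°) L.≈ η L.* A y°)

      eigenvalue-∣ : ∀ x y {d e} → d ∣ e → Eigenvalue x y d → Eigenvalue x y e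
      eigenvalue-∣ x y {d} (∣.divides q refl) (η , h , y° , y°≉0 , h°) = L.ℕφ q L.* η , scale h , y° , y°≉0 , scale h°
        where
        scale : ∀ {u v} → L.ℕφ d L.* u L.≈ η L.* v → L.ℕφ (q ℕ.* d) L.* u L.≈ (L.ℕφ q L.* η) L.* v
        scale {u} h = L.≈-trans (L.*-congʳ (L.ℕφ-* q d)) (L.≈-trans (L.*-assoc _ _ _) (L.≈-trans (L.*-congˡ h) (L.≈-sym (L.*-assoc _ _ _))))

      eigenvalue : ∀ x y → Σ[ d ∈ ℕ ] Eigenvalue x y (suc d)
      eigenvalue x y with decide em (y K.≈ K.0#)
      ... | no y≉0 = let d , η , h = at-nonzero y y≉0 in d , η , h , y , y≉0 , h
        where
        at-nonzero : ∀ y → ¬ y K.≈ K.0# → Σ[ d ∈ ℕ ] Σ[ η ∈ L.Carrier ] L.ℕφ (suc d) L.* A (x K.* y) L.≈ η L.* A y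
        at-nonzero y y≉0 = let e , d , h = L.cofactor (A-injective y≉0) in d , A (x K.* y) L.* e ,
          L.≈-trans (L.*-congʳ (L.≈-sym h)) (L.solve 3 (λ a e b → (a L.:* e) L.:* b L.:= (b L.:* e) L.:* a) L.≈-refl (A y) e (A (x K.* y)))
      ... | yes y≈0 = let e , d , h = L.cofactor (A-injective K.1≉0) in d , A (x K.* K.1#) L.* e ,
          L.≈-trans (L.*-congˡ (L.≈-trans (A-cong (K.≈-trans (K.*-congˡ y≈0) (K.zeroʳ x))) A-0))
            (L.≈-trans (L.zeroʳ _) (L.≈-sym (L.≈-trans (L.*-congˡ (L.≈-trans (A-cong y≈0) A-0)) (L.zeroʳ _)))) ,
          K.1# , K.1≉0 ,
          L.≈-trans (L.*-congʳ (L.≈-sym h)) (L.solve 3 (λ a e b → (a L.:* e) L.:* b L.:= (b L.:* e) L.:* a) L.≈-refl (A K.1#) e (A (x K.* K.1#)))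

      -- A polynomial has finitely many roots, so two of the translates y + j
      -- share an eigenvalue, which is then an eigenvalue for 1 and y too.
      multiplicative : ∀ x y → A (x K.* y) L.* A K.1# L.≈ A x L.* A y
      multiplicative x y =
        let d , eigen = common-multiple (λ j → Eigenvalue x (node j)) (λ j → eigenvalue-∣ x (node j)) (λ j → eigenvalue x (node j))
            f , f≢0 , f-root = K.annihilating-polynomial (K.ℕφ (suc d) K.* x)
            η = λ j → proj₁ (eigen j)
            η-root : ∀ j → L.⟦ f ⟧ (η j) L.≈ L.0#
            η-root j = let _ , _ , y° , y°≉0 , h° = eigen j in root-transfer f y°≉0
              (L.≈-trans (A-cong (K.*-assoc _ _ _)) (L.≈-trans (A-φ (+ suc d) _) h°)) f-root
            i , j , i≢j , ηᵢ≈ηⱼ = L.repeated-root f f≢0 η η-root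
        in conclude (suc d) (λ ()) (η i) i j i≢j (proj₁ (proj₂ (eigen i)))
             (L.≈-trans (proj₁ (proj₂ (eigen j))) (L.*-congʳ (L.≈-sym ηᵢ≈ηⱼ)))
        where
        open import Relation.Binary.Reasoning.Setoid L.setoid
        node : Fin (suc K.rank) → K.Carrier
        node j = y K.+ K.ℕφ (Fin.toℕ j)

        A-shift : ∀ x a → A (x K.* (y K.+ K.ℕφ a)) L.≈ A (x K.* y) L.+ L.ℕφ a L.* A x
        A-shift x a = L.≈-trans (A-cong (K.solve 3 (λ x y a → x K.:* (y K.:+ a) K.:= x K.:* y K.:+ a K.:* x) K.≈-refl x y (K.ℕφ a)))
          (L.≈-trans (A-+ _ _) (L.+-congˡ (A-φ (+ a) x)))

        A-node : ∀ a → A (y K.+ K.ℕφ a) L.≈ A y L.+ L.ℕφ a L.* A K.1#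
        A-node a = L.≈-trans (A-cong (K.≈-sym (K.*-identityˡ _)))
          (L.≈-trans (A-shift K.1# a) (L.+-congʳ (A-cong (K.*-identityˡ y))))

        conclude : ∀ D → D ≢ 0 → ∀ η (i j : Fin (suc K.rank)) → i ≢ j →
          L.ℕφ D L.* A (x K.* node i) L.≈ η L.* A (node i) →
          L.ℕφ D L.* A (x K.* node j) L.≈ η L.* A (node j) → A (x K.* y) L.* A K.1# L.≈ A x L.* A y
        conclude D D≢0 η i j i≢j hᵢ hⱼ = L.*-cancelˡ (L.φ≉0 (D≢0 ∘ ℤ.+-injective)) (begin
          L.ℕφ D L.* (A (x K.* y) L.* A K.1#) ≈⟨ L.≈-sym (L.*-assoc _ _ _) ⟩
          (L.ℕφ D L.* A (x K.* y)) L.* A K.1# ≈⟨ L.*-congʳ at-y ⟩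
          (η L.* A y) L.* A K.1# ≈⟨ L.solve 3 (λ e y o → (e L.:* y) L.:* o L.:= (e L.:* o) L.:* y) L.≈-refl η (A y) (A K.1#) ⟩
          (η L.* A K.1#) L.* A y ≈⟨ L.*-congʳ (L.≈-sym at-1) ⟩
          (L.ℕφ D L.* A x) L.* A y ≈⟨ L.*-assoc _ _ _ ⟩
          L.ℕφ D L.* (A x L.* A y) ∎)
          where
          a = Fin.toℕ i
          b = Fin.toℕ j
          expanded : ∀ a → L.ℕφ D L.* A (x K.* (y K.+ K.ℕφ a)) L.≈ η L.* A (y K.+ K.ℕφ a) →
            L.ℕφ D L.* (A (x K.* y) L.+ L.ℕφ a L.* A x) L.≈ η L.* (A y L.+ L.ℕφ a L.* A K.1#)
          expanded a h = L.≈-trans (L.*-congˡ (L.≈-sym (A-shift x a))) (L.≈-trans h (L.*-congˡ (A-node a)))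
          a-b≉0 : ¬ L.ℕφ a L.- L.ℕφ b L.≈ L.0#
          a-b≉0 h = i≢j (Fin.toℕ-injective (ℤ.+-injective (ℤ.i-j≡0⇒i≡j (+ a) (+ b) (L.φ-injective
            (L.≈-trans (L.φ-+ (+ a) (ℤ.- + b)) (L.≈-trans (L.+-congˡ (L.φ-neg (+ b))) h))))))
          at-1 : L.ℕφ D L.* A x L.≈ η L.* A K.1#
          at-1 = L.*-cancelˡ a-b≉0 (begin
            (L.ℕφ a L.- L.ℕφ b) L.* (L.ℕφ D L.* A x)
              ≈⟨ L.solve 5 (λ a b d u x → (a L.:- b) L.:* (d L.:* x) L.:= d L.:* (u L.:+ a L.:* x) L.:- d L.:* (u L.:+ b L.:* x)) L.≈-refl
                   (L.ℕφ a) (L.ℕφ b) (L.ℕφ D) (A (x K.* y)) (A x) ⟩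
            L.ℕφ D L.* (A (x K.* y) L.+ L.ℕφ a L.* A x) L.- L.ℕφ D L.* (A (x K.* y) L.+ L.ℕφ b L.* A x)
              ≈⟨ L.+-cong (expanded a hᵢ) (L.-‿cong (expanded b hⱼ)) ⟩
            η L.* (A y L.+ L.ℕφ a L.* A K.1#) L.- η L.* (A y L.+ L.ℕφ b L.* A K.1#)
              ≈⟨ L.solve 5 (λ a b e y o → e L.:* (y L.:+ a L.:* o) L.:- e L.:* (y L.:+ b L.:* o) L.:= (a L.:- b) L.:* (e L.:* o)) L.≈-refl
                   (L.ℕφ a) (L.ℕφ b) η (A y) (A K.1#) ⟩
            (L.ℕφ a L.- L.ℕφ b) L.* (η L.* A K.1#) ∎)
          at-y : L.ℕφ D L.* A (x K.* y) L.≈ η L.* A y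
          at-y = begin
            L.ℕφ D L.* A (x K.* y)
              ≈⟨ L.solve 4 (λ d u a x → d L.:* u L.:= d L.:* (u L.:+ a L.:* x) L.:- a L.:* (d L.:* x)) L.≈-refl (L.ℕφ D) (A (x K.* y)) (L.ℕφ a) (A x) ⟩
            L.ℕφ D L.* (A (x K.* y) L.+ L.ℕφ a L.* A x) L.- L.ℕφ a L.* (L.ℕφ D L.* A x)
              ≈⟨ L.+-cong (expanded a hᵢ) (L.-‿cong (L.*-congˡ at-1)) ⟩
            η L.* (A y L.+ L.ℕφ a L.* A K.1#) L.- L.ℕφ a L.* (η L.* A K.1#)
              ≈⟨ L.solve 4 (λ e y a o → e L.:* (y L.:+ a L.:* o) L.:- a L.:* (e L.:* o) L.:= e L.:* y) L.≈-refl η (A y) (L.ℕφ a) (A K.1#) ⟩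
            η L.* A y ∎

module Field (em : ExcludedMiddle (lsuc 0ℓ)) (F : NumberField) where
  open NumberField F public
    hiding (zero) renaming (sym to ≈-sym; trans to ≈-trans)
  ≈-refl : ∀ {x} → x ≈ x
  ≈-refl = CommutativeRing.refl commutativeRing
  open Integrality commutativeRing fromInt fromInt-hom public using (⟦_⟧)
  open Algebra.Properties.CommutativeSemiring.Exp commutativeSemiring public
    using () renaming (_^_ to _^ᴿ_)
  open IntegerCoefficients commutativeRing fromInt fromInt-hom public
  open Algebra.Properties.Semiring.Sum semiring public
    using (sum-cong-≋; sum-replicate-zero; ∑-comm; *-distribˡ-sum; *-distribʳ-sum)
  open import Relation.Binary.Reasoning.Setoid setoid public
  private
    module ι = RingMorphisms.IsRingHomomorphism ι-hom
    module H = HeytingField heytingField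

  1≉0 : ¬ 1# ≈ 0#
  1≉0 1≈0 = H.#-irrefl ≈-refl (H.invertible⇒# {0#} {0#} (0# , collapse _ , collapse _))
    where
    collapse : ∀ x → x ≈ 1#
    collapse x = ≈-trans (≈-sym (*-identityʳ x)) (≈-trans (*-congˡ 1≈0) (≈-trans (zeroʳ x) (≈-sym 1≈0)))

  inverse : ∀ {x} → ¬ x ≈ 0# → Σ[ y ∈ Carrier ] x * y ≈ 1#
  inverse {x} x≉0 =
    let y , _ , h = H.#⇒invertible {x} {0#} (decidable-stable (decide em _) λ ¬# → x≉0 (proj₁ (H.tight x 0#) ¬#))
    in y , ≈-trans (*-congʳ (≈-trans (≈-sym (+-identityʳ x)) (+-congˡ (≈-sym (≈-trans (≈-sym (+-identityˡ _)) (-‿inverseʳ 0#)))))) h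

  no-zero-divisor : ∀ {x y} → ¬ x ≈ 0# → x * y ≈ 0# → y ≈ 0#
  no-zero-divisor {x} {y} x≉0 xy≈0 = let z , xz≈1 = inverse x≉0 in begin
    y ≈⟨ ≈-sym (*-identityˡ y) ⟩
    1# * y ≈⟨ *-congʳ (≈-sym xz≈1) ⟩
    (x * z) * y ≈⟨ solve 3 (λ x z y → (x :* z) :* y := z :* (x :* y)) ≈-refl x z y ⟩
    z * (x * y) ≈⟨ *-congˡ xy≈0 ⟩
    z * 0# ≈⟨ zeroʳ z ⟩
    0# ∎

  *-cancelˡ : ∀ {x y z} → ¬ x ≈ 0# → x * y ≈ x * z → y ≈ z
  *-cancelˡ = cancelˡ no-zero-divisor

  fromInt-injective : ∀ {z} → fromInt z ≈ 0# → z ≡ 0ℤ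
  fromInt-injective {z} h = decidable-stable (z ℤ.≟ 0ℤ) λ z≢0 →
    let instance nonZero = ℚ.≢-nonZero {fromℤ z} (λ e → z≢0 (cong ℚ.numerator e))
    in 1≉0 (begin
      1# ≈⟨ ≈-sym ι.1#-homo ⟩
      ι ℚ.1ℚ ≈⟨ ι.⟦⟧-cong (≡.sym (ℚ.*-inverseʳ (fromℤ z))) ⟩
      ι (fromℤ z ℚ.* ℚ.1/ fromℤ z) ≈⟨ ι.*-homo _ _ ⟩
      fromInt z * ι (ℚ.1/ fromℤ z) ≈⟨ ≈-trans (*-congʳ h) (zeroˡ _) ⟩
      0# ∎)

  fromInt≉0 : ∀ {z} → z ≢ 0ℤ → ¬ fromInt z ≈ 0#
  fromInt≉0 z≢0 h = z≢0 (fromInt-injective h)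

  dimension : ℕ
  dimension = proj₁ finite-dimensional

  private
    clear-denominator : ∀ q → Σ[ d ∈ ℕ ] Σ[ z ∈ ℤ ] fromℤ (+ suc d) ℚ.* q ≡ fromℤ z
    clear-denominator (ℚ.mkℚ z d c) = d , z , ℚ.toℚᵘ-injective
      (ℚᵘ.≃-trans (ℚ.toℚᵘ-homo-* (fromℤ (+ suc d)) (ℚ.mkℚ z d c)) (ℚᵘ.*≡* (commute (+ suc d) z)))
      where
      commute : ∀ d z → d ℤ.* z ℤ.* 1ℤ ≡ z ℤ.* (1ℤ ℤ.* d)
      commute = ℤ-ring

    Cleared : ℚ → ℕ → Set
    Cleared q d = Σ[ z ∈ ℤ ] fromInt (+ d) * ι q ≈ fromInt z

    cleared : ∀ q → Σ[ d ∈ ℕ ] Cleared q (suc d)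
    cleared q = let d , z , h = clear-denominator q in d , z , ≈-trans (≈-sym (ι.*-homo _ _)) (ι.⟦⟧-cong h)

    cleared-∣ : ∀ q {d e} → d ∣ e → Cleared q d → Cleared q e
    cleared-∣ q {d} (∣.divides k refl) (z , h) = + k ℤ.* z , (begin
      fromInt (+ (k ℕ.* d)) * ι q ≈⟨ *-congʳ (≈-trans (φ-cong (ℤ.pos-* k d)) (φ-* (+ k) (+ d))) ⟩
      (fromInt (+ k) * fromInt (+ d)) * ι q ≈⟨ *-assoc _ _ _ ⟩
      fromInt (+ k) * (fromInt (+ d) * ι q) ≈⟨ *-congˡ h ⟩
      fromInt (+ k) * fromInt z ≈⟨ ≈-sym (φ-* (+ k) z) ⟩
      fromInt (+ k ℤ.* z) ∎)

    fromInt-sum : ∀ {n} (f : Fin n → ℤ) → sum (λ i → fromInt (f i)) ≈ fromInt (ℤΣ.sum f)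
    fromInt-sum {zero}  f = ≈-sym φ-0
    fromInt-sum {suc n} f = ≈-trans (+-congˡ (fromInt-sum (f ∘ suc))) (≈-sym (φ-+ (f zero) _))

  dependent : (v : Fin (suc dimension) → Carrier) →
    Σ[ c ∈ (Fin (suc dimension) → ℤ) ] (∃[ i ] c i ≢ 0ℤ) × sum (λ i → fromInt (c i) * v i) ≈ 0#
  dependent v = c , nonzero , no-zero-divisor (fromInt≉0 {+ suc d} λ ()) (begin
    D * sum (λ j → fromInt (c j) * v j)
      ≈⟨ *-distribˡ-sum D (λ j → fromInt (c j) * v j) ⟩
    sum (λ j → D * (fromInt (c j) * v j))
      ≈⟨ sum-cong-≋ (λ j → ≈-trans (solve 3 (λ d c x → d :* (c :* x) := c :* (d :* x)) ≈-refl D (fromInt (c j)) (v j))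
           (≈-trans (*-congˡ (row j)) (*-distribˡ-sum (fromInt (c j)) (λ i → fromInt (m j i) * b i)))) ⟩
    sum (λ j → sum (λ i → fromInt (c j) * (fromInt (m j i) * b i)))
      ≈⟨ ∑-comm (λ j i → fromInt (c j) * (fromInt (m j i) * b i)) ⟩
    sum (λ i → sum (λ j → fromInt (c j) * (fromInt (m j i) * b i)))
      ≈⟨ sum-cong-≋ column ⟩
    sum {n} (λ _ → 0#)
      ≈⟨ sum-replicate-zero n ⟩
    0# ∎)
    where
    n = dimension
    b = proj₁ (proj₂ finite-dimensional)
    q : Fin (suc n) → Fin n → ℚ
    q j = proj₁ (proj₂ (proj₂ finite-dimensional) (v j))
    v≈ : ∀ j → v j ≈ sum (λ i → ι (q j i) * b i)
    v≈ j = proj₂ (proj₂ (proj₂ finite-dimensional) (v j))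
    common : Σ[ d ∈ ℕ ] (∀ j i → Cleared (q j i) (suc d))
    common = common-multiple (λ j d → ∀ i → Cleared (q j i) d) (λ j d∣e h i → cleared-∣ (q j i) d∣e (h i))
      (λ j → common-multiple (λ i → Cleared (q j i)) (λ i → cleared-∣ (q j i)) (λ i → cleared (q j i)))
    d = proj₁ common
    D = fromInt (+ suc d)
    m : Fin (suc n) → Fin n → ℤ
    m j i = proj₁ (proj₂ common j i)
    relation = linearly-dependent n m
    c = proj₁ relation
    nonzero = proj₁ (proj₂ relation)
    row : ∀ j → D * v j ≈ sum (λ i → fromInt (m j i) * b i)
    row j = begin
      D * v j ≈⟨ *-congˡ (v≈ j) ⟩
      D * sum (λ i → ι (q j i) * b i) ≈⟨ *-distribˡ-sum D (λ i → ι (q j i) * b i) ⟩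
      sum (λ i → D * (ι (q j i) * b i)) ≈⟨ sum-cong-≋ (λ i → ≈-trans (≈-sym (*-assoc D (ι (q j i)) (b i))) (*-congʳ (proj₂ (proj₂ common j i)))) ⟩
      sum (λ i → fromInt (m j i) * b i) ∎
    column : ∀ i → sum (λ j → fromInt (c j) * (fromInt (m j i) * b i)) ≈ 0#
    column i = begin
      sum (λ j → fromInt (c j) * (fromInt (m j i) * b i))
        ≈⟨ sum-cong-≋ (λ j → ≈-trans (≈-sym (*-assoc (fromInt (c j)) (fromInt (m j i)) (b i))) (*-congʳ (≈-sym (φ-* (c j) (m j i))))) ⟩
      sum (λ j → fromInt (c j ℤ.* m j i) * b i)
        ≈⟨ ≈-sym (*-distribʳ-sum (b i) (λ j → fromInt (c j ℤ.* m j i))) ⟩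
      sum (λ j → fromInt (c j ℤ.* m j i)) * b i
        ≈⟨ *-congʳ (≈-trans (fromInt-sum (λ j → c j ℤ.* m j i)) (≈-trans (φ-cong (proj₂ (proj₂ relation) i)) φ-0)) ⟩
      0# * b i ≈⟨ zeroˡ (b i) ⟩
      0# ∎

  private
    ⟦⟧-∷ʳ : ∀ {n} (p : Vec ℤ n) c x → ⟦ p Vec.∷ʳ c ⟧ x ≈ ⟦ p ⟧ x + fromInt c * x ^ᴿ n
    ⟦⟧-∷ʳ []      c x = begin
      fromInt c + x * 0# ≈⟨ +-congˡ (zeroʳ x) ⟩
      fromInt c + 0# ≈⟨ +-comm _ _ ⟩
      0# + fromInt c ≈⟨ +-congˡ (≈-sym (*-identityʳ _)) ⟩
      0# + fromInt c * 1# ∎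
    ⟦⟧-∷ʳ {suc n} (a ∷ p) c x = ≈-trans (+-congˡ (*-congˡ (⟦⟧-∷ʳ p c x)))
      (solve 5 (λ a x u c t → a :+ x :* (u :+ c :* t) := (a :+ x :* u) :+ c :* (x :* t)) ≈-refl (fromInt a) x (⟦ p ⟧ x) (fromInt c) (x ^ᴿ n))

    scale : ∀ {n} → ℤ → Vec ℤ n → Vec ℤ n
    scale         c []      = []
    scale {suc n} c (a ∷ p) = a ℤ.* c ℤ.^ n ∷ scale c p

    power : ∀ c n → fromInt (c ℤ.^ n) ≈ fromInt c ^ᴿ n
    power c zero    = φ-1
    power c (suc n) = ≈-trans (φ-* c (c ℤ.^ n)) (*-congˡ (power c n))

    ^-distrib : ∀ x y n → (x * y) ^ᴿ n ≈ x ^ᴿ n * y ^ᴿ n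
    ^-distrib x y zero    = ≈-sym (*-identityˡ 1#)
    ^-distrib x y (suc n) = ≈-trans (*-congˡ (^-distrib x y n))
      (solve 4 (λ x y s t → (x :* y) :* (s :* t) := (x :* s) :* (y :* t)) ≈-refl x y (x ^ᴿ n) (y ^ᴿ n))

    ⟦⟧-scale : ∀ {n} c (p : Vec ℤ n) x → fromInt c * ⟦ scale c p ⟧ (fromInt c * x) ≈ fromInt c ^ᴿ n * ⟦ p ⟧ x
    ⟦⟧-scale c []      x = ≈-trans (zeroʳ _) (≈-sym (zeroʳ _))
    ⟦⟧-scale {suc n} c (a ∷ p) x = begin
      C * (fromInt (a ℤ.* c ℤ.^ n) + (C * x) * ⟦ scale c p ⟧ (C * x))
        ≈⟨ *-congˡ (+-congʳ (≈-trans (φ-* a (c ℤ.^ n)) (*-congˡ (power c n)))) ⟩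
      C * (fromInt a * C ^ᴿ n + (C * x) * ⟦ scale c p ⟧ (C * x))
        ≈⟨ solve 5 (λ c a t x s → c :* (a :* t :+ (c :* x) :* s) := (c :* t) :* a :+ (c :* x) :* (c :* s)) ≈-refl C (fromInt a) (C ^ᴿ n) x (⟦ scale c p ⟧ (C * x)) ⟩
      (C * C ^ᴿ n) * fromInt a + (C * x) * (C * ⟦ scale c p ⟧ (C * x))
        ≈⟨ +-congˡ (*-congˡ (⟦⟧-scale c p x)) ⟩
      (C * C ^ᴿ n) * fromInt a + (C * x) * (C ^ᴿ n * ⟦ p ⟧ x)
        ≈⟨ solve 5 (λ c a t x s → (c :* t) :* a :+ (c :* x) :* (t :* s) := (c :* t) :* (a :+ x :* s)) ≈-refl C (fromInt a) (C ^ᴿ n) x (⟦ p ⟧ x) ⟩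
      (C * C ^ᴿ n) * (fromInt a + x * ⟦ p ⟧ x) ∎
      where C = fromInt c

    leading : ∀ {n} (p : Vec ℤ n) c x → c ≢ 0ℤ → ⟦ p ⟧ x + fromInt c * x ^ᴿ n ≈ 0# → Integral (fromInt c * x)
    leading {n} p c x c≢0 root = n , scale c p , no-zero-divisor (fromInt≉0 c≢0) (begin
      C * ((C * x) ^ᴿ n + ⟦ scale c p ⟧ (C * x))
        ≈⟨ distribˡ _ _ _ ⟩
      C * (C * x) ^ᴿ n + C * ⟦ scale c p ⟧ (C * x)
        ≈⟨ +-cong (*-congˡ (^-distrib C x n)) (⟦⟧-scale c p x) ⟩
      C * (C ^ᴿ n * x ^ᴿ n) + C ^ᴿ n * ⟦ p ⟧ x
        ≈⟨ solve 4 (λ c t y s → c :* (t :* y) :+ t :* s := t :* (s :+ c :* y)) ≈-refl C (C ^ᴿ n) (x ^ᴿ n) (⟦ p ⟧ x) ⟩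
      C ^ᴿ n * (⟦ p ⟧ x + C * x ^ᴿ n)
        ≈⟨ ≈-trans (*-congˡ root) (zeroʳ _) ⟩
      0# ∎)
      where C = fromInt c

    integral-multiple-of-root : ∀ n (p : Vec ℤ n) x → ¬ (∀ i → Vec.lookup p i ≡ 0ℤ) → ⟦ p ⟧ x ≈ 0# → Σ[ c ∈ ℤ ] c ≢ 0ℤ × Integral (fromInt c * x)
    integral-multiple-of-root zero    []  x p≢0 root = contradiction (λ ()) p≢0
    integral-multiple-of-root (suc n) p   x p≢0 root with Vec.initLast p
    ... | p′ , c , refl with c ℤ.≟ 0ℤ
    ...   | no  c≢0  = c , c≢0 , leading p′ c x c≢0 (≈-trans (≈-sym (⟦⟧-∷ʳ p′ c x)) root)
    ...   | yes refl = integral-multiple-of-root n p′ x (λ h → p≢0 (zeros p′ h)) (begin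
      ⟦ p′ ⟧ x ≈⟨ solve 2 (λ u t → u := u :+ con 0ℤ :* t) ≈-refl (⟦ p′ ⟧ x) (x ^ᴿ n) ⟩
      ⟦ p′ ⟧ x + fromInt 0ℤ * x ^ᴿ n ≈⟨ ≈-sym (⟦⟧-∷ʳ p′ 0ℤ x) ⟩
      ⟦ p′ Vec.∷ʳ 0ℤ ⟧ x ≈⟨ root ⟩
      0# ∎)
      where
      zeros : ∀ {n} (p : Vec ℤ n) → (∀ i → Vec.lookup p i ≡ 0ℤ) → ∀ i → Vec.lookup (p Vec.∷ʳ 0ℤ) i ≡ 0ℤ
      zeros []      h zero    = refl
      zeros (a ∷ p) h zero    = h zero
      zeros (a ∷ p) h (suc i) = zeros p (h ∘ suc) i

  integral-multiple : ∀ x → Σ[ c ∈ ℤ ] c ≢ 0ℤ × Integral (fromInt c * x)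
  integral-multiple x =
    let c , (i , cᵢ≢0) , rel = dependent (λ i → x ^ᴿ Fin.toℕ i)
    in integral-multiple-of-root _ (Vec.tabulate c) x (λ zeros → cᵢ≢0 (≡.trans (≡.sym (lookup∘tabulate c i)) (zeros i)))
         (≈-trans (≈-sym (⟦⟧-tabulate c x)) rel)

module RingOfIntegers (em : ExcludedMiddle (lsuc 0ℓ)) (F : NumberField) where
  open Field em F
  private
    module 𝒪 = CommutativeRing (𝒪 F)
    open Algebra.Properties.CommutativeSemiring.Exp 𝒪.commutativeSemiring using () renaming (_^_ to _^𝒪_)
    module Σ𝒪 = Algebra.Properties.Semiring.Sum 𝒪.semiring

  int-hom : RingMorphisms.IsRingHomomorphism (CommutativeRing.rawRing ℤ.+-*-commutativeRing) (CommutativeRing.rawRing (𝒪 F)) (int F)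
  int-hom = record
    { isSemiringHomomorphism = record
      { isNearSemiringHomomorphism = record
        { +-isMonoidHomomorphism = record
          { isMagmaHomomorphism = record
            { isRelHomomorphism = record { cong = φ-cong }
            ; homo = φ-+
            }
          ; ε-homo = φ-0
          }
        ; *-homo = φ-*
        }
      ; 1#-homo = φ-1
      }
    ; -‿homo = φ-neg
    }

  private
    module I = Integrality (𝒪 F) (int F) int-hom

    ^-proj : ∀ x n → proj₁ (x ^𝒪 n) ≈ proj₁ x ^ᴿ n
    ^-proj x zero    = ≈-refl
    ^-proj x (suc n) = *-congˡ (^-proj x n)

    ⟦⟧-proj : ∀ {n} (p : Vec ℤ n) x → proj₁ (I.⟦ p ⟧ x) ≈ ⟦ p ⟧ (proj₁ x)
    ⟦⟧-proj []      x = ≈-refl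
    ⟦⟧-proj (a ∷ p) x = +-congˡ (*-congˡ (⟦⟧-proj p x))

    sum-proj : ∀ {n} (f : Fin n → ∣𝒪 F ∣) → proj₁ (Σ𝒪.sum f) ≈ sum (λ i → proj₁ (f i))
    sum-proj {zero}  f = ≈-refl
    sum-proj {suc n} f = +-congˡ (sum-proj (f ∘ suc))

  numberRing : NumberRing
  numberRing = record
    { commutativeRing = 𝒪 F
    ; φ               = int F
    ; φ-hom           = int-hom
    ; 1≉0             = 1≉0
    ; no-zero-divisor = no-zero-divisor
    ; φ-injective     = fromInt-injective
    ; integral        = λ x → let n , p , h = proj₂ x in n , p , ≈-trans (+-cong (^-proj x n) (⟦⟧-proj p x)) h
    ; rank            = dimension
    ; dependent       = λ v → let c , nonzero , h = dependent (λ i → proj₁ (v i)) in c , nonzero , ≈-trans (sum-proj (λ i → int F (c i) 𝒪.* v i)) h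
    }

module FieldHomomorphism (em : ExcludedMiddle (lsuc 0ℓ)) (K L : NumberField) (A : ∣𝒪 K ∣ → ∣𝒪 L ∣)
  (A-cong : ∀ {x y} → NumberField._≈_ K (proj₁ x) (proj₁ y) → NumberField._≈_ L (proj₁ (A x)) (proj₁ (A y)))
  (A-+ : ∀ x y → NumberField._≈_ L (proj₁ (A (CommutativeRing._+_ (𝒪 K) x y))) (NumberField._+_ L (proj₁ (A x)) (proj₁ (A y))))
  (A-int : ∀ z x → NumberField._≈_ L (proj₁ (A (CommutativeRing._*_ (𝒪 K) (int K z) x))) (NumberField._*_ L (NumberField.fromInt L z) (proj₁ (A x))))
  where
  private
    module K = Field em K
    module L = Field em L
    module 𝒪K = CommutativeRing (𝒪 K)
    a : ∣𝒪 K ∣ → L.Carrier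
    a x = proj₁ (A x)
    a₁ = a 𝒪K.1#
  open import Relation.Binary.Reasoning.Setoid L.setoid

  module _ (multiple : ∀ x → Σ[ c ∈ ℤ ] c ≢ 0ℤ × K.Integral (K.fromInt c K.* x)) (a₁≉0 : ¬ a₁ L.≈ L.0#)
    (multiplicative : ∀ x y → a (x 𝒪K.* y) L.* a₁ L.≈ a x L.* a y) where

    private
      numer : K.Carrier → ∣𝒪 K ∣
      numer x = K.fromInt (proj₁ (multiple x)) K.* x , proj₂ (proj₂ (multiple x))

      denominator≉0 : ∀ {c} → c ≢ 0ℤ → ¬ L.fromInt c L.* a₁ L.≈ L.0#
      denominator≉0 c≢0 h = a₁≉0 (L.no-zero-divisor (L.fromInt≉0 c≢0) h)

    τ : K.Carrier → L.Carrier
    τ x = a (numer x) L.* proj₁ (L.inverse (denominator≉0 (proj₁ (proj₂ (multiple x)))))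

    τ-spec : ∀ {x c} (u : ∣𝒪 K ∣) → proj₁ u K.≈ K.fromInt c K.* x → τ x L.* (L.fromInt c L.* a₁) L.≈ a u
    τ-spec {x} {c} u u≈cx = L.*-cancelˡ (L.fromInt≉0 c₀≢0) (begin
      L.fromInt c₀ L.* (τ x L.* (L.fromInt c L.* a₁))
        ≈⟨ L.solve 4 (λ c₀ t c o → c₀ L.:* (t L.:* (c L.:* o)) L.:= c L.:* (t L.:* (c₀ L.:* o))) L.≈-refl (L.fromInt c₀) (τ x) (L.fromInt c) a₁ ⟩
      L.fromInt c L.* (τ x L.* (L.fromInt c₀ L.* a₁))
        ≈⟨ L.*-congˡ cancel ⟩
      L.fromInt c L.* a (numer x)
        ≈⟨ L.≈-sym (A-int c (numer x)) ⟩
      a (int K c 𝒪K.* numer x)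
        ≈⟨ A-cong (K.≈-trans (K.solve 3 (λ c c₀ x → c K.:* (c₀ K.:* x) K.:= c₀ K.:* (c K.:* x)) K.≈-refl (K.fromInt c) (K.fromInt c₀) x) (K.*-congˡ (K.≈-sym u≈cx))) ⟩
      a (int K c₀ 𝒪K.* u)
        ≈⟨ A-int c₀ u ⟩
      L.fromInt c₀ L.* a u ∎)
      where
      c₀ = proj₁ (multiple x)
      c₀≢0 = proj₁ (proj₂ (multiple x))
      cancel : τ x L.* (L.fromInt c₀ L.* a₁) L.≈ a (numer x)
      cancel = let i , h = L.inverse (denominator≉0 c₀≢0) in
        L.≈-trans (L.*-assoc _ _ _) (L.≈-trans (L.*-congˡ (L.≈-trans (L.*-comm _ _) h)) (L.*-identityʳ _))

    τ-unique : ∀ {x c t} (u : ∣𝒪 K ∣) → c ≢ 0ℤ → proj₁ u K.≈ K.fromInt c K.* x → (L.fromInt c L.* a₁) L.* t L.≈ a u → τ x L.≈ t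
    τ-unique {x} {c} {t} u c≢0 u≈cx h = L.*-cancelˡ (denominator≉0 {c} c≢0) (L.≈-trans (L.*-comm (L.fromInt c L.* a₁) (τ x)) (L.≈-trans (τ-spec {x} {c} u u≈cx) (L.≈-sym h)))

    private
      τ-numer : ∀ x → τ x L.* (L.fromInt (proj₁ (multiple x)) L.* a₁) L.≈ a (numer x)
      τ-numer x = τ-spec {x} {proj₁ (multiple x)} (numer x) K.≈-refl

      fromInt-1 : ∀ {x} → x K.≈ K.fromInt 1ℤ K.* x
      fromInt-1 = K.≈-trans (K.≈-sym (K.*-identityˡ _)) (K.*-congʳ (K.≈-sym K.φ-1))

      *≢0 : ∀ x y → proj₁ (multiple x) ℤ.* proj₁ (multiple y) ≢ 0ℤ
      *≢0 x y h = [ proj₁ (proj₂ (multiple x)) , proj₁ (proj₂ (multiple y)) ]′ (ℤ.i*j≡0⇒i≡0∨j≡0 (proj₁ (multiple x)) h)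

    τ-cong : ∀ {x y} → x K.≈ y → τ x L.≈ τ y
    τ-cong {x} {y} x≈y = τ-unique {c = proj₁ (multiple y)} (numer y) (proj₁ (proj₂ (multiple y))) (K.*-congˡ (K.≈-sym x≈y)) (L.≈-trans (L.*-comm _ (τ y)) (τ-numer y))

    τ-0 : τ K.0# L.≈ L.0#
    τ-0 = τ-unique {c = 1ℤ} 𝒪K.0# (λ ()) fromInt-1 (L.≈-trans (L.zeroʳ _) (L.≈-sym a-0))
      where
      a-0 : a 𝒪K.0# L.≈ L.0#
      a-0 = begin
        a 𝒪K.0# ≈⟨ A-cong (K.≈-sym (K.zeroʳ (K.fromInt 0ℤ))) ⟩
        a (int K 0ℤ 𝒪K.* 𝒪K.0#) ≈⟨ A-int 0ℤ 𝒪K.0# ⟩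
        L.fromInt 0ℤ L.* a 𝒪K.0# ≈⟨ L.≈-trans (L.*-congʳ L.φ-0) (L.zeroˡ _) ⟩
        L.0# ∎

    τ-1 : τ K.1# L.≈ L.1#
    τ-1 = τ-unique {c = 1ℤ} 𝒪K.1# (λ ()) fromInt-1 (L.≈-trans (L.*-identityʳ _) (L.≈-trans (L.*-congʳ L.φ-1) (L.*-identityˡ _)))

    τ-neg : ∀ x → τ (K.- x) L.≈ L.- τ x
    τ-neg x = τ-unique {c = c} (int K -1ℤ 𝒪K.* numer x) (proj₁ (proj₂ (multiple x)))
      (K.solve 2 (λ c x → K.con -1ℤ K.:* (c K.:* x) K.:= c K.:* (K.:- x)) K.≈-refl (K.fromInt c) x) (begin
      (L.fromInt c L.* a₁) L.* (L.- τ x)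
        ≈⟨ L.solve 3 (λ c o t → (c L.:* o) L.:* (L.:- t) L.:= L.con -1ℤ L.:* (t L.:* (c L.:* o))) L.≈-refl (L.fromInt c) a₁ (τ x) ⟩
      L.fromInt -1ℤ L.* (τ x L.* (L.fromInt c L.* a₁))
        ≈⟨ L.*-congˡ (τ-numer x) ⟩
      L.fromInt -1ℤ L.* a (numer x)
        ≈⟨ L.≈-sym (A-int -1ℤ (numer x)) ⟩
      a (int K -1ℤ 𝒪K.* numer x) ∎)
      where c = proj₁ (multiple x)

    τ-+ : ∀ x y → τ (x K.+ y) L.≈ τ x L.+ τ y
    τ-+ x y = τ-unique {c = c ℤ.* d} u (*≢0 x y)
      (K.≈-trans (K.solve 4 (λ c d x y → d K.:* (c K.:* x) K.:+ c K.:* (d K.:* y) K.:= (c K.:* d) K.:* (x K.:+ y)) K.≈-refl (K.fromInt c) (K.fromInt d) x y)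
        (K.*-congʳ (K.≈-sym (K.φ-* c d))))
      (begin
        (L.fromInt (c ℤ.* d) L.* a₁) L.* (τ x L.+ τ y)
          ≈⟨ L.*-congʳ (L.*-congʳ (L.φ-* c d)) ⟩
        ((L.fromInt c L.* L.fromInt d) L.* a₁) L.* (τ x L.+ τ y)
          ≈⟨ L.solve 5 (λ c d o s t → ((c L.:* d) L.:* o) L.:* (s L.:+ t) L.:= d L.:* (s L.:* (c L.:* o)) L.:+ c L.:* (t L.:* (d L.:* o))) L.≈-refl
               (L.fromInt c) (L.fromInt d) a₁ (τ x) (τ y) ⟩
        L.fromInt d L.* (τ x L.* (L.fromInt c L.* a₁)) L.+ L.fromInt c L.* (τ y L.* (L.fromInt d L.* a₁))
          ≈⟨ L.+-cong (L.*-congˡ (τ-numer x)) (L.*-congˡ (τ-numer y)) ⟩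
        L.fromInt d L.* a (numer x) L.+ L.fromInt c L.* a (numer y)
          ≈⟨ L.≈-sym (L.+-cong (A-int d (numer x)) (A-int c (numer y))) ⟩
        a (int K d 𝒪K.* numer x) L.+ a (int K c 𝒪K.* numer y)
          ≈⟨ L.≈-sym (A-+ (int K d 𝒪K.* numer x) (int K c 𝒪K.* numer y)) ⟩
        a u ∎)
      where
      c = proj₁ (multiple x)
      d = proj₁ (multiple y)
      u = (int K d 𝒪K.* numer x) 𝒪K.+ (int K c 𝒪K.* numer y)

    τ-* : ∀ x y → τ (x K.* y) L.≈ τ x L.* τ y
    τ-* x y = τ-unique {c = c ℤ.* d} u (*≢0 x y)
      (K.≈-trans (K.solve 4 (λ c d x y → (c K.:* x) K.:* (d K.:* y) K.:= (c K.:* d) K.:* (x K.:* y)) K.≈-refl (K.fromInt c) (K.fromInt d) x y)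
        (K.*-congʳ (K.≈-sym (K.φ-* c d))))
      (L.*-cancelˡ a₁≉0 (begin
        a₁ L.* ((L.fromInt (c ℤ.* d) L.* a₁) L.* (τ x L.* τ y))
          ≈⟨ L.*-congˡ (L.*-congʳ (L.*-congʳ (L.φ-* c d))) ⟩
        a₁ L.* (((L.fromInt c L.* L.fromInt d) L.* a₁) L.* (τ x L.* τ y))
          ≈⟨ L.solve 5 (λ c d o s t → o L.:* (((c L.:* d) L.:* o) L.:* (s L.:* t)) L.:= (s L.:* (c L.:* o)) L.:* (t L.:* (d L.:* o))) L.≈-refl
               (L.fromInt c) (L.fromInt d) a₁ (τ x) (τ y) ⟩
        (τ x L.* (L.fromInt c L.* a₁)) L.* (τ y L.* (L.fromInt d L.* a₁))
          ≈⟨ L.*-cong (τ-numer x) (τ-numer y) ⟩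
        a (numer x) L.* a (numer y)
          ≈⟨ L.≈-sym (multiplicative (numer x) (numer y)) ⟩
        a u L.* a₁
          ≈⟨ L.*-comm _ _ ⟩
        a₁ L.* a u ∎))
      where
      c = proj₁ (multiple x)
      d = proj₁ (multiple y)
      u = numer x 𝒪K.* numer y

    τ-isFieldHomomorphism : IsFieldHomomorphism K L τ
    τ-isFieldHomomorphism = record
      { isSemiringHomomorphism = record
        { isNearSemiringHomomorphism = record
          { +-isMonoidHomomorphism = record
            { isMagmaHomomorphism = record
              { isRelHomomorphism = record { cong = τ-cong }
              ; homo = τ-+
              }
            ; ε-homo = τ-0
            }
          ; *-homo = τ-*
          }
        ; 1#-homo = τ-1
        }
      ; -‿homo = τ-neg
      }

    factorisation : ∀ x → a x L.≈ a₁ L.* τ (proj₁ x)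
    factorisation x = L.≈-sym (L.≈-trans (L.*-comm _ _) (L.≈-trans
      (L.*-congˡ (L.≈-sym (L.≈-trans (L.*-congʳ L.φ-1) (L.*-identityˡ _)))) (τ-spec {c = 1ℤ} x fromInt-1)))

theorem1p2 : ExcludedMiddle (lsuc 0ℓ) →
    (K L : NumberField) (k l : ℕ) → 2 ℕ.≤ k → 2 ℕ.≤ l →
    (A : ∣𝒪 K ∣ → ∣𝒪 L ∣) → IsℤLinear K L A →
    let a = ∀ x → x ∈ V K k → A x ∈ V L l
        b = ∀ p → Prime p → ∀ x →
              class K (p ℕ.^ k) x ∈ V-mod K k p →
              class L (p ℕ.^ l) (A x) ∈ V-mod L l p
        c = Σ[ τ ∈ (∣ K ∣ → ∣ L ∣) ] IsFieldHomomorphism K L τ ×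
            (Σ[ ε ∈ ∣𝒪 L ∣ ] (∀ x → NumberField._≈_ L (proj₁ (A x)) (M L ε (τ (proj₁ x)))))
    in (a ⇔ b) × (b → c)
theorem1p2 em K L k (suc l) 2≤k 2≤l A linear =
  mk⇔ (P.global⇒local A ⟦⟧-cong +ᴹ-homo A-multiple {k} {suc l} 2≤k) (P.local⇒global {k} {suc l} A) , λ local →
    let a₁≉0 = P.A-injective A ⟦⟧-cong +ᴹ-homo A-multiple k l 1≤k local (Field.1≉0 em K)
        multiplicative = P.multiplicative A ⟦⟧-cong +ᴹ-homo A-multiple k l 1≤k local
    in F.τ multiple a₁≉0 multiplicative ,
       F.τ-isFieldHomomorphism multiple a₁≉0 multiplicative ,
       A (CommutativeRing.1# (𝒪 K)) ,
       F.factorisation multiple a₁≉0 multiplicative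
  where
  open LeftModuleMorphisms.IsLeftModuleHomomorphism linear using (+ᴹ-homo; *ₗ-homo; ⟦⟧-cong)
  N₁ = RingOfIntegers.numberRing em K
  N₂ = RingOfIntegers.numberRing em L
  module P = Preserver em N₁ N₂ (coordinates em N₁) (coordinates em N₂)
  module F = FieldHomomorphism em K L A ⟦⟧-cong +ᴹ-homo *ₗ-homo
  A-multiple : ∀ z {x y} → NumberField._≈_ K (proj₁ y) (NumberField._*_ K (NumberField.fromInt K z) (proj₁ x)) →
    NumberField._≈_ L (proj₁ (A y)) (NumberField._*_ L (NumberField.fromInt L z) (proj₁ (A x)))
  A-multiple z {x} {y} e = NumberField.trans L (⟦⟧-cong {y} {CommutativeRing._*_ (𝒪 K) (int K z) x} e) (*ₗ-homo z x)
  multiple = Field.integral-multiple em K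
  1≤k = ℕ.≤-trans (ℕ.n≤1+n 1) 2≤k
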